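{- For each $n\geq1$ and all real $\beta,J>0$, $$2(e^{2\beta J}-1)^{|V(\Gamma_n)|-1}e^{ -\beta J|E(\Gamma_n)|}\,T_n\!\left(\frac{e^{2\beta J}+1}{e^{2\beta J}-1},e^{2\beta J}\right)=2^{\frac{3^n+3}{2}}\cosh(\beta J)^{3^n}\,\Phi_n(\tanh(\beta J)),$$ where $\Phi_n(z)=z^{3^n/2}\prod_{k=1}^n\phi_k(z)^{3^{n-k}}\,(\phi_{n+1}(z)-1)$ with $\phi_1(z)=\frac{z+1}{z^{1/2}}$, $\phi_2(z)=\frac{z^2+1}{z}$, $\phi_k=\phi_{k-1}^2-3\phi_{k-1}+4$ for $k\ge3$. (The right-hand side is the partition function $Z_n=\sum_{\sigma\in\{\pm1\}^{V(\Gamma_n)}}\exp(\beta J\sum_{\{i,j\}\in E(\Gamma_n)}\sigma_i\sigma_j)$ of the Ising model on $\Gamma_n$.)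
   Context: Graphs are finite; for a graph $G$ and spanning subgraph $A$ (vertex set $V(G)$, edge set $E(A)\subseteq E(G)$), $k(A)$ is its number of components, $r(A)=|V(G)|-k(A)$, $n(A)=|E(A)|-r(A)$, and the Tutte polynomial is $T(G;x,y)=\sum_A(x-1)^{r(G)-r(A)}(y-1)^{n(A)}$. Sierpiński graphs $\Gamma_n$ ($n\ge1$), each with three outmost vertices top, left, right: $\Gamma_1$ is the triangle $K_3$; $\Gamma_{n+1}$ is obtained from three disjoint copies $G_1,G_2,G_3$ of $\Gamma_n$ by identifying left$(G_1)$ with top$(G_2)$, right$(G_1)$ with top$(G_3)$, right$(G_2)$ with left$(G_3)$; its outmost vertices are top$(G_1)$, left$(G_2)$, right$(G_3)$. $|V(\Gamma_n)|=(3^n+3)/2$, $|E(\Gamma_n)|=3^n$, and $T_n(x,y)=T(\Gamma_n;x,y)$. -}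

module Defs where

open import Data.Empty using (⊥-elim)
open import Data.Fin.Base using (Fin; splitAt; combine; _↑ʳ_)
open import Data.Fin.Patterns using (0F; 1F; 2F; 3F; 4F; 5F)
import Data.Fin.Properties as Fin
import Data.Integer.Base as ℤ
import Data.Integer.Properties as ℤ
open import Data.List.Base using (List; []; _∷_; _++_; map; foldr; length; allFin; deduplicate; concatMap)
open import Data.List.Membership.Propositional using (_∈_)
open import Data.List.Relation.Unary.Any using (here; there)
open import Data.Nat.Base as ℕ using (ℕ; zero; suc)
import Data.Nat.Properties as ℕ
open import Data.Product.Base using (∃; _×_; _,_; proj₁; proj₂)
open import Data.Rational.Base using (ℚ; mkℚ; 0ℚ; 1ℚ; ½; _+_; _*_; _-_; -_; _/_; _≤_; _<_; *≤*; ∣_∣; ↥_; 1/_; nonNegative; positive; ≢-nonZero; toℚᵘ)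
open import Data.Rational.Properties
import Data.Rational.Unnormalised.Base as ℚᵘ
import Data.Rational.Unnormalised.Properties as ℚᵘ
open import Data.Rational.Solver using (module +-*-Solver)
open import Data.Sign.Base using (Sign)
open import Data.Sum.Base using (_⊎_; inj₁; inj₂; [_,_]′)
open import Data.Vec.Base using (Vec; []; _∷_; lookup)
open import Relation.Binary.Construct.Closure.Equivalence using (EqClosure)
import Relation.Binary.Construct.Closure.Equivalence as EqClosure
open import Relation.Binary.Construct.Closure.ReflexiveTransitive using (_◅_; _◅◅_)
import Relation.Binary.Construct.Closure.ReflexiveTransitive as Star
open import Relation.Binary.Construct.Closure.Symmetric using (fwd; bwd)
open import Relation.Binary.Definitions using (Decidable)
open import Relation.Binary.PropositionalEquality
open import Relation.Nullary using (yes; no)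
open import Relation.Nullary.Decidable using (map′; _⊎-dec_; _×-dec_)

open +-*-Solver using (solve; _:=_; _:+_; _:*_; _:-_; :-_; con)

private
  variable
    p q r p′ q′ : ℚ

*-monoˡ : 0ℚ ≤ r → p ≤ q → r * p ≤ r * q
*-monoˡ {r} 0≤r = *-monoˡ-≤-nonNeg r {{nonNegative 0≤r}}

*-monoʳ : 0ℚ ≤ r → p ≤ q → p * r ≤ q * r
*-monoʳ {r} 0≤r = *-monoʳ-≤-nonNeg r {{nonNegative 0≤r}}

*-mono : 0ℚ ≤ p → 0ℚ ≤ q′ → p ≤ p′ → q ≤ q′ → p * q ≤ p′ * q′
*-mono 0≤p 0≤q′ p≤p′ q≤q′ = ≤-trans (*-monoˡ 0≤p q≤q′) (*-monoʳ 0≤q′ p≤p′)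

*-nonneg : 0ℚ ≤ p → 0ℚ ≤ q → 0ℚ ≤ p * q
*-nonneg {p} 0≤p 0≤q = subst (_≤ p * _) (*-zeroʳ p) (*-monoˡ 0≤p 0≤q)

*-pos : 0ℚ < p → 0ℚ < q → 0ℚ < p * q
*-pos {p} {q} 0<p 0<q =
  positive⁻¹ (p * q) {{pos*pos⇒pos p {{positive 0<p}} q {{positive 0<q}}}}

+-pos : 0ℚ < p → 0ℚ < q → 0ℚ < p + q
+-pos {p} {q} 0<p 0<q =
  positive⁻¹ (p + q) {{pos+pos⇒pos p {{positive 0<p}} q {{positive 0<q}}}}

+-nonneg : 0ℚ ≤ p → 0ℚ ≤ q → 0ℚ ≤ p + q
+-nonneg = +-mono-≤

p≤p+q : 0ℚ ≤ q → p ≤ p + q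
p≤p+q {q} {p} 0≤q = subst (_≤ p + q) (+-identityʳ p) (+-monoʳ-≤ p 0≤q)

p≤q+p : 0ℚ ≤ q → p ≤ q + p
p≤q+p {q} {p} 0≤q = subst (_≤ q + p) (+-identityˡ p) (+-monoˡ-≤ p 0≤q)

p≤q⇒0≤q-p : p ≤ q → 0ℚ ≤ q - p
p≤q⇒0≤q-p {p} {q} p≤q = subst (_≤ q - p) (+-inverseʳ p) (+-monoˡ-≤ (- p) p≤q)

0≤q-p⇒p≤q : 0ℚ ≤ q - p → p ≤ q
0≤q-p⇒p≤q {q} {p} h = subst (p ≤_) (solve 2 (λ q p → p :+ (q :- p) := q) refl q p) (p≤p+q h)

p≤q+r⇒p-q≤r : ∀ p q → p ≤ q + r → p - q ≤ r
p≤q+r⇒p-q≤r {r} p q h =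
  subst (p - q ≤_) (solve 2 (λ q r → q :+ r :- q := r) refl q r) (+-monoˡ-≤ (- q) h)

p≤∣p∣ : ∀ p → p ≤ ∣ p ∣
p≤∣p∣ p with ≤-total 0ℚ p
... | inj₁ 0≤p = ≤-reflexive (sym (0≤p⇒∣p∣≡p 0≤p))
... | inj₂ p≤0 = ≤-trans p≤0 (0≤∣p∣ p)

∣-∣-sym : ∀ p q → ∣ p - q ∣ ≡ ∣ q - p ∣
∣-∣-sym p q =
  trans (sym (∣-p∣≡∣p∣ (p - q))) (cong ∣_∣ (solve 2 (λ p q → :- (p :- q) := q :- p) refl p q))

p-q≤⇒∣p-q∣≤ : ∀ p q → p - q ≤ r → q - p ≤ r → ∣ p - q ∣ ≤ r
p-q≤⇒∣p-q∣≤ {r} p q h₁ h₂ with ∣p∣≡p∨∣p∣≡-p (p - q)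
... | inj₁ e = subst (_≤ r) (sym e) h₁
... | inj₂ e =
  subst (_≤ r) (sym (trans e (solve 2 (λ p q → :- (p :- q) := q :- p) refl p q))) h₂

∣-∣-triangle : ∀ p q r → ∣ p - r ∣ ≤ ∣ p - q ∣ + ∣ q - r ∣
∣-∣-triangle p q r =
  subst (_≤ ∣ p - q ∣ + ∣ q - r ∣)
    (cong ∣_∣ (solve 3 (λ p q r → (p :- q) :+ (q :- r) := p :- r) refl p q r))
    (∣p+q∣≤∣p∣+∣q∣ (p - q) (q - r))

∣p∣≤∣p-q∣+∣q∣ : ∀ p q → ∣ p ∣ ≤ ∣ p - q ∣ + ∣ q ∣
∣p∣≤∣p-q∣+∣q∣ p q =
  subst (_≤ ∣ p - q ∣ + ∣ q ∣) (cong ∣_∣ (solve 2 (λ p q → (p :- q) :+ q := p) refl p q))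
    (∣p+q∣≤∣p∣+∣q∣ (p - q) q)

square-cancel : 0ℚ ≤ q → p * p ≤ q * q → p ≤ q
square-cancel {q} {p} 0≤q h = ≮⇒≥ λ q<p →
  <-irrefl refl (<-≤-trans
    (≤-<-trans (*-monoˡ 0≤q (<⇒≤ q<p))
      (*-monoˡ-<-pos p {{positive (≤-<-trans 0≤q q<p)}} q<p))
    h)

0≤1 : 0ℚ ≤ 1ℚ
0≤1 = nonNegative⁻¹ 1ℚ

0<1 : 0ℚ < 1ℚ
0<1 = positive⁻¹ 1ℚ

0<2 : 0ℚ < 1ℚ + 1ℚ
0<2 = positive⁻¹ (1ℚ + 1ℚ)

ℕ→ℚ : ℕ → ℚ
ℕ→ℚ n = ℤ.+ n / 1

1/suc : ℕ → ℚ
1/suc n = ℤ.+ 1 / suc n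

-- The reciprocal made total by 0⁻¹ = 0, so that it can be applied termwise to sequences.
invℚ : ℚ → ℚ
invℚ p with p ≟ 0ℚ
... | yes _  = 0ℚ
... | no p≢0 = (1/ p) {{≢-nonZero p≢0}}

0<1/suc : ∀ n → 0ℚ < 1/suc n
0<1/suc n = positive⁻¹ (1/suc n) {{normalize-pos 1 (suc n)}}

0≤1/suc : ∀ n → 0ℚ ≤ 1/suc n
0≤1/suc n = <⇒≤ (0<1/suc n)

ℕ→ℚ-suc : ∀ n → ℕ→ℚ (suc n) ≡ 1ℚ + ℕ→ℚ n
ℕ→ℚ-suc n = toℚᵘ-injective (begin
    toℚᵘ (ℕ→ℚ (suc n))         ≈⟨ toℚᵘ-fromℚᵘ (ℚᵘ.mkℚᵘ (ℤ.+ suc n) 0) ⟩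
    ℚᵘ.mkℚᵘ (ℤ.+ suc n) 0       ≈⟨ ℚᵘ.*≡* (cong (ℤ._* ℤ.+ 1) (cong (λ k → ℤ.+ 1 ℤ.+ k) (sym (ℤ.*-identityʳ (ℤ.+ n))))) ⟩
    ℚᵘ.1ℚᵘ ℚᵘ.+ ℚᵘ.mkℚᵘ (ℤ.+ n) 0 ≈⟨ ℚᵘ.+-congʳ ℚᵘ.1ℚᵘ (ℚᵘ.≃-sym (toℚᵘ-fromℚᵘ (ℚᵘ.mkℚᵘ (ℤ.+ n) 0))) ⟩
    ℚᵘ.1ℚᵘ ℚᵘ.+ toℚᵘ (ℕ→ℚ n)   ≈⟨ ℚᵘ.≃-sym (toℚᵘ-homo-+ 1ℚ (ℕ→ℚ n)) ⟩
    toℚᵘ (1ℚ + ℕ→ℚ n)          ∎)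
  where open ℚᵘ.≃-Reasoning

1/suc-inverse : ∀ n → ℕ→ℚ (suc n) * 1/suc n ≡ 1ℚ
1/suc-inverse n = toℚᵘ-injective (begin
    toℚᵘ (ℕ→ℚ (suc n) * 1/suc n)                 ≈⟨ toℚᵘ-homo-* (ℕ→ℚ (suc n)) (1/suc n) ⟩
    toℚᵘ (ℕ→ℚ (suc n)) ℚᵘ.* toℚᵘ (1/suc n)
      ≈⟨ ℚᵘ.*-cong (toℚᵘ-fromℚᵘ (ℚᵘ.mkℚᵘ (ℤ.+ suc n) 0)) (toℚᵘ-fromℚᵘ (ℚᵘ.mkℚᵘ (ℤ.+ 1) n)) ⟩
    ℚᵘ.mkℚᵘ (ℤ.+ suc n) 0 ℚᵘ.* ℚᵘ.mkℚᵘ (ℤ.+ 1) n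
      ≈⟨ ℚᵘ.*≡* (trans (ℤ.*-identityʳ (ℤ.+ suc n ℤ.* ℤ.+ 1)) (trans (ℤ.*-identityʳ (ℤ.+ suc n))
           (sym (trans (ℤ.*-identityˡ (ℤ.+ suc (n ℕ.+ 0))) (cong (λ k → ℤ.+ suc k) (ℕ.+-identityʳ n)))))) ⟩
    toℚᵘ 1ℚ ∎)
  where open ℚᵘ.≃-Reasoning

0≤ℕ→ℚ : ∀ n → 0ℚ ≤ ℕ→ℚ n
0≤ℕ→ℚ zero    = ≤-refl
0≤ℕ→ℚ (suc n) = subst (0ℚ ≤_) (sym (ℕ→ℚ-suc n)) (+-nonneg 0≤1 (0≤ℕ→ℚ n))

0<ℕ→ℚ-suc : ∀ n → 0ℚ < ℕ→ℚ (suc n)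
0<ℕ→ℚ-suc n = positive⁻¹ (ℕ→ℚ (suc n)) {{normalize-pos (suc n) 1}}

ℕ→ℚ-+ : ∀ m n → ℕ→ℚ (m ℕ.+ n) ≡ ℕ→ℚ m + ℕ→ℚ n
ℕ→ℚ-+ zero    n = sym (+-identityˡ (ℕ→ℚ n))
ℕ→ℚ-+ (suc m) n = begin
    ℕ→ℚ (suc (m ℕ.+ n))       ≡⟨ ℕ→ℚ-suc (m ℕ.+ n) ⟩
    1ℚ + ℕ→ℚ (m ℕ.+ n)        ≡⟨ cong (1ℚ +_) (ℕ→ℚ-+ m n) ⟩
    1ℚ + (ℕ→ℚ m + ℕ→ℚ n)      ≡⟨ sym (+-assoc 1ℚ (ℕ→ℚ m) (ℕ→ℚ n)) ⟩
    1ℚ + ℕ→ℚ m + ℕ→ℚ n        ≡⟨ cong (_+ ℕ→ℚ n) (sym (ℕ→ℚ-suc m)) ⟩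
    ℕ→ℚ (suc m) + ℕ→ℚ n       ∎
  where open ≡-Reasoning

ℕ→ℚ-mono : ∀ {m n} → m ℕ.≤ n → ℕ→ℚ m ≤ ℕ→ℚ n
ℕ→ℚ-mono {m} {n} m≤n =
  subst (ℕ→ℚ m ≤_) (trans (sym (ℕ→ℚ-+ m (n ℕ.∸ m))) (cong ℕ→ℚ (ℕ.m+[n∸m]≡n m≤n)))
    (p≤p+q (0≤ℕ→ℚ (n ℕ.∸ m)))

ceil : ℚ → ℕ
ceil p = ℤ.∣ ↥ p ∣

p≤ceil : ∀ p → p ≤ ℕ→ℚ (ceil p)
p≤ceil p@(mkℚ n d _) = toℚᵘ-cancel-≤ (ℚᵘ.≤-respʳ-≃
    (ℚᵘ.≃-sym (toℚᵘ-fromℚᵘ (ℚᵘ.mkℚᵘ (ℤ.+ ℤ.∣ n ∣) 0)))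
    (ℚᵘ.*≤* (ℤ.≤-trans (ℤ.≤-reflexive (ℤ.*-identityʳ n)) (lemma n))))
  where
  lemma : ∀ n → n ℤ.≤ ℤ.+ ℤ.∣ n ∣ ℤ.* ℤ.+ suc d
  lemma (ℤ.+ n)    = subst (ℤ.+ n ℤ.≤_) (ℤ.pos-* n (suc d)) (ℤ.+≤+ (ℕ.m≤m*n n (suc d)))
  lemma ℤ.-[1+ n ] = ℤ.-≤+

invℚ-inverse : 0ℚ < p → p * invℚ p ≡ 1ℚ
invℚ-inverse {p} 0<p with p ≟ 0ℚ
... | yes refl = ⊥-elim (<-irrefl refl 0<p)
... | no p≢0   = *-inverseʳ p {{≢-nonZero p≢0}}

0<invℚ : 0ℚ < p → 0ℚ < invℚ p
0<invℚ {p} 0<p = ≰⇒> λ i≤0 → <-irrefl refl (<-≤-trans 0<1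
  (subst₂ _≤_ (invℚ-inverse 0<p) (*-zeroʳ p) (*-monoˡ (<⇒≤ 0<p) i≤0)))

0≤invℚ : 0ℚ < p → 0ℚ ≤ invℚ p
0≤invℚ 0<p = <⇒≤ (0<invℚ 0<p)

invℚ-antitone : 0ℚ < p → p ≤ q → invℚ q ≤ invℚ p
invℚ-antitone {p} {q} 0<p p≤q = begin
    invℚ q                  ≡⟨ sym (*-identityˡ (invℚ q)) ⟩
    1ℚ * invℚ q             ≡⟨ cong (_* invℚ q) (sym (invℚ-inverse 0<p)) ⟩
    p * invℚ p * invℚ q     ≤⟨ *-monoʳ (0≤invℚ 0<q) (*-monoʳ (0≤invℚ 0<p) p≤q) ⟩
    q * invℚ p * invℚ q     ≡⟨ solve 3 (λ a b c → a :* b :* c := a :* c :* b) refl q (invℚ p) (invℚ q) ⟩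
    q * invℚ q * invℚ p     ≡⟨ cong (_* invℚ p) (invℚ-inverse 0<q) ⟩
    1ℚ * invℚ p             ≡⟨ *-identityˡ (invℚ p) ⟩
    invℚ p                  ∎
  where
  open ≤-Reasoning
  0<q = <-≤-trans 0<p p≤q

archimedean : 0ℚ < p → ∃ λ N → ∀ n → N ℕ.≤ n → 1/suc n ≤ p
archimedean {p} 0<p = ceil (invℚ p) , λ n N≤n → begin
    1/suc n                        ≡⟨ sym (*-identityˡ (1/suc n)) ⟩
    1ℚ * 1/suc n                   ≡⟨ cong (_* 1/suc n) (sym (invℚ-inverse 0<p)) ⟩
    p * invℚ p * 1/suc n           ≤⟨ *-monoʳ (0≤1/suc n) (*-monoˡ (<⇒≤ 0<p)
                                        (≤-trans (p≤ceil (invℚ p)) (ℕ→ℚ-mono (ℕ.m≤n⇒m≤1+n N≤n)))) ⟩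
    p * ℕ→ℚ (suc n) * 1/suc n      ≡⟨ *-assoc p (ℕ→ℚ (suc n)) (1/suc n) ⟩
    p * (ℕ→ℚ (suc n) * 1/suc n)    ≡⟨ cong (p *_) (1/suc-inverse n) ⟩
    p * 1ℚ                         ≡⟨ *-identityʳ p ⟩
    p                              ∎
  where open ≤-Reasoning

IsCauchy : (ℕ → ℚ) → Set
IsCauchy f = ∀ ε → 0ℚ < ε → ∃ λ N → ∀ m n → N ℕ.≤ m → N ℕ.≤ n → ∣ f m - f n ∣ ≤ ε

record ℝ : Set where
  no-eta-equality
  constructor mkℝ
  field
    seq    : ℕ → ℚ
    cauchy : IsCauchy seq

open ℝ public

infix 4 _≈_

record _≈_ (x y : ℝ) : Set where
  constructor mk≈
  field
    converge : ∀ ε → 0ℚ < ε → ∃ λ N → ∀ n → N ℕ.≤ n → ∣ seq x n - seq y n ∣ ≤ ε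

record Positive (x : ℝ) : Set where
  constructor mkPositive
  field
    bound     : ℚ
    0<bound   : 0ℚ < bound
    start     : ℕ
    bound≤seq : ∀ n → start ℕ.≤ n → bound ≤ seq x n

-- It suffices to bound the differences by C * ε for a fixed C.
isCauchy : ∀ f C → 0ℚ < C →
  (∀ ε → 0ℚ < ε → ∃ λ N → ∀ m n → N ℕ.≤ m → N ℕ.≤ n → ∣ f m - f n ∣ ≤ C * ε) → IsCauchy f
isCauchy f C 0<C h ε 0<ε with h (invℚ C * ε) (*-pos (0<invℚ 0<C) 0<ε)
... | N , H = N , λ m n N≤m N≤n → ≤-trans (H m n N≤m N≤n) (≤-reflexive
  (trans (sym (*-assoc C (invℚ C) ε)) (trans (cong (_* ε) (invℚ-inverse 0<C)) (*-identityˡ ε))))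

record Bounded (x : ℝ) : Set where
  constructor mkBounded
  field
    bound     : ℚ
    start     : ℕ
    0<bound   : 0ℚ < bound
    ∣seq∣≤bound : ∀ n → start ℕ.≤ n → ∣ seq x n ∣ ≤ bound

bounded : ∀ x → Bounded x
bounded x with cauchy x 1ℚ 0<1
... | N , H = mkBounded (1ℚ + ∣ seq x N ∣) N
    (<-≤-trans 0<1 (p≤p+q (0≤∣p∣ (seq x N))))
    λ n N≤n → ≤-trans (∣p∣≤∣p-q∣+∣q∣ (seq x n) (seq x N)) (+-monoˡ-≤ ∣ seq x N ∣ (H n N N≤n ℕ.≤-refl))

ℚ→ℝ : ℚ → ℝ
ℚ→ℝ q .seq _ = q
ℚ→ℝ q .cauchy ε 0<ε = 0 , λ _ _ _ _ →
  ≤-trans (≤-reflexive (cong ∣_∣ (+-inverseʳ q))) (<⇒≤ 0<ε)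

ℕ→ℝ : ℕ → ℝ
ℕ→ℝ n = ℚ→ℝ (ℕ→ℚ n)

0ᴿ 1ᴿ : ℝ
0ᴿ = ℕ→ℝ 0
1ᴿ = ℕ→ℝ 1

infixl 6 _+ᴿ_ _-ᴿ_
infixl 7 _*ᴿ_
infix  8 -ᴿ_
infixr 9 _^ᴿ_

+-cauchy : ∀ x y → IsCauchy (λ n → seq x n + seq y n)
+-cauchy x y = isCauchy (λ n → seq x n + seq y n) (1ℚ + 1ℚ) 0<2 step
  where
  step : ∀ ε → 0ℚ < ε → ∃ λ N → ∀ m n → N ℕ.≤ m → N ℕ.≤ n →
    ∣ (seq x m + seq y m) - (seq x n + seq y n) ∣ ≤ (1ℚ + 1ℚ) * ε
  step ε 0<ε with cauchy x ε 0<ε | cauchy y ε 0<ε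
  ... | M , H | N , K = M ℕ.⊔ N , λ m n h k → begin
      ∣ (seq x m + seq y m) - (seq x n + seq y n) ∣
        ≡⟨ cong ∣_∣ (solve 4 (λ a b c d → (a :+ b) :- (c :+ d) := (a :- c) :+ (b :- d)) refl
             (seq x m) (seq y m) (seq x n) (seq y n)) ⟩
      ∣ (seq x m - seq x n) + (seq y m - seq y n) ∣
        ≤⟨ ∣p+q∣≤∣p∣+∣q∣ (seq x m - seq x n) (seq y m - seq y n) ⟩
      ∣ seq x m - seq x n ∣ + ∣ seq y m - seq y n ∣
        ≤⟨ +-mono-≤ (H m n (ℕ.m⊔n≤o⇒m≤o M N h) (ℕ.m⊔n≤o⇒m≤o M N k))
                    (K m n (ℕ.m⊔n≤o⇒n≤o M N h) (ℕ.m⊔n≤o⇒n≤o M N k)) ⟩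
      ε + ε
        ≡⟨ solve 1 (λ e → e :+ e := (con 1ℚ :+ con 1ℚ) :* e) refl ε ⟩
      (1ℚ + 1ℚ) * ε ∎
    where open ≤-Reasoning

_+ᴿ_ : ℝ → ℝ → ℝ
(x +ᴿ y) .seq n = seq x n + seq y n
(x +ᴿ y) .cauchy = +-cauchy x y

-ᴿ_ : ℝ → ℝ
(-ᴿ x) .seq n = - seq x n
(-ᴿ x) .cauchy ε 0<ε with cauchy x ε 0<ε
... | N , H = N , λ m n h k → begin
      ∣ - seq x m - (- seq x n) ∣
        ≡⟨ cong ∣_∣ (solve 2 (λ a b → :- a :- (:- b) := b :- a) refl (seq x m) (seq x n)) ⟩
      ∣ seq x n - seq x m ∣
        ≤⟨ H n m k h ⟩
      ε ∎
    where open ≤-Reasoning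

_-ᴿ_ : ℝ → ℝ → ℝ
x -ᴿ y = x +ᴿ (-ᴿ y)

*-cauchy : ∀ x y → IsCauchy (λ n → seq x n * seq y n)
*-cauchy x y = isCauchy (λ n → seq x n * seq y n) (A + B) (+-pos 0<A 0<B) step
  where
  open Bounded (bounded x) renaming (bound to A; start to a; 0<bound to 0<A; ∣seq∣≤bound to HA)
  open Bounded (bounded y) renaming (bound to B; start to b; 0<bound to 0<B; ∣seq∣≤bound to HB)

  step : ∀ ε → 0ℚ < ε → ∃ λ N → ∀ m n → N ℕ.≤ m → N ℕ.≤ n →
    ∣ seq x m * seq y m - seq x n * seq y n ∣ ≤ (A + B) * ε
  step ε 0<ε with cauchy x ε 0<ε | cauchy y ε 0<ε
  ... | M , H | N , K = (M ℕ.⊔ N) ℕ.⊔ (a ℕ.⊔ b) , λ m n h k →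
      let hM = ℕ.m⊔n≤o⇒m≤o M N (ℕ.m⊔n≤o⇒m≤o (M ℕ.⊔ N) (a ℕ.⊔ b) h)
          hN = ℕ.m⊔n≤o⇒n≤o M N (ℕ.m⊔n≤o⇒m≤o (M ℕ.⊔ N) (a ℕ.⊔ b) h)
          kM = ℕ.m⊔n≤o⇒m≤o M N (ℕ.m⊔n≤o⇒m≤o (M ℕ.⊔ N) (a ℕ.⊔ b) k)
          kN = ℕ.m⊔n≤o⇒n≤o M N (ℕ.m⊔n≤o⇒m≤o (M ℕ.⊔ N) (a ℕ.⊔ b) k)
          ha = ℕ.m⊔n≤o⇒m≤o a b (ℕ.m⊔n≤o⇒n≤o (M ℕ.⊔ N) (a ℕ.⊔ b) h)
          kb = ℕ.m⊔n≤o⇒n≤o a b (ℕ.m⊔n≤o⇒n≤o (M ℕ.⊔ N) (a ℕ.⊔ b) k)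
      in begin
      ∣ seq x m * seq y m - seq x n * seq y n ∣
        ≡⟨ cong ∣_∣ (solve 4 (λ a b c d → a :* b :- c :* d := a :* (b :- d) :+ d :* (a :- c)) refl
             (seq x m) (seq y m) (seq x n) (seq y n)) ⟩
      ∣ seq x m * (seq y m - seq y n) + seq y n * (seq x m - seq x n) ∣
        ≤⟨ ∣p+q∣≤∣p∣+∣q∣ (seq x m * (seq y m - seq y n)) (seq y n * (seq x m - seq x n)) ⟩
      ∣ seq x m * (seq y m - seq y n) ∣ + ∣ seq y n * (seq x m - seq x n) ∣
        ≡⟨ cong₂ _+_ (∣p*q∣≡∣p∣*∣q∣ (seq x m) (seq y m - seq y n))
                     (∣p*q∣≡∣p∣*∣q∣ (seq y n) (seq x m - seq x n)) ⟩
      ∣ seq x m ∣ * ∣ seq y m - seq y n ∣ + ∣ seq y n ∣ * ∣ seq x m - seq x n ∣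
        ≤⟨ +-mono-≤ (*-mono (0≤∣p∣ (seq x m)) (<⇒≤ 0<ε) (HA m ha) (K m n hN kN))
                    (*-mono (0≤∣p∣ (seq y n)) (<⇒≤ 0<ε) (HB n kb) (H m n hM kM)) ⟩
      A * ε + B * ε
        ≡⟨ sym (*-distribʳ-+ ε A B) ⟩
      (A + B) * ε ∎
    where open ≤-Reasoning

_*ᴿ_ : ℝ → ℝ → ℝ
(x *ᴿ y) .seq n = seq x n * seq y n
(x *ᴿ y) .cauchy = *-cauchy x y

_^ᴿ_ : ℝ → ℕ → ℝ
x ^ᴿ zero  = 1ᴿ
x ^ᴿ suc n = x *ᴿ x ^ᴿ n

recip-cauchy : ∀ x → Positive x → IsCauchy (λ n → invℚ (seq x n))
recip-cauchy x (mkPositive δ 0<δ N₀ H₀) =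
  isCauchy (λ n → invℚ (seq x n)) (invℚ δ * invℚ δ) (*-pos (0<invℚ 0<δ) (0<invℚ 0<δ)) step
  where
  step : ∀ ε → 0ℚ < ε → ∃ λ N → ∀ m n → N ℕ.≤ m → N ℕ.≤ n →
    ∣ invℚ (seq x m) - invℚ (seq x n) ∣ ≤ invℚ δ * invℚ δ * ε
  step ε 0<ε with cauchy x ε 0<ε
  ... | N , H = N₀ ℕ.⊔ N , λ m n h k →
      let p = seq x m ; q = seq x n
          δ≤p = H₀ m (ℕ.m⊔n≤o⇒m≤o N₀ N h)
          δ≤q = H₀ n (ℕ.m⊔n≤o⇒m≤o N₀ N k)
          0<p = <-≤-trans 0<δ δ≤p
          0<q = <-≤-trans 0<δ δ≤q
          0≤i = *-nonneg (0≤invℚ 0<p) (0≤invℚ 0<q)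
      in begin
      ∣ invℚ p - invℚ q ∣
        ≡⟨ cong ∣_∣ (sym (cong₂ _-_ (*-identityʳ (invℚ p)) (*-identityʳ (invℚ q)))) ⟩
      ∣ invℚ p * 1ℚ - invℚ q * 1ℚ ∣
        ≡⟨ cong ∣_∣ (cong₂ (λ a b → invℚ p * a - invℚ q * b)
             (sym (invℚ-inverse 0<q)) (sym (invℚ-inverse 0<p))) ⟩
      ∣ invℚ p * (q * invℚ q) - invℚ q * (p * invℚ p) ∣
        ≡⟨ cong ∣_∣ (solve 4 (λ p q i j → i :* (q :* j) :- j :* (p :* i) := (i :* j) :* (q :- p)) refl
             p q (invℚ p) (invℚ q)) ⟩
      ∣ (invℚ p * invℚ q) * (q - p) ∣
        ≡⟨ ∣p*q∣≡∣p∣*∣q∣ (invℚ p * invℚ q) (q - p) ⟩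
      ∣ invℚ p * invℚ q ∣ * ∣ q - p ∣
        ≡⟨ cong₂ _*_ (0≤p⇒∣p∣≡p 0≤i) (∣-∣-sym q p) ⟩
      (invℚ p * invℚ q) * ∣ p - q ∣
        ≤⟨ *-mono 0≤i (<⇒≤ 0<ε)
             (*-mono (0≤invℚ 0<p) (0≤invℚ 0<δ) (invℚ-antitone 0<δ δ≤p) (invℚ-antitone 0<δ δ≤q))
             (H m n (ℕ.m⊔n≤o⇒n≤o N₀ N h) (ℕ.m⊔n≤o⇒n≤o N₀ N k)) ⟩
      invℚ δ * invℚ δ * ε ∎
    where open ≤-Reasoning

recip : (x : ℝ) → Positive x → ℝ
recip x 0<x .seq n = invℚ (seq x n)
recip x 0<x .cauchy = recip-cauchy x 0<x

infixl 7 _÷_by_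

_÷_by_ : (x y : ℝ) → Positive y → ℝ
x ÷ y by 0<y = x *ᴿ recip y 0<y

ℚ→ℝ-pos : 0ℚ < q → Positive (ℚ→ℝ q)
ℚ→ℝ-pos {q} 0<q = mkPositive q 0<q 0 λ _ _ → ≤-refl

ℕ→ℝ-pos : ∀ n → .{{ℕ.NonZero n}} → Positive (ℕ→ℝ n)
ℕ→ℝ-pos (suc n) = ℚ→ℝ-pos (0<ℕ→ℚ-suc n)

*ᴿ-pos : ∀ {x y} → Positive x → Positive y → Positive (x *ᴿ y)
*ᴿ-pos {x} {y} (mkPositive a 0<a M H) (mkPositive b 0<b N K) =
  mkPositive (a * b) (*-pos 0<a 0<b) (M ℕ.⊔ N) λ n h →
    let a≤x = H n (ℕ.m⊔n≤o⇒m≤o M N h) ; b≤y = K n (ℕ.m⊔n≤o⇒n≤o M N h) in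
    *-mono (<⇒≤ 0<a) (≤-trans (<⇒≤ 0<b) b≤y) a≤x b≤y

recip-pos : ∀ {x} (0<x : Positive x) → Positive (recip x 0<x)
recip-pos {x} (mkPositive δ 0<δ N H) = mkPositive (invℚ B) (0<invℚ 0<B) (N ℕ.⊔ M) λ n h →
  invℚ-antitone (<-≤-trans 0<δ (H n (ℕ.m⊔n≤o⇒m≤o N M h)))
    (≤-trans (p≤∣p∣ (seq x n)) (K n (ℕ.m⊔n≤o⇒n≤o N M h)))
  where
  open Bounded (bounded x) renaming (bound to B; start to M; 0<bound to 0<B; ∣seq∣≤bound to K)

-- expTerm q k = qᵏ / k!
expTerm : ℚ → ℕ → ℚ
expTerm q zero    = 1ℚ
expTerm q (suc k) = expTerm q k * (q * 1/suc k)

expSum : ℚ → ℕ → ℚ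
expSum q zero    = expTerm q zero
expSum q (suc n) = expSum q n + expTerm q (suc n)

expTerm-nonneg : 0ℚ ≤ q → ∀ k → 0ℚ ≤ expTerm q k
expTerm-nonneg 0≤q zero    = 0≤1
expTerm-nonneg 0≤q (suc k) = *-nonneg (expTerm-nonneg 0≤q k) (*-nonneg 0≤q (0≤1/suc k))

expSum-mono : 0ℚ ≤ q → ∀ j n → expSum q n ≤ expSum q (j ℕ.+ n)
expSum-mono 0≤q zero    n = ≤-refl
expSum-mono 0≤q (suc j) n =
  ≤-trans (expSum-mono 0≤q j n) (p≤p+q (expTerm-nonneg 0≤q (suc (j ℕ.+ n))))

expSum-mono-≤ : 0ℚ ≤ q → ∀ {m n} → m ℕ.≤ n → expSum q m ≤ expSum q n
expSum-mono-≤ {q} 0≤q {m} {n} m≤n =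
  subst (λ k → expSum q m ≤ expSum q k) (ℕ.m∸n+n≡m m≤n) (expSum-mono 0≤q (n ℕ.∸ m) m)

∣expTerm∣≤ : ∀ {B} → ∣ q ∣ ≤ B → ∀ k → ∣ expTerm q k ∣ ≤ expTerm B k
∣expTerm∣≤ h zero    = ≤-refl
∣expTerm∣≤ {q} {B} h (suc k) = begin
    ∣ expTerm q k * (q * 1/suc k) ∣       ≡⟨ ∣p*q∣≡∣p∣*∣q∣ (expTerm q k) (q * 1/suc k) ⟩
    ∣ expTerm q k ∣ * ∣ q * 1/suc k ∣     ≡⟨ cong (∣ expTerm q k ∣ *_) (∣p*q∣≡∣p∣*∣q∣ q (1/suc k)) ⟩
    ∣ expTerm q k ∣ * (∣ q ∣ * ∣ 1/suc k ∣)
      ≡⟨ cong (λ t → ∣ expTerm q k ∣ * (∣ q ∣ * t)) (0≤p⇒∣p∣≡p (0≤1/suc k)) ⟩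
    ∣ expTerm q k ∣ * (∣ q ∣ * 1/suc k)
      ≤⟨ *-mono (0≤∣p∣ (expTerm q k)) (*-nonneg (≤-trans (0≤∣p∣ q) h) (0≤1/suc k))
           (∣expTerm∣≤ h k) (*-monoʳ (0≤1/suc k) h) ⟩
    expTerm B k * (B * 1/suc k)           ∎
  where open ≤-Reasoning

-- ∣pᵏ⁺¹ - qᵏ⁺¹∣ / (k+1)! ≤ ∣p - q∣ Bᵏ / k!
expTerm-lipschitz : ∀ {B} → ∣ p ∣ ≤ B → ∣ q ∣ ≤ B → ∀ k →
  ∣ expTerm p (suc k) - expTerm q (suc k) ∣ ≤ ∣ p - q ∣ * expTerm B k
expTerm-lipschitz {p} {q} h₁ h₂ zero = ≤-reflexive
  (trans (cong ∣_∣ (solve 2 (λ p q → con 1ℚ :* (p :* con 1ℚ) :- con 1ℚ :* (q :* con 1ℚ) := p :- q) refl p q))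
    (sym (*-identityʳ ∣ p - q ∣)))
expTerm-lipschitz {p} {q} {B} h₁ h₂ (suc k) = begin
    ∣ P * (p * u) - Q * (q * u) ∣
      ≡⟨ cong ∣_∣ (solve 5 (λ P Q p q u → P :* (p :* u) :- Q :* (q :* u) :=
           ((p :- q) :* P :+ q :* (P :- Q)) :* u) refl P Q p q u) ⟩
    ∣ ((p - q) * P + q * (P - Q)) * u ∣
      ≡⟨ ∣p*q∣≡∣p∣*∣q∣ ((p - q) * P + q * (P - Q)) u ⟩
    ∣ (p - q) * P + q * (P - Q) ∣ * ∣ u ∣
      ≡⟨ cong (∣ (p - q) * P + q * (P - Q) ∣ *_) (0≤p⇒∣p∣≡p 0≤u) ⟩
    ∣ (p - q) * P + q * (P - Q) ∣ * u
      ≤⟨ *-monoʳ 0≤u (∣p+q∣≤∣p∣+∣q∣ ((p - q) * P) (q * (P - Q))) ⟩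
    (∣ (p - q) * P ∣ + ∣ q * (P - Q) ∣) * u
      ≡⟨ cong (_* u) (cong₂ _+_ (∣p*q∣≡∣p∣*∣q∣ (p - q) P) (∣p*q∣≡∣p∣*∣q∣ q (P - Q))) ⟩
    (d * ∣ P ∣ + ∣ q ∣ * ∣ P - Q ∣) * u
      ≤⟨ *-monoʳ 0≤u (+-mono-≤ (*-monoˡ (0≤∣p∣ (p - q)) (∣expTerm∣≤ h₁ (suc k)))
           (*-mono (0≤∣p∣ q) (*-nonneg (0≤∣p∣ (p - q)) (expTerm-nonneg 0≤B k)) h₂
             (expTerm-lipschitz h₁ h₂ k))) ⟩
    (d * (T * (B * v)) + B * (d * T)) * u
      ≡⟨ solve 5 (λ d T B v u → (d :* (T :* (B :* v)) :+ B :* (d :* T)) :* u :=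
           (d :* T :* B) :* ((v :+ con 1ℚ) :* u)) refl d T B v u ⟩
    (d * T * B) * ((v + 1ℚ) * u)
      ≡⟨ cong ((d * T * B) *_) v+1u≡v ⟩
    (d * T * B) * v
      ≡⟨ solve 4 (λ d T B v → (d :* T :* B) :* v := d :* (T :* (B :* v))) refl d T B v ⟩
    d * (T * (B * v)) ∎
  where
  open ≤-Reasoning
  P = expTerm p (suc k) ; Q = expTerm q (suc k) ; T = expTerm B k
  u = 1/suc (suc k) ; v = 1/suc k ; d = ∣ p - q ∣
  0≤u = 0≤1/suc (suc k)
  0≤B = ≤-trans (0≤∣p∣ p) h₁
  v+1u≡v : (v + 1ℚ) * u ≡ v
  v+1u≡v = ≡-Reasoning.begin
      (v + 1ℚ) * u                     ≡-Reasoning.≡⟨ cong (λ t → (v + t) * u) (sym (1/suc-inverse k)) ⟩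
      (v + ℕ→ℚ (suc k) * v) * u
        ≡-Reasoning.≡⟨ solve 3 (λ v n u → (v :+ n :* v) :* u := v :* ((con 1ℚ :+ n) :* u)) refl v (ℕ→ℚ (suc k)) u ⟩
      v * ((1ℚ + ℕ→ℚ (suc k)) * u)     ≡-Reasoning.≡⟨ cong (λ t → v * (t * u)) (sym (ℕ→ℚ-suc (suc k))) ⟩
      v * (ℕ→ℚ (suc (suc k)) * u)      ≡-Reasoning.≡⟨ cong (v *_) (1/suc-inverse (suc k)) ⟩
      v * 1ℚ                           ≡-Reasoning.≡⟨ *-identityʳ v ⟩
      v                                ≡-Reasoning.∎

expSum-lipschitz-suc : ∀ {B} → ∣ p ∣ ≤ B → ∣ q ∣ ≤ B → ∀ n →
  ∣ expSum p (suc n) - expSum q (suc n) ∣ ≤ ∣ p - q ∣ * expSum B n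
expSum-lipschitz-suc {p} {q} h₁ h₂ zero = ≤-reflexive
  (trans (cong ∣_∣ (solve 2 (λ p q → (con 1ℚ :+ con 1ℚ :* (p :* con 1ℚ)) :- (con 1ℚ :+ con 1ℚ :* (q :* con 1ℚ)) := p :- q) refl p q))
    (sym (*-identityʳ ∣ p - q ∣)))
expSum-lipschitz-suc {p} {q} {B} h₁ h₂ (suc n) = begin
    ∣ (P + p') - (Q + q') ∣
      ≡⟨ cong ∣_∣ (solve 4 (λ a b c d → (a :+ b) :- (c :+ d) := (a :- c) :+ (b :- d)) refl P p' Q q') ⟩
    ∣ (P - Q) + (p' - q') ∣
      ≤⟨ ∣p+q∣≤∣p∣+∣q∣ (P - Q) (p' - q') ⟩
    ∣ P - Q ∣ + ∣ p' - q' ∣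
      ≤⟨ +-mono-≤ (expSum-lipschitz-suc h₁ h₂ n) (expTerm-lipschitz h₁ h₂ (suc n)) ⟩
    ∣ p - q ∣ * expSum B n + ∣ p - q ∣ * expTerm B (suc n)
      ≡⟨ sym (*-distribˡ-+ ∣ p - q ∣ (expSum B n) (expTerm B (suc n))) ⟩
    ∣ p - q ∣ * (expSum B n + expTerm B (suc n)) ∎
  where
  open ≤-Reasoning
  P = expSum p (suc n) ; Q = expSum q (suc n)
  p' = expTerm p (suc (suc n)) ; q' = expTerm q (suc (suc n))

expSum-lipschitz : ∀ {B} → ∣ p ∣ ≤ B → ∣ q ∣ ≤ B → ∀ n →
  ∣ expSum p n - expSum q n ∣ ≤ ∣ p - q ∣ * expSum B n
expSum-lipschitz {p} {q} h₁ h₂ zero =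
  ≤-trans (0≤∣p∣ (p - q)) (≤-reflexive (sym (*-identityʳ ∣ p - q ∣)))
expSum-lipschitz {p} {q} h₁ h₂ (suc n) =
  ≤-trans (expSum-lipschitz-suc h₁ h₂ n)
    (*-monoˡ (0≤∣p∣ (p - q)) (expSum-mono (≤-trans (0≤∣p∣ p) h₁) 1 n))

expSum-tail : ∀ {B} → ∣ q ∣ ≤ B → ∀ j n →
  ∣ expSum q (j ℕ.+ n) - expSum q n ∣ ≤ expSum B (j ℕ.+ n) - expSum B n
expSum-tail {q} {B} h zero n = ≤-reflexive
  (trans (cong ∣_∣ (+-inverseʳ (expSum q n))) (sym (+-inverseʳ (expSum B n))))
expSum-tail {q} {B} h (suc j) n = begin
    ∣ (S + t) - s ∣
      ≡⟨ cong ∣_∣ (solve 3 (λ S t s → (S :+ t) :- s := (S :- s) :+ t) refl S t s) ⟩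
    ∣ (S - s) + t ∣
      ≤⟨ ∣p+q∣≤∣p∣+∣q∣ (S - s) t ⟩
    ∣ S - s ∣ + ∣ t ∣
      ≤⟨ +-mono-≤ (expSum-tail h j n) (∣expTerm∣≤ h (suc (j ℕ.+ n))) ⟩
    (S' - s') + t'
      ≡⟨ solve 3 (λ S t s → (S :- s) :+ t := (S :+ t) :- s) refl S' t' s' ⟩
    (S' + t') - s' ∎
  where
  open ≤-Reasoning
  S = expSum q (j ℕ.+ n) ; s = expSum q n ; t = expTerm q (suc (j ℕ.+ n))
  S' = expSum B (j ℕ.+ n) ; s' = expSum B n ; t' = expTerm B (suc (j ℕ.+ n))

expSum-tail-∣∣ : ∀ {B} → ∣ q ∣ ≤ B → ∀ m n →
  ∣ expSum q m - expSum q n ∣ ≤ ∣ expSum B m - expSum B n ∣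
expSum-tail-∣∣ {q} {B} h m n with ℕ.≤-total n m
... | inj₁ n≤m = ≤-trans
      (subst (λ k → ∣ expSum q k - expSum q n ∣ ≤ expSum B k - expSum B n) (ℕ.m∸n+n≡m n≤m)
        (expSum-tail h (m ℕ.∸ n) n))
      (p≤∣p∣ (expSum B m - expSum B n))
... | inj₂ m≤n = subst₂ _≤_ (∣-∣-sym (expSum q n) (expSum q m)) (∣-∣-sym (expSum B n) (expSum B m))
      (≤-trans
        (subst (λ k → ∣ expSum q k - expSum q m ∣ ≤ expSum B k - expSum B m) (ℕ.m∸n+n≡m m≤n)
          (expSum-tail h (n ℕ.∸ m) m))
        (p≤∣p∣ (expSum B n - expSum B m)))

-- Convergence of the series at a natural number b ≥ 1: from the index 2b on, each term is at
-- most half of the preceding one.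
module _ (c : ℕ) where
  private
    b K : ℕ
    b = suc c
    K = b ℕ.+ b

    B : ℚ
    B = ℕ→ℚ b

    T S : ℕ → ℚ
    T = expTerm B
    S = expSum B

    0≤B : 0ℚ ≤ B
    0≤B = 0≤ℕ→ℚ b

    0<T : ∀ k → 0ℚ < T k
    0<T zero    = 0<1
    0<T (suc k) = *-pos (0<T k) (*-pos (0<ℕ→ℚ-suc c) (0<1/suc k))

    halving : ∀ {n} → K ℕ.≤ n → T (suc n) + T (suc n) ≤ T n
    halving {n} K≤n = begin
        T n * (B * u) + T n * (B * u)
          ≡⟨ solve 3 (λ T B u → T :* (B :* u) :+ T :* (B :* u) := T :* ((B :+ B) :* u)) refl (T n) B u ⟩
        T n * ((B + B) * u)
          ≤⟨ *-monoˡ (<⇒≤ (0<T n)) (*-monoʳ (0≤1/suc n)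
               (subst (_≤ ℕ→ℚ (suc n)) (ℕ→ℚ-+ b b) (ℕ→ℚ-mono (ℕ.m≤n⇒m≤1+n K≤n)))) ⟩
        T n * (ℕ→ℚ (suc n) * u)
          ≡⟨ cong (T n *_) (1/suc-inverse n) ⟩
        T n * 1ℚ
          ≡⟨ *-identityʳ (T n) ⟩
        T n ∎
      where
      open ≤-Reasoning
      u = 1/suc n

    S+T-antitone : ∀ j {n} → K ℕ.≤ n → S (j ℕ.+ n) + T (j ℕ.+ n) ≤ S n + T n
    S+T-antitone zero    K≤n = ≤-refl
    S+T-antitone (suc j) {n} K≤n = ≤-trans
      (≤-reflexive (+-assoc (S (j ℕ.+ n)) (T (suc (j ℕ.+ n))) (T (suc (j ℕ.+ n)))))
      (≤-trans (+-monoʳ-≤ (S (j ℕ.+ n)) (halving (ℕ.≤-trans K≤n (ℕ.m≤n+m n j)))) (S+T-antitone j K≤n))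

    T-antitone : ∀ j → T (j ℕ.+ K) ≤ T K
    T-antitone zero    = ≤-refl
    T-antitone (suc j) = ≤-trans (p≤p+q (<⇒≤ (0<T (suc j ℕ.+ K))))
      (≤-trans (halving (ℕ.m≤n+m K j)) (T-antitone j))

    S-gap : ∀ {m n} → K ℕ.≤ n → n ℕ.≤ m → S m - S n ≤ T n
    S-gap {m} {n} K≤n n≤m = p≤q+r⇒p-q≤r (S m) (S n) (≤-trans (p≤p+q (<⇒≤ (0<T m)))
      (subst (λ k → S k + T k ≤ S n + T n) (ℕ.m∸n+n≡m n≤m) (S+T-antitone (m ℕ.∸ n) K≤n)))

    S-∣gap∣ : ∀ {N} → K ℕ.≤ N → ∀ m n → N ℕ.≤ m → N ℕ.≤ n → ∣ S m - S n ∣ ≤ T N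
    S-∣gap∣ {N} K≤N m n N≤m N≤n = p-q≤⇒∣p-q∣≤ (S m) (S n) (gap N≤m N≤n) (gap N≤n N≤m)
      where
      gap : ∀ {m n} → N ℕ.≤ m → N ℕ.≤ n → S m - S n ≤ T N
      gap {m} N≤m N≤n = ≤-trans
        (+-monoʳ-≤ (S m) (neg-antimono-≤ (expSum-mono-≤ 0≤B N≤n)))
        (S-gap K≤N N≤m)

  expSum-ℕ-cauchy : IsCauchy (expSum (ℕ→ℚ (suc c)))
  expSum-ℕ-cauchy = isCauchy S (T K * B) (*-pos (0<T K) (0<ℕ→ℚ-suc c)) λ ε 0<ε →
    let N , H = archimedean 0<ε
        M = suc (N ℕ.+ K)
    in M , λ m n M≤m M≤n → begin
      ∣ S m - S n ∣                       ≤⟨ S-∣gap∣ (ℕ.m≤n⇒m≤1+n (ℕ.m≤n+m K N)) m n M≤m M≤n ⟩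
      T (N ℕ.+ K) * (B * 1/suc (N ℕ.+ K)) ≡⟨ sym (*-assoc (T (N ℕ.+ K)) B (1/suc (N ℕ.+ K))) ⟩
      T (N ℕ.+ K) * B * 1/suc (N ℕ.+ K)
        ≤⟨ *-mono (*-nonneg (<⇒≤ (0<T (N ℕ.+ K))) 0≤B) (<⇒≤ 0<ε)
             (*-monoʳ 0≤B (T-antitone N)) (H (N ℕ.+ K) (ℕ.m≤m+n N K)) ⟩
      T K * B * ε                         ∎
    where open ≤-Reasoning

  expSum-ℕ-bounded : ∃ λ L → 0ℚ < L × (∀ n → expSum (ℕ→ℚ (suc c)) n ≤ L)
  expSum-ℕ-bounded = S K + T K
    , <-≤-trans (0<T K) (p≤q+p (≤-trans 0≤1 (expSum-mono-≤ 0≤B (ℕ.z≤n {K}))))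
    , λ n → ≤-trans (expSum-mono-≤ 0≤B (ℕ.m≤m+n n K))
        (≤-trans (p≤p+q (<⇒≤ (0<T (n ℕ.+ K)))) (S+T-antitone n ℕ.≤-refl))

expSum-cauchy : ∀ x → IsCauchy (λ n → expSum (seq x n) n)
expSum-cauchy x = isCauchy (λ n → expSum (seq x n) n) (L + 1ℚ) (+-pos 0<L 0<1) step
    where
    open ≤-Reasoning
    open Bounded (bounded x) renaming (bound to A; start to a; ∣seq∣≤bound to HA)

    c = ceil A
    B = ℕ→ℚ (suc c)
    A≤B = ≤-trans (p≤ceil A) (ℕ→ℚ-mono (ℕ.n≤1+n c))
    L = proj₁ (expSum-ℕ-bounded c)
    0<L = proj₁ (proj₂ (expSum-ℕ-bounded c))
    HL = proj₂ (proj₂ (expSum-ℕ-bounded c))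

    step : ∀ ε → 0ℚ < ε → ∃ λ N → ∀ m n → N ℕ.≤ m → N ℕ.≤ n →
      ∣ expSum (seq x m) m - expSum (seq x n) n ∣ ≤ (L + 1ℚ) * ε
    step ε 0<ε = let M , H = cauchy x ε 0<ε ; N , G = expSum-ℕ-cauchy c ε 0<ε in
        a ℕ.+ (M ℕ.+ N) , λ m n h k →
        let M+N≤m = ℕ.m+n≤o⇒n≤o a h ; M+N≤n = ℕ.m+n≤o⇒n≤o a k
            hp = ≤-trans (HA m (ℕ.m+n≤o⇒m≤o a h)) A≤B
            hq = ≤-trans (HA n (ℕ.m+n≤o⇒m≤o a k)) A≤B
            p = seq x m ; q = seq x n
        in begin
        ∣ expSum p m - expSum q n ∣
          ≤⟨ ∣-∣-triangle (expSum p m) (expSum q m) (expSum q n) ⟩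
        ∣ expSum p m - expSum q m ∣ + ∣ expSum q m - expSum q n ∣
          ≤⟨ +-mono-≤ (expSum-lipschitz hp hq m) (expSum-tail-∣∣ hq m n) ⟩
        ∣ p - q ∣ * expSum B m + ∣ expSum B m - expSum B n ∣
          ≤⟨ +-mono-≤
               (*-mono (0≤∣p∣ (p - q)) (<⇒≤ 0<L)
                 (H m n (ℕ.m+n≤o⇒m≤o M M+N≤m) (ℕ.m+n≤o⇒m≤o M M+N≤n)) (HL m))
               (G m n (ℕ.m+n≤o⇒n≤o M M+N≤m) (ℕ.m+n≤o⇒n≤o M M+N≤n)) ⟩
        ε * L + ε
          ≡⟨ solve 2 (λ e L → e :* L :+ e := (L :+ con 1ℚ) :* e) refl ε L ⟩
        (L + 1ℚ) * ε ∎

-- The diagonal sequence n ↦ ∑_{k ≤ n} xₙᵏ / k!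
exp : ℝ → ℝ
exp x .seq n = expSum (seq x n) n
exp x .cauchy = expSum-cauchy x

cosh sinh : ℝ → ℝ
cosh x = ℚ→ℝ ½ *ᴿ (exp x +ᴿ exp (-ᴿ x))
sinh x = ℚ→ℝ ½ *ᴿ (exp x -ᴿ exp (-ᴿ x))

expTerm-even-odd : 0ℚ ≤ q → ∀ k →
  0ℚ ≤ expTerm q k + expTerm (- q) k × 0ℚ ≤ expTerm q k - expTerm (- q) k
expTerm-even-odd {q} 0≤q zero = nonNegative⁻¹ (1ℚ + 1ℚ) , ≤-refl
expTerm-even-odd {q} 0≤q (suc k) with expTerm-even-odd 0≤q k
... | even , odd =
    subst (0ℚ ≤_) (solve 4 (λ s t q u → (s :- t) :* (q :* u) := s :* (q :* u) :+ t :* (:- q :* u)) refl s t q u)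
      (*-nonneg odd 0≤qu)
  , subst (0ℚ ≤_) (solve 4 (λ s t q u → (s :+ t) :* (q :* u) := s :* (q :* u) :- t :* (:- q :* u)) refl s t q u)
      (*-nonneg even 0≤qu)
  where
  s = expTerm q k ; t = expTerm (- q) k ; u = 1/suc k
  0≤qu = *-nonneg 0≤q (0≤1/suc k)

2≤expSum-even : 0ℚ ≤ q → ∀ n → 1ℚ + 1ℚ ≤ expSum q n + expSum (- q) n
2≤expSum-even 0≤q zero = ≤-refl
2≤expSum-even {q} 0≤q (suc n) = ≤-trans (2≤expSum-even 0≤q n)
  (subst (S + S' ≤_) (solve 4 (λ a b c d → (a :+ b) :+ (c :+ d) := (a :+ c) :+ (b :+ d)) refl S S' t t')
    (p≤p+q (proj₁ (expTerm-even-odd 0≤q (suc n)))))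
  where
  S = expSum q n ; S' = expSum (- q) n ; t = expTerm q (suc n) ; t' = expTerm (- q) (suc n)

2q≤expSum-odd : 0ℚ ≤ q → ∀ n → q + q ≤ expSum q (suc n) - expSum (- q) (suc n)
2q≤expSum-odd {q} 0≤q zero = ≤-reflexive
  (solve 1 (λ q → q :+ q := (con 1ℚ :+ con 1ℚ :* (q :* con 1ℚ)) :- (con 1ℚ :+ con 1ℚ :* (:- q :* con 1ℚ))) refl q)
2q≤expSum-odd {q} 0≤q (suc n) = ≤-trans (2q≤expSum-odd 0≤q n)
  (subst (S - S' ≤_) (solve 4 (λ a b c d → (a :- b) :+ (c :- d) := (a :+ c) :- (b :+ d)) refl S S' t t')
    (p≤p+q (proj₂ (expTerm-even-odd 0≤q (suc (suc n))))))
  where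
  S = expSum q (suc n) ; S' = expSum (- q) (suc n)
  t = expTerm q (suc (suc n)) ; t' = expTerm (- q) (suc (suc n))

½*2q : ∀ q → ½ * (q + q) ≡ q
½*2q q = solve 1 (λ q → con ½ :* (q :+ q) := q) refl q

0≤½ : 0ℚ ≤ ½
0≤½ = nonNegative⁻¹ ½

cosh-pos : ∀ x → Positive (cosh x)
cosh-pos x = mkPositive 1ℚ 0<1 0 λ n _ →
  subst (_≤ seq (cosh x) n) (½*2q 1ℚ) (*-monoˡ 0≤½ (lemma n))
  where
  lemma : ∀ n → 1ℚ + 1ℚ ≤ expSum (seq x n) n + expSum (- seq x n) n
  lemma n with ≤-total 0ℚ (seq x n)
  ... | inj₁ 0≤q = 2≤expSum-even 0≤q n
  ... | inj₂ q≤0 = ≤-trans (2≤expSum-even (neg-antimono-≤ q≤0) n) (≤-reflexive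
    (trans (+-comm (expSum (- seq x n) n) (expSum (- - seq x n) n))
      (cong (λ t → expSum t n + expSum (- seq x n) n) (solve 1 (λ q → :- (:- q) := q) refl (seq x n)))))

sinh-pos : ∀ {x} → Positive x → Positive (sinh x)
sinh-pos {x} (mkPositive δ 0<δ N H) = mkPositive δ 0<δ (suc N) bound'
  where
  bound' : ∀ n → suc N ℕ.≤ n → δ ≤ seq (sinh x) n
  bound' (suc n) h =
    let δ≤q = H (suc n) (ℕ.<⇒≤ h) in
    ≤-trans δ≤q (subst (_≤ seq (sinh x) (suc n)) (½*2q (seq x (suc n)))
      (*-monoˡ 0≤½ (2q≤expSum-odd (≤-trans (<⇒≤ 0<δ) δ≤q) n)))

exp-1-pos : ∀ {x} → Positive x → Positive (exp x -ᴿ 1ᴿ)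
exp-1-pos {x} (mkPositive δ 0<δ N H) = mkPositive δ 0<δ (suc N) bound'
  where
  bound' : ∀ n → suc N ℕ.≤ n → δ ≤ expSum (seq x n) n - 1ℚ
  bound' (suc n) h =
    let q = seq x (suc n)
        δ≤q = H (suc n) (ℕ.<⇒≤ h)
    in ≤-trans δ≤q (subst (_≤ expSum q (suc n) - 1ℚ)
      (solve 1 (λ q → (con 1ℚ :+ con 1ℚ :* (q :* con 1ℚ)) :- con 1ℚ := q) refl q)
      (+-monoˡ-≤ (- 1ℚ) (expSum-mono-≤ (≤-trans (<⇒≤ 0<δ) δ≤q) (ℕ.s≤s (ℕ.z≤n {n})))))

tanh : ℝ → ℝ
tanh x = sinh x ÷ cosh x by cosh-pos x

tanh-pos : ∀ {x} → Positive x → Positive (tanh x)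
tanh-pos {x} 0<x = *ᴿ-pos (sinh-pos 0<x) (recip-pos (cosh-pos x))

-- The largest k with 1 ≤ k ≤ m and f k ≤ q, or 0 if there is none.
greatest : (ℕ → ℚ) → ℚ → ℕ → ℕ
greatest f q zero    = zero
greatest f q (suc m) with f (suc m) ≤? q
... | yes _ = suc m
... | no  _ = greatest f q m

square/ : ℕ → ℕ → ℚ
square/ d k = (ℕ→ℚ k * 1/suc d) * (ℕ→ℚ k * 1/suc d)

rootUpTo : ℕ → ℕ → ℚ → ℚ
rootUpTo m d q = ℕ→ℚ (greatest (square/ d) q m) * 1/suc d

-- For q ≥ 0, the largest multiple of 1 / (d + 1) whose square is at most q; the cut-off of the
-- search is harmless because √ q ≤ ∣ ↥ q ∣ + 1.
sqrtℚ : ℕ → ℚ → ℚ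
sqrtℚ d q = rootUpTo (suc d ℕ.* suc ℤ.∣ ↥ q ∣) d q

greatest-sound : ∀ (f : ℕ → ℚ) q → f 0 ≤ q → ∀ m → f (greatest f q m) ≤ q
greatest-sound f q h zero = h
greatest-sound f q h (suc m) with f (suc m) ≤? q
... | yes h′ = h′
... | no  _  = greatest-sound f q h m

greatest-maximal : ∀ (f : ℕ → ℚ) q m → q < f (suc m) → q < f (suc (greatest f q m))
greatest-maximal f q zero h = h
greatest-maximal f q (suc m) h with f (suc m) ≤? q
... | yes _  = h
... | no  h′ = greatest-maximal f q m (≰⇒> h′)

ℕ→ℚ-* : ∀ m n → ℕ→ℚ (m ℕ.* n) ≡ ℕ→ℚ m * ℕ→ℚ n
ℕ→ℚ-* zero    n = sym (*-zeroˡ (ℕ→ℚ n))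
ℕ→ℚ-* (suc m) n = trans (ℕ→ℚ-+ n (m ℕ.* n)) (trans (cong (ℕ→ℚ n +_) (ℕ→ℚ-* m n))
  (trans (solve 2 (λ a b → a :+ b :* a := (con 1ℚ :+ b) :* a) refl (ℕ→ℚ n) (ℕ→ℚ m))
    (cong (_* ℕ→ℚ n) (sym (ℕ→ℚ-suc m)))))

rootUpTo-nonneg : ∀ m d q → 0ℚ ≤ rootUpTo m d q
rootUpTo-nonneg m d q = *-nonneg (0≤ℕ→ℚ (greatest (square/ d) q m)) (0≤1/suc d)

rootUpTo-lower : ∀ m d q → 0ℚ ≤ q → rootUpTo m d q * rootUpTo m d q ≤ q
rootUpTo-lower m d q 0≤q = greatest-sound (square/ d) q square0≤q m
  where
  square0≤q : square/ d 0 ≤ q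
  square0≤q = subst (_≤ q)
    (sym (trans (cong (_* (0ℚ * 1/suc d)) (*-zeroˡ (1/suc d))) (*-zeroˡ (0ℚ * 1/suc d)))) 0≤q

rootUpTo-upper : ∀ m d q → q < square/ d (suc m) →
  q ≤ (rootUpTo m d q + 1/suc d) * (rootUpTo m d q + 1/suc d)
rootUpTo-upper m d q h =
  subst (q ≤_) (cong₂ _*_ next next) (<⇒≤ (greatest-maximal (square/ d) q m h))
  where
  g = greatest (square/ d) q m
  u = 1/suc d

  next : ℕ→ℚ (suc g) * u ≡ ℕ→ℚ g * u + u
  next = trans (cong (_* u) (ℕ→ℚ-suc g))
    (solve 2 (λ g u → (con 1ℚ :+ g) :* u := g :* u :+ u) refl (ℕ→ℚ g) u)

sqrtℚ-nonneg : ∀ d q → 0ℚ ≤ sqrtℚ d q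
sqrtℚ-nonneg d q = rootUpTo-nonneg (suc d ℕ.* suc ℤ.∣ ↥ q ∣) d q

sqrtℚ-lower : ∀ d → 0ℚ ≤ q → sqrtℚ d q * sqrtℚ d q ≤ q
sqrtℚ-lower {q} d 0≤q = rootUpTo-lower (suc d ℕ.* suc ℤ.∣ ↥ q ∣) d q 0≤q

-- The square of ((d + 1) (a + 1) + 1) / (d + 1) exceeds a.
search-bound : ∀ d a → ℕ→ℚ a < square/ d (suc (suc d ℕ.* suc a))
search-bound d a = fuel
  where
  open ≤-Reasoning
  m = suc d ℕ.* suc a
  u = 1/suc d

  A = ℕ→ℚ (suc a)

  1≤A : 1ℚ ≤ A
  1≤A = ℕ→ℚ-mono (ℕ.s≤s (ℕ.z≤n {a}))

  mu≡A : ℕ→ℚ m * u ≡ A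
  mu≡A = trans (cong (_* u) (ℕ→ℚ-* (suc d) (suc a)))
    (trans (solve 3 (λ d a u → d :* a :* u := (d :* u) :* a) refl (ℕ→ℚ (suc d)) A u)
      (trans (cong (_* A) (1/suc-inverse d)) (*-identityˡ A)))

  A≤ : A ≤ ℕ→ℚ (suc m) * u
  A≤ = subst (_≤ ℕ→ℚ (suc m) * u) mu≡A (*-monoʳ (0≤1/suc d) (ℕ→ℚ-mono (ℕ.n≤1+n m)))

  fuel : ℕ→ℚ a < square/ d (suc m)
  fuel = begin-strict
      ℕ→ℚ a                                   ≡⟨ sym (+-identityˡ (ℕ→ℚ a)) ⟩
      0ℚ + ℕ→ℚ a                              <⟨ +-monoˡ-< (ℕ→ℚ a) 0<1 ⟩
      1ℚ + ℕ→ℚ a                              ≡⟨ sym (ℕ→ℚ-suc a) ⟩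
      A                                       ≡⟨ sym (*-identityʳ A) ⟩
      A * 1ℚ                                  ≤⟨ *-monoˡ (0≤ℕ→ℚ (suc a)) 1≤A ⟩
      A * A                                   ≤⟨ *-mono (0≤ℕ→ℚ (suc a)) (≤-trans (0≤ℕ→ℚ (suc a)) A≤) A≤ A≤ ⟩
      (ℕ→ℚ (suc m) * u) * (ℕ→ℚ (suc m) * u)   ∎

sqrtℚ-upper : ∀ d q → q ≤ (sqrtℚ d q + 1/suc d) * (sqrtℚ d q + 1/suc d)
sqrtℚ-upper d q = rootUpTo-upper (suc d ℕ.* suc ℤ.∣ ↥ q ∣) d q
  (≤-<-trans (p≤ceil q) (search-bound d ℤ.∣ ↥ q ∣))

root-close : ∀ {a b u ε p q} → 0ℚ ≤ b + u → 0ℚ ≤ ε → a * a ≤ p → q ≤ (b + u) * (b + u) →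
  u ≤ ε → ∣ p - q ∣ ≤ ε * ε → a - b ≤ (1ℚ + 1ℚ) * ε
root-close {a} {b} {u} {ε} {p} {q} 0≤b+u 0≤ε a²≤p q≤[b+u]² u≤ε h = p≤q+r⇒p-q≤r a b (begin
    a                   ≤⟨ square-cancel {b + u + ε} {a} (+-nonneg {b + u} {ε} 0≤b+u 0≤ε) a²≤ ⟩
    b + u + ε           ≤⟨ +-monoˡ-≤ ε (+-monoʳ-≤ b u≤ε) ⟩
    b + ε + ε           ≡⟨ solve 2 (λ b e → b :+ e :+ e := b :+ (con 1ℚ :+ con 1ℚ) :* e) refl b ε ⟩
    b + (1ℚ + 1ℚ) * ε   ∎)
  where
  open ≤-Reasoning
  0≤[b+u]ε = *-nonneg {b + u} {ε} 0≤b+u 0≤ε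
  a²≤ : a * a ≤ (b + u + ε) * (b + u + ε)
  a²≤ = begin
      a * a
        ≤⟨ a²≤p ⟩
      p
        ≡⟨ solve 2 (λ p q → p := q :+ (p :- q)) refl p q ⟩
      q + (p - q)
        ≤⟨ +-mono-≤ q≤[b+u]² (≤-trans (p≤∣p∣ (p - q)) h) ⟩
      (b + u) * (b + u) + ε * ε
        ≤⟨ p≤p+q (+-nonneg 0≤[b+u]ε 0≤[b+u]ε) ⟩
      (b + u) * (b + u) + ε * ε + ((b + u) * ε + (b + u) * ε)
        ≡⟨ solve 2 (λ c e → c :* c :+ e :* e :+ (c :* e :+ c :* e) := (c :+ e) :* (c :+ e)) refl (b + u) ε ⟩
      (b + u + ε) * (b + u + ε) ∎

sqrt-cauchy : ∀ x → Positive x → IsCauchy (λ n → sqrtℚ n (seq x n))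
sqrt-cauchy x (mkPositive δ 0<δ N₀ H₀) = isCauchy (λ n → sqrtℚ n (seq x n)) (1ℚ + 1ℚ) 0<2 step
  where
  close : ∀ ε → 0ℚ < ε → ∀ m n → 0ℚ ≤ seq x m → 1/suc n ≤ ε → ∣ seq x m - seq x n ∣ ≤ ε * ε →
    sqrtℚ m (seq x m) - sqrtℚ n (seq x n) ≤ (1ℚ + 1ℚ) * ε
  close ε 0<ε m n 0≤p u≤ε h = root-close {sqrtℚ m (seq x m)} {sqrtℚ n (seq x n)} {1/suc n}
    (+-nonneg (sqrtℚ-nonneg n (seq x n)) (0≤1/suc n)) (<⇒≤ 0<ε)
    (sqrtℚ-lower m 0≤p) (sqrtℚ-upper n (seq x n)) u≤ε h

  step : ∀ ε → 0ℚ < ε → ∃ λ N → ∀ m n → N ℕ.≤ m → N ℕ.≤ n →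
    ∣ sqrtℚ m (seq x m) - sqrtℚ n (seq x n) ∣ ≤ (1ℚ + 1ℚ) * ε
  step ε 0<ε = let M , H = cauchy x (ε * ε) (*-pos 0<ε 0<ε) ; N , G = archimedean 0<ε in
    N₀ ℕ.+ (M ℕ.+ N) , λ m n h k →
    let h' = ℕ.m+n≤o⇒n≤o N₀ h ; k' = ℕ.m+n≤o⇒n≤o N₀ k
        hM = ℕ.m+n≤o⇒m≤o M h' ; kM = ℕ.m+n≤o⇒m≤o M k'
        hN = ℕ.m+n≤o⇒n≤o M h' ; kN = ℕ.m+n≤o⇒n≤o M k'
        0≤p = ≤-trans (<⇒≤ 0<δ) (H₀ m (ℕ.m+n≤o⇒m≤o N₀ h))
        0≤q = ≤-trans (<⇒≤ 0<δ) (H₀ n (ℕ.m+n≤o⇒m≤o N₀ k))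
    in p-q≤⇒∣p-q∣≤ (sqrtℚ m (seq x m)) (sqrtℚ n (seq x n))
         (close ε 0<ε m n 0≤p (G n kN) (H m n hM kM))
         (close ε 0<ε n m 0≤q (G m hN) (H n m kM hM))

sqrt : (x : ℝ) → Positive x → ℝ
sqrt x 0<x .seq n = sqrtℚ n (seq x n)
sqrt x 0<x .cauchy = sqrt-cauchy x 0<x

sqrt-pos : ∀ {x} (0<x : Positive x) → Positive (sqrt x 0<x)
sqrt-pos {x} (mkPositive δ 0<δ N H) = mkPositive η 0<η (N ℕ.+ M) λ n h →
  let q = seq x n
      a = sqrtℚ n q
      2η≤ : η + η ≤ a + 1/suc n
      2η≤ = square-cancel (+-nonneg (sqrtℚ-nonneg n q) (0≤1/suc n))
        (≤-trans 4η²≤δ (≤-trans (H n (ℕ.m+n≤o⇒m≤o N h)) (sqrtℚ-upper n q)))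
  in subst₂ _≤_ (solve 1 (λ e → e :+ e :- e := e) refl η) (solve 2 (λ a e → a :+ e :- e := a) refl a η)
       (+-monoˡ-≤ (- η) (≤-trans 2η≤ (+-monoʳ-≤ a (G n (ℕ.m+n≤o⇒n≤o N h)))))
  where
  t = δ * invℚ (1ℚ + δ)
  η = ½ * t
  0<1+δ = +-pos {1ℚ} {δ} 0<1 0<δ
  0<i = 0<invℚ {1ℚ + δ} 0<1+δ
  0<t = *-pos {δ} {invℚ (1ℚ + δ)} 0<δ 0<i
  0<η : 0ℚ < η
  0<η = *-pos (positive⁻¹ ½) 0<t
  M = proj₁ (archimedean 0<η)
  G = proj₂ (archimedean 0<η)
  t≤1 : t ≤ 1ℚ
  t≤1 = ≤-trans (*-monoʳ (<⇒≤ 0<i) (p≤q+p {1ℚ} {δ} 0≤1)) (≤-reflexive (invℚ-inverse {1ℚ + δ} 0<1+δ))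
  t≤δ : t ≤ δ
  t≤δ = subst₂ _≤_ (trans (*-assoc δ (1ℚ) (invℚ (1ℚ + δ))) (cong (δ *_) (*-identityˡ (invℚ (1ℚ + δ)))))
    (trans (*-assoc δ (1ℚ + δ) (invℚ (1ℚ + δ))) (trans (cong (δ *_) (invℚ-inverse 0<1+δ)) (*-identityʳ δ)))
    (*-monoʳ (<⇒≤ 0<i) (*-monoˡ (<⇒≤ 0<δ) (p≤p+q (<⇒≤ 0<δ))))
  4η²≤δ : (η + η) * (η + η) ≤ δ
  4η²≤δ = subst (_≤ δ)
    (solve 1 (λ t → t :* t := (con ½ :* t :+ con ½ :* t) :* (con ½ :* t :+ con ½ :* t)) refl t)
    (≤-trans (*-mono (<⇒≤ 0<t) 0≤1 t≤δ t≤1) (≤-reflexive (*-identityʳ δ)))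

∑ : {A : Set} → List A → (A → ℝ) → ℝ
∑ xs f = foldr (λ a s → f a +ᴿ s) 0ᴿ xs

-- ∏₁ n f = ∏_{k=1}^{n} f k
∏₁ : ℕ → ((k : ℕ) → .{{ℕ.NonZero k}} → ℝ) → ℝ
∏₁ zero    f = 1ᴿ
∏₁ (suc n) f = ∏₁ n f *ᴿ f (suc n)

-- A finite graph on the vertices Fin n, given by the list of its edges; (u , v) stands for the
-- unordered edge {u, v}.
record Graph : Set where
  constructor mkGraph
  field
    ∣V∣   : ℕ
    edges : List (Fin ∣V∣ × Fin ∣V∣)

  ∣E∣ : ℕ
  ∣E∣ = length edges

open Graph public

Adjacent : ∀ {n} → List (Fin n × Fin n) → Fin n → Fin n → Set
Adjacent es u v = (u , v) ∈ es

Connected : ∀ {n} → List (Fin n × Fin n) → Fin n → Fin n → Set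
Connected es = EqClosure (Adjacent es)

module _ {n} {a b : Fin n} {es : List (Fin n × Fin n)} where

  weaken : ∀ {u v} → Connected es u v → Connected ((a , b) ∷ es) u v
  weaken = EqClosure.map there

  Via : Fin n → Fin n → Set
  Via u v = Connected es u v ⊎ ((Connected es u a × Connected es b v) ⊎ (Connected es u b × Connected es a v))

  join : ∀ {u v} → Via u v → Connected ((a , b) ∷ es) u v
  join (inj₁ p)              = weaken p
  join (inj₂ (inj₁ (p , q))) = weaken p ◅◅ (fwd (here refl) ◅ weaken q)
  join (inj₂ (inj₂ (p , q))) = weaken p ◅◅ (bwd (here refl) ◅ weaken q)

  cons : ∀ {u v w} → Connected es u v → Via v w → Via u w
  cons p (inj₁ q)              = inj₁ (p ◅◅ q)
  cons p (inj₂ (inj₁ (q , r))) = inj₂ (inj₁ (p ◅◅ q , r))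
  cons p (inj₂ (inj₂ (q , r))) = inj₂ (inj₂ (p ◅◅ q , r))

  from-b : ∀ {v} → Via b v → Via a v
  from-b (inj₁ q)              = inj₂ (inj₁ (Star.ε , q))
  from-b (inj₂ (inj₁ (q , r))) = inj₂ (inj₁ (Star.ε , r))
  from-b (inj₂ (inj₂ (q , r))) = inj₁ r

  from-a : ∀ {v} → Via a v → Via b v
  from-a (inj₁ q)              = inj₂ (inj₂ (Star.ε , q))
  from-a (inj₂ (inj₁ (q , r))) = inj₁ r
  from-a (inj₂ (inj₂ (q , r))) = inj₂ (inj₂ (Star.ε , r))

  split : ∀ {u v} → Connected ((a , b) ∷ es) u v → Via u v
  split Star.ε = inj₁ Star.ε
  split (fwd (here refl) ◅ p) = from-b (split p)
  split (bwd (here refl) ◅ p) = from-a (split p)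
  split (fwd (there e) ◅ p)   = cons (fwd e ◅ Star.ε) (split p)
  split (bwd (there e) ◅ p)   = cons (bwd e ◅ Star.ε) (split p)

connected-[] : ∀ {n} {u v : Fin n} → Connected [] u v → u ≡ v
connected-[] Star.ε = refl
connected-[] (fwd () ◅ _)
connected-[] (bwd () ◅ _)

connected? : ∀ {n} (es : List (Fin n × Fin n)) → Decidable (Connected es)
connected? []             u v = map′ (λ { refl → Star.ε }) connected-[] (u Fin.≟ v)
connected? ((a , b) ∷ es) u v = map′ join split
  (connected? es u v ⊎-dec
    ((connected? es u a ×-dec connected? es b v) ⊎-dec (connected? es u b ×-dec connected? es a v)))

-- k, r and n of the spanning subgraph of a graph on n vertices with the edges A;
-- deduplicate keeps one vertex of each component.
components : ∀ {n} → List (Fin n × Fin n) → ℕ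
components {n} A = length (deduplicate (connected? A) (allFin n))

rank : ∀ {n} → List (Fin n × Fin n) → ℕ
rank {n} A = n ℕ.∸ components A

nullity : ∀ {n} → List (Fin n × Fin n) → ℕ
nullity A = length A ℕ.∸ rank A

sublists : {A : Set} → List A → List (List A)
sublists []       = [] ∷ []
sublists (x ∷ xs) = sublists xs ++ map (x ∷_) (sublists xs)

-- Neither subtraction of natural numbers is truncated: rank A ≤ rank (edges G) and rank A ≤ ∣A∣.
tutte : Graph → ℝ → ℝ → ℝ
tutte G x y = ∑ (sublists (edges G)) λ A →
  (x -ᴿ 1ᴿ) ^ᴿ (rank (edges G) ℕ.∸ rank A) *ᴿ (y -ᴿ 1ᴿ) ^ᴿ nullity A

configurations : ∀ n → List (Vec Sign n)
configurations zero    = [] ∷ []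
configurations (suc n) = map (Sign.+ ∷_) (configurations n) ++ map (Sign.- ∷_) (configurations n)

spin : Sign → ℝ
spin Sign.+ = 1ᴿ
spin Sign.- = -ᴿ 1ᴿ

isingZ : Graph → ℝ → ℝ → ℝ
isingZ G β J = ∑ (configurations (∣V∣ G)) λ σ →
  exp (β *ᴿ J *ᴿ ∑ (edges G) λ (i , j) → spin (lookup σ i) *ᴿ spin (lookup σ j))

-- A graph with three outmost vertices 0 (top), 1 (left) and 2 (right) and i further vertices.
record CornerGraph : Set where
  constructor mkCornerGraph
  field
    i           : ℕ
    cornerEdges : List (Fin (3 ℕ.+ i) × Fin (3 ℕ.+ i))

open CornerGraph

-- The image in the amalgam of corner d of the copy number c. The copies c and d meet in the
-- vertex corner d of copy c = corner c of copy d, which is one of the new inner vertices 3, 4, 5.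
corner : ∀ {i} → Fin 3 → Fin 3 → Fin (6 ℕ.+ i)
corner 0F 0F = 0F
corner 0F 1F = 3F
corner 0F 2F = 4F
corner 1F 0F = 3F
corner 1F 1F = 1F
corner 1F 2F = 5F
corner 2F 0F = 4F
corner 2F 1F = 5F
corner 2F 2F = 2F

embed : ∀ {i} → Fin 3 → Fin (3 ℕ.+ i) → Fin (6 ℕ.+ 3 ℕ.* i)
embed c v = [ corner c , (λ w → 6 ↑ʳ combine c w) ]′ (splitAt 3 v)

amalgam : CornerGraph → CornerGraph
amalgam G = mkCornerGraph (3 ℕ.+ 3 ℕ.* i G)
  (concatMap (λ c → map (λ (u , v) → embed c u , embed c v) (cornerEdges G)) (allFin 3))

triangle : CornerGraph
triangle = mkCornerGraph 0 ((0F , 1F) ∷ (0F , 2F) ∷ (1F , 2F) ∷ [])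

Γ′ : (n : ℕ) → .{{ℕ.NonZero n}} → CornerGraph
Γ′ (suc zero)    = triangle
Γ′ (suc (suc n)) = amalgam (Γ′ (suc n))

Γ : (n : ℕ) → .{{ℕ.NonZero n}} → Graph
Γ n = mkGraph (3 ℕ.+ i (Γ′ n)) (cornerEdges (Γ′ n))

φ : (k : ℕ) → .{{ℕ.NonZero k}} → (z : ℝ) → Positive z → ℝ
φ 1 z 0<z = (z +ᴿ 1ᴿ) ÷ sqrt z 0<z by sqrt-pos 0<z
φ 2 z 0<z = (z ^ᴿ 2 +ᴿ 1ᴿ) ÷ z by 0<z
φ (suc k@(suc (suc _))) z 0<z = φ k z 0<z ^ᴿ 2 -ᴿ ℕ→ℝ 3 *ᴿ φ k z 0<z +ᴿ ℕ→ℝ 4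

-- z^{m/2} is (√ z)ᵐ.
Φ : ℕ → (z : ℝ) → Positive z → ℝ
Φ n z 0<z =
  sqrt z 0<z ^ᴿ (3 ℕ.^ n)
  *ᴿ ∏₁ n (λ k → φ k z 0<z ^ᴿ (3 ℕ.^ (n ℕ.∸ k)))
  *ᴿ (φ (suc n) z 0<z -ᴿ 1ᴿ)

{-# OPTIONS --safe #-}

-- Both sides are evaluated against the spin sum.
--
-- Tutte side: the weight of an edge is e^{-βJ} (1 + v δ(σᵢ, σⱼ)) with v = e^{2βJ} - 1. Expanding the product over
-- the edges gives Z = e^{-βJ|E|} ∑_A v^{|A|} 2^{k(A)} (Fortuin and Kasteleyn), since 2^{k(A)} configurations are
-- constant on the components of A; as Γ_n is connected and v (x - 1) = 2, this is the Tutte sum term by term.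
--
-- Product side: the weight of an edge is cosh(βJ) (1 + z σᵢ σⱼ) with z = tanh(βJ). Summing over the inner spins of
-- Γ_n only, with the spins a, b, c of the outmost vertices fixed, leaves a function of the form
-- D (t + ab + ac + bc). Gluing three copies maps D to 8 D³ (t + 1) and t to t² - t + 1, and t + 1 obeys the
-- recursion of φ_{n+1}.
module Submission where

open import Data.Nat.Base using (ℕ; zero; suc; NonZero; _+_; _∸_; _^_; _/_)
open import Data.Product.Base using (∃; _×_; _,_; proj₁; proj₂)
open import Defs
open import Data.Fin.Base using (Fin; zero; suc)
open import Data.Fin.Patterns using (0F; 1F; 2F; 3F; 4F; 5F)
import Data.Fin.Properties as Fin
open import Data.List.Base using (List; []; _∷_; _++_; map; foldr; length; filter; allFin; deduplicate)
open import Data.List.Membership.Propositional.Properties using (∈-allFin; ∈-concat⁺′; ∈-map⁺)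
import Data.List.Properties as List
open import Data.List.Relation.Unary.All as All using (All; []; _∷_)
import Data.List.Relation.Unary.All.Properties as All
open import Data.List.Relation.Unary.AllPairs as AllPairs using (AllPairs; []; _∷_)
import Data.List.Relation.Unary.AllPairs.Properties as AllPairs
open import Data.List.Relation.Unary.Any as Any using (Any; here; there)
import Data.List.Relation.Unary.Any.Properties as Any
import Data.List.Relation.Unary.Unique.DecSetoid.Properties as DecSetoid
import Data.List.Relation.Unary.Unique.Propositional.Properties as Unique
import Data.Nat.Base as ℕ
import Data.Nat.DivMod as ℕ
import Data.Nat.Properties as ℕ
import Data.Nat.Solver as ℕ
open import Data.Rational.Base as ℚ using (ℚ; 0ℚ; 1ℚ; ½; ∣_∣)
import Data.Rational.Properties as ℚ
open import Data.Rational.Solver using (module +-*-Solver)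
open import Data.Sign.Base as Sign using (Sign)
import Data.Sign.Properties as Sign
open import Data.Sum.Base using (inj₁; inj₂)
open import Data.Vec.Base using (Vec; []; _∷_; lookup; concat) renaming (_++_ to _++ᵥ_)
import Data.Vec.Properties as Vec
open import Relation.Binary.Bundles using (Setoid)
import Relation.Binary.Construct.Closure.Equivalence as EqClosure
open import Relation.Binary.Construct.Closure.ReflexiveTransitive using (_◅_; _◅◅_; ε)
open import Relation.Binary.Construct.Closure.Symmetric using (fwd)
import Relation.Binary.Construct.On as On
open import Relation.Binary.PropositionalEquality hiding (setoid)
import Relation.Binary.Reasoning.Setoid as SetoidReasoning
open import Relation.Binary.Structures using (IsDecEquivalence)
open import Relation.Nullary using (Dec; yes; no; ¬_; ¬?; contradiction)
open import Relation.Nullary.Decidable using (_→-dec_; _×-dec_)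

open +-*-Solver using (solve; _:=_; _:+_; _:*_; _:-_; :-_; con)
open CornerGraph

-- The ring of real numbers

-- The form `D (t + ab + ac + bc)` is forced by symmetry: the spin weight is unchanged when all
-- spins are reversed or the corners permuted, and the functions of three spins invariant under both
-- are spanned by 1 and ab + ac + bc. Gluing is therefore a map of two parameters, in which t
-- evolves on its own; with f = t + 1 the map t ↦ t² - t + 1 becomes f ↦ f² - 3f + 4. A final sum
-- over the corner spins annihilates ab + ac + bc and leaves t, which is why Φ_n ends in φ_{n+1} -
-- 1.
--
-- On the Tutte side the obstacle is counting: `components` is computed by `deduplicate`, which
-- follows neither an induction on edges nor one on vertices. All comparisons go through lists of
-- class representatives, any two of which have equal length.
--
-- Operations on reals act termwise, so polynomial identities are checked over the rationals at each
-- index. Estimates are required only for congruence, reciprocals, roots and `exp`; the functional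
-- equation of `exp` is the longest of them.

≈-eventually : ∀ {x y} N → (∀ n → N ℕ.≤ n → seq x n ≡ seq y n) → x ≈ y
≈-eventually {x} {y} N h = mk≈ λ ε 0<ε → N , λ n N≤n → ℚ.≤-trans
  (ℚ.≤-reflexive (cong ∣_∣ (trans (cong (ℚ._- seq y n) (h n N≤n)) (ℚ.+-inverseʳ (seq y n)))))
  (ℚ.<⇒≤ 0<ε)

-- Sums, products and negatives are formed termwise, so this reduces every ring identity over `ℝ` to
-- one over `ℚ` that the solver can decide.
≈-pointwise : ∀ {x y} → (∀ n → seq x n ≡ seq y n) → x ≈ y
≈-pointwise h = ≈-eventually 0 λ n _ → h n

≈-scaled : ∀ {x y} C → 0ℚ ℚ.< C →
  (∀ ε → 0ℚ ℚ.< ε → ∃ λ N → ∀ n → N ℕ.≤ n → ∣ seq x n ℚ.- seq y n ∣ ℚ.≤ C ℚ.* ε) → x ≈ y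
≈-scaled C 0<C h = mk≈ λ ε 0<ε → let N , H = h (invℚ C ℚ.* ε) (*-pos (0<invℚ 0<C) 0<ε) in
  N , λ n N≤n → ℚ.≤-trans (H n N≤n) (ℚ.≤-reflexive
    (trans (sym (ℚ.*-assoc C (invℚ C) ε))
      (trans (cong (ℚ._* ε) (invℚ-inverse 0<C)) (ℚ.*-identityˡ ε))))

≈-refl : ∀ {x} → x ≈ x
≈-refl = ≈-pointwise λ _ → refl

≈-sym : ∀ {x y} → x ≈ y → y ≈ x
≈-sym {x} {y} (mk≈ h) = mk≈ λ ε 0<ε → let N , H = h ε 0<ε in
  N , λ n N≤n → subst (ℚ._≤ ε) (∣-∣-sym (seq x n) (seq y n)) (H n N≤n)

≈-trans : ∀ {x y z} → x ≈ y → y ≈ z → x ≈ z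
≈-trans {x} {y} {z} (mk≈ h) (mk≈ k) = ≈-scaled (1ℚ ℚ.+ 1ℚ) 0<2 λ ε 0<ε →
  let M , H = h ε 0<ε ; N , K = k ε 0<ε in
  M ℕ.⊔ N , λ n l → begin
    ∣ seq x n ℚ.- seq z n ∣
      ≤⟨ ∣-∣-triangle (seq x n) (seq y n) (seq z n) ⟩
    ∣ seq x n ℚ.- seq y n ∣ ℚ.+ ∣ seq y n ℚ.- seq z n ∣
      ≤⟨ ℚ.+-mono-≤ (H n (ℕ.m⊔n≤o⇒m≤o M N l)) (K n (ℕ.m⊔n≤o⇒n≤o M N l)) ⟩
    ε ℚ.+ ε
      ≡⟨ solve 1 (λ e → e :+ e := (con 1ℚ :+ con 1ℚ) :* e) refl ε ⟩
    (1ℚ ℚ.+ 1ℚ) ℚ.* ε ∎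
  where open ℚ.≤-Reasoning

≈-setoid : Setoid _ _
≈-setoid = record
  { Carrier = ℝ
  ; _≈_ = _≈_
  ; isEquivalence = record { refl = ≈-refl ; sym = ≈-sym ; trans = ≈-trans }
  }

≈-reflexive : ∀ {x y} → x ≡ y → x ≈ y
≈-reflexive refl = ≈-refl

+ᴿ-cong : ∀ {x x′ y y′} → x ≈ x′ → y ≈ y′ → x +ᴿ y ≈ x′ +ᴿ y′
+ᴿ-cong {x} {x′} {y} {y′} (mk≈ h) (mk≈ k) = ≈-scaled (1ℚ ℚ.+ 1ℚ) 0<2 λ ε 0<ε →
  let M , H = h ε 0<ε ; N , K = k ε 0<ε in
  M ℕ.⊔ N , λ n l → begin
    ∣ (seq x n ℚ.+ seq y n) ℚ.- (seq x′ n ℚ.+ seq y′ n) ∣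
      ≡⟨ cong ∣_∣ (solve 4 (λ a b c d → (a :+ b) :- (c :+ d) := (a :- c) :+ (b :- d)) refl
           (seq x n) (seq y n) (seq x′ n) (seq y′ n)) ⟩
    ∣ (seq x n ℚ.- seq x′ n) ℚ.+ (seq y n ℚ.- seq y′ n) ∣
      ≤⟨ ℚ.∣p+q∣≤∣p∣+∣q∣ (seq x n ℚ.- seq x′ n) (seq y n ℚ.- seq y′ n) ⟩
    ∣ seq x n ℚ.- seq x′ n ∣ ℚ.+ ∣ seq y n ℚ.- seq y′ n ∣
      ≤⟨ ℚ.+-mono-≤ (H n (ℕ.m⊔n≤o⇒m≤o M N l)) (K n (ℕ.m⊔n≤o⇒n≤o M N l)) ⟩
    ε ℚ.+ ε
      ≡⟨ solve 1 (λ e → e :+ e := (con 1ℚ :+ con 1ℚ) :* e) refl ε ⟩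
    (1ℚ ℚ.+ 1ℚ) ℚ.* ε ∎
  where open ℚ.≤-Reasoning

*ᴿ-cong : ∀ {x x′ y y′} → x ≈ x′ → y ≈ y′ → x *ᴿ y ≈ x′ *ᴿ y′
*ᴿ-cong {x} {x′} {y} {y′} (mk≈ h) (mk≈ k) = ≈-scaled (A ℚ.+ B) (+-pos 0<A 0<B) λ ε 0<ε →
  let M , H = h ε 0<ε ; N , K = k ε 0<ε in
  (M ℕ.⊔ N) ℕ.⊔ (a ℕ.⊔ b) , λ n l →
    let l₁ = ℕ.m⊔n≤o⇒m≤o (M ℕ.⊔ N) (a ℕ.⊔ b) l
        l₂ = ℕ.m⊔n≤o⇒n≤o (M ℕ.⊔ N) (a ℕ.⊔ b) l
    in begin
    ∣ seq x n ℚ.* seq y n ℚ.- seq x′ n ℚ.* seq y′ n ∣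
      ≡⟨ cong ∣_∣ (solve 4 (λ a b c d → a :* b :- c :* d := a :* (b :- d) :+ d :* (a :- c)) refl
           (seq x n) (seq y n) (seq x′ n) (seq y′ n)) ⟩
    ∣ seq x n ℚ.* (seq y n ℚ.- seq y′ n) ℚ.+ seq y′ n ℚ.* (seq x n ℚ.- seq x′ n) ∣
      ≤⟨ ℚ.∣p+q∣≤∣p∣+∣q∣ (seq x n ℚ.* (seq y n ℚ.- seq y′ n)) (seq y′ n ℚ.* (seq x n ℚ.- seq x′ n)) ⟩
    ∣ seq x n ℚ.* (seq y n ℚ.- seq y′ n) ∣ ℚ.+ ∣ seq y′ n ℚ.* (seq x n ℚ.- seq x′ n) ∣
      ≡⟨ cong₂ ℚ._+_ (ℚ.∣p*q∣≡∣p∣*∣q∣ (seq x n) (seq y n ℚ.- seq y′ n))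
                     (ℚ.∣p*q∣≡∣p∣*∣q∣ (seq y′ n) (seq x n ℚ.- seq x′ n)) ⟩
    ∣ seq x n ∣ ℚ.* ∣ seq y n ℚ.- seq y′ n ∣ ℚ.+ ∣ seq y′ n ∣ ℚ.* ∣ seq x n ℚ.- seq x′ n ∣
      ≤⟨ ℚ.+-mono-≤
           (*-mono (ℚ.0≤∣p∣ (seq x n)) (ℚ.<⇒≤ 0<ε) (HA n (ℕ.m⊔n≤o⇒m≤o a b l₂)) (K n (ℕ.m⊔n≤o⇒n≤o M N l₁)))
           (*-mono (ℚ.0≤∣p∣ (seq y′ n)) (ℚ.<⇒≤ 0<ε) (HB n (ℕ.m⊔n≤o⇒n≤o a b l₂)) (H n (ℕ.m⊔n≤o⇒m≤o M N l₁))) ⟩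
    A ℚ.* ε ℚ.+ B ℚ.* ε
      ≡⟨ sym (ℚ.*-distribʳ-+ ε A B) ⟩
    (A ℚ.+ B) ℚ.* ε ∎
  where
  open ℚ.≤-Reasoning
  open Bounded (bounded x) renaming (bound to A; start to a; 0<bound to 0<A; ∣seq∣≤bound to HA)
  open Bounded (bounded y′) renaming (bound to B; start to b; 0<bound to 0<B; ∣seq∣≤bound to HB)

-- `invℚ` is a true reciprocal only away from 0, and positivity of `x` excludes zero terms only from
-- the index `N` on; hence an eventual equality.
*ᴿ-inverseʳ : ∀ x 0<x → x *ᴿ recip x 0<x ≈ 1ᴿ
*ᴿ-inverseʳ x (mkPositive δ 0<δ N H) = ≈-eventually N λ n N≤n →
  invℚ-inverse (ℚ.<-≤-trans 0<δ (H n N≤n))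

÷-*-cancel : ∀ x y 0<y → y *ᴿ (x ÷ y by 0<y) ≈ x
÷-*-cancel x y 0<y = ≈-trans
  (≈-pointwise λ n → solve 3 (λ x y r → y :* (x :* r) := x :* (y :* r)) refl (seq x n) (seq y n) (seq (recip y 0<y) n))
  (≈-trans (*ᴿ-cong {x} ≈-refl (*ᴿ-inverseʳ y 0<y)) (≈-pointwise λ n → ℚ.*-identityʳ (seq x n)))

-- With s = `sqrtℚ n q` and u = 1/(n + 1), s² ≤ q ≤ (s + u)², so the error is at most (2s + u) u.
-- The first factor stays below `C` = 2A + 1, where A bounds the roots.
sqrt-square : ∀ x 0<x → sqrt x 0<x *ᴿ sqrt x 0<x ≈ x
sqrt-square x 0<x@(mkPositive δ 0<δ M H) = ≈-scaled C 0<C λ ε 0<ε →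
  let N , K = archimedean 0<ε in
  M ℕ.⊔ (a ℕ.⊔ N) , λ n l →
    let s = sqrtℚ n (seq x n) ; u = 1/suc n ; q = seq x n
        M≤n = ℕ.m⊔n≤o⇒m≤o M (a ℕ.⊔ N) l
        l′ = ℕ.m⊔n≤o⇒n≤o M (a ℕ.⊔ N) l
        0≤q = ℚ.≤-trans (ℚ.<⇒≤ 0<δ) (H n M≤n)
        s≤A = ℚ.≤-trans (p≤∣p∣ s) (HA n (ℕ.m⊔n≤o⇒m≤o a N l′))
        2s+u≤C = ℚ.+-mono-≤ (ℚ.+-mono-≤ s≤A s≤A) (1/suc-≤1 n)
        above : q ℚ.- s ℚ.* s ℚ.≤ C ℚ.* ε
        above = p≤q+r⇒p-q≤r q (s ℚ.* s) (begin
          q                                      ≤⟨ sqrtℚ-upper n q ⟩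
          (s ℚ.+ u) ℚ.* (s ℚ.+ u)
            ≡⟨ solve 2 (λ s u → (s :+ u) :* (s :+ u) := s :* s :+ (s :+ s :+ u) :* u) refl s u ⟩
          s ℚ.* s ℚ.+ (s ℚ.+ s ℚ.+ u) ℚ.* u
            ≤⟨ ℚ.+-monoʳ-≤ (s ℚ.* s) (*-mono
                 (+-nonneg (+-nonneg (sqrtℚ-nonneg n q) (sqrtℚ-nonneg n q)) (0≤1/suc n))
                 (ℚ.<⇒≤ 0<ε) 2s+u≤C (K n (ℕ.m⊔n≤o⇒n≤o a N l′))) ⟩
          s ℚ.* s ℚ.+ C ℚ.* ε                      ∎)
        below : s ℚ.* s ℚ.- q ℚ.≤ C ℚ.* ε
        below = p≤q+r⇒p-q≤r (s ℚ.* s) q (ℚ.≤-trans (sqrtℚ-lower n 0≤q)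
          (p≤p+q (ℚ.<⇒≤ (*-pos 0<C 0<ε))))
    in p-q≤⇒∣p-q∣≤ (s ℚ.* s) q below above
  where
  open ℚ.≤-Reasoning
  open Bounded (bounded (sqrt x 0<x)) renaming (bound to A; start to a; 0<bound to 0<A; ∣seq∣≤bound to HA)
  C = A ℚ.+ A ℚ.+ 1ℚ
  0<C = +-pos (+-pos 0<A 0<A) 0<1
  1/suc-≤1 : ∀ n → 1/suc n ℚ.≤ 1ℚ
  1/suc-≤1 n = subst₂ ℚ._≤_ (ℚ.*-identityˡ (1/suc n)) (1/suc-inverse n)
    (*-monoʳ (0≤1/suc n) (ℕ→ℚ-mono (ℕ.s≤s (ℕ.z≤n {n}))))

-- The exponential series

-- conv f g n = ∑_{i ≤ n} f i * g (n - i)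
conv : (ℕ → ℚ) → (ℕ → ℚ) → ℕ → ℚ
conv f g zero    = f 0 ℚ.* g 0
conv f g (suc n) = f 0 ℚ.* g (suc n) ℚ.+ conv (λ i → f (suc i)) g n

-- The coefficients of the formal derivative of ∑ f i xⁱ. Comparing derivatives replaces the
-- binomial theorem in the product of exponential series.
derivative : (ℕ → ℚ) → ℕ → ℚ
derivative f i = ℕ→ℚ (suc i) ℚ.* f (suc i)

-- The two-term form serves both for sums (`p` = `q` = 1) and for scalar multiples (`q` = 0).
conv-linearˡ : ∀ {f f₁ f₂} p q g → (∀ i → f i ≡ p ℚ.* f₁ i ℚ.+ q ℚ.* f₂ i) → ∀ n →
  conv f g n ≡ p ℚ.* conv f₁ g n ℚ.+ q ℚ.* conv f₂ g n
conv-linearˡ {f} {f₁} {f₂} p q g h zero = trans (cong (ℚ._* g 0) (h 0))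
  (solve 5 (λ p a q b g → (p :* a :+ q :* b) :* g := p :* (a :* g) :+ q :* (b :* g)) refl p (f₁ 0) q (f₂ 0) (g 0))
conv-linearˡ {f} {f₁} {f₂} p q g h (suc n) = trans
  (cong₂ (λ a b → a ℚ.* g (suc n) ℚ.+ b) (h 0) (conv-linearˡ p q g (λ i → h (suc i)) n))
  (solve 7 (λ p a q b g c d → (p :* a :+ q :* b) :* g :+ (p :* c :+ q :* d)
      := p :* (a :* g :+ c) :+ q :* (b :* g :+ d)) refl p (f₁ 0) q (f₂ 0) (g (suc n))
      (conv (λ i → f₁ (suc i)) g n) (conv (λ i → f₂ (suc i)) g n))

conv-scaleʳ : ∀ {g g₁} f p → (∀ i → g i ≡ p ℚ.* g₁ i) → ∀ n → conv f g n ≡ p ℚ.* conv f g₁ n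
conv-scaleʳ {g} {g₁} f p h zero = trans (cong (f 0 ℚ.*_) (h 0))
  (solve 3 (λ f p g → f :* (p :* g) := p :* (f :* g)) refl (f 0) p (g₁ 0))
conv-scaleʳ {g} {g₁} f p h (suc n) = trans
  (cong₂ (λ a b → f 0 ℚ.* a ℚ.+ b) (h (suc n)) (conv-scaleʳ (λ i → f (suc i)) p h n))
  (solve 4 (λ f p g c → f :* (p :* g) :+ p :* c := p :* (f :* g :+ c)) refl (f 0) p (g₁ (suc n))
    (conv (λ i → f (suc i)) g₁ n))

leibniz : ∀ f g n → derivative (conv f g) n ≡ conv (derivative f) g n ℚ.+ conv f (derivative g) n
leibniz f g zero = solve 4 (λ a b c d → con 1ℚ :* (a :* b :+ c :* d) := (con 1ℚ :* c) :* d :+ a :* (con 1ℚ :* b))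
  refl (f 0) (g 1) (f 1) (g 0)
leibniz f g (suc n) = begin
    ℕ→ℚ (2 + n) ℚ.* (f 0 ℚ.* g (2 + n) ℚ.+ C (suc n))
      ≡⟨ solve 4 (λ k a b c → k :* (a :* b :+ c) := a :* (k :* b) :+ k :* c) refl
           (ℕ→ℚ (2 + n)) (f 0) (g (2 + n)) (C (suc n)) ⟩
    a ℚ.+ ℕ→ℚ (2 + n) ℚ.* C (suc n)
      ≡⟨ cong (λ k → a ℚ.+ k ℚ.* C (suc n)) (ℕ→ℚ-suc (suc n)) ⟩
    a ℚ.+ (1ℚ ℚ.+ ℕ→ℚ (suc n)) ℚ.* C (suc n)
      ≡⟨ solve 3 (λ a k c → a :+ (con 1ℚ :+ k) :* c := a :+ (c :+ k :* c)) refl a (ℕ→ℚ (suc n)) (C (suc n)) ⟩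
    a ℚ.+ (C (suc n) ℚ.+ derivative C n)
      ≡⟨ cong (λ c → a ℚ.+ (C (suc n) ℚ.+ c)) (leibniz f′ g n) ⟩
    a ℚ.+ ((f 1 ℚ.* g (suc n) ℚ.+ d) ℚ.+ (b ℚ.+ c))
      ≡⟨ solve 6 (λ a f g d b c → a :+ ((f :* g :+ d) :+ (b :+ c))
           := ((con 1ℚ :* f) :* g :+ (con 1ℚ :* b :+ con 1ℚ :* d)) :+ (a :+ c)) refl a (f 1) (g (suc n)) d b c ⟩
    ((1ℚ ℚ.* f 1) ℚ.* g (suc n) ℚ.+ (1ℚ ℚ.* b ℚ.+ 1ℚ ℚ.* d)) ℚ.+ (a ℚ.+ c)
      ≡⟨ cong (λ t → ((1ℚ ℚ.* f 1) ℚ.* g (suc n) ℚ.+ t) ℚ.+ (a ℚ.+ c))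
           (sym (conv-linearˡ 1ℚ 1ℚ g shift n)) ⟩
    conv (derivative f) g (suc n) ℚ.+ conv f (derivative g) (suc n) ∎
  where
  open ≡-Reasoning
  f′ = λ i → f (suc i)
  C = conv f′ g
  a = f 0 ℚ.* derivative g (suc n)
  b = conv (derivative f′) g n
  c = conv f′ (derivative g) n
  d = conv (λ i → f (2 + i)) g n
  -- Shifting the coefficients does not commute with the derivative: i + 2 = (i + 1) + 1 leaves one
  -- extra copy of f (i + 2). It is supplied by the extra `C (suc n)` split off from (n + 2) C (n +
  -- 1).
  shift : ∀ i → derivative f (suc i) ≡ 1ℚ ℚ.* derivative f′ i ℚ.+ 1ℚ ℚ.* f (2 + i)
  shift i = trans (cong (ℚ._* f (2 + i)) (ℕ→ℚ-suc (suc i)))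
    (solve 2 (λ k f → (con 1ℚ :+ k) :* f := con 1ℚ :* (k :* f) :+ con 1ℚ :* f) refl (ℕ→ℚ (suc i)) (f (2 + i)))

derivative-expTerm : ∀ p i → derivative (expTerm p) i ≡ p ℚ.* expTerm p i
derivative-expTerm p i = trans
  (solve 4 (λ k t p u → k :* (t :* (p :* u)) := (p :* t) :* (k :* u)) refl (ℕ→ℚ (suc i)) (expTerm p i) p (1/suc i))
  (trans (cong ((p ℚ.* expTerm p i) ℚ.*_) (1/suc-inverse i)) (ℚ.*-identityʳ _))

-- Both sides satisfy (n + 1) c (n + 1) = (p + q) c n.
conv-expTerm : ∀ p q n → conv (expTerm p) (expTerm q) n ≡ expTerm (p ℚ.+ q) n
conv-expTerm p q zero = refl
conv-expTerm p q (suc n) = begin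
    c (suc n)
      ≡⟨ sym (ℚ.*-identityˡ (c (suc n))) ⟩
    1ℚ ℚ.* c (suc n)
      ≡⟨ cong (ℚ._* c (suc n)) (sym (1/suc-inverse n)) ⟩
    (ℕ→ℚ (suc n) ℚ.* 1/suc n) ℚ.* c (suc n)
      ≡⟨ solve 3 (λ k u c → (k :* u) :* c := (k :* c) :* u) refl (ℕ→ℚ (suc n)) (1/suc n) (c (suc n)) ⟩
    derivative c n ℚ.* 1/suc n
      ≡⟨ cong (ℚ._* 1/suc n) (leibniz (expTerm p) (expTerm q) n) ⟩
    (conv (derivative (expTerm p)) (expTerm q) n ℚ.+ conv (expTerm p) (derivative (expTerm q)) n) ℚ.* 1/suc n
      ≡⟨ cong (ℚ._* 1/suc n) (cong₂ ℚ._+_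
           (conv-linearˡ p 0ℚ (expTerm q) (λ i → trans (derivative-expTerm p i)
             (solve 2 (λ p t → p :* t := p :* t :+ con 0ℚ :* t) refl p (expTerm p i))) n)
           (conv-scaleʳ (expTerm p) q (derivative-expTerm q) n)) ⟩
    (p ℚ.* c n ℚ.+ 0ℚ ℚ.* c n ℚ.+ q ℚ.* c n) ℚ.* 1/suc n
      ≡⟨ solve 4 (λ p q c u → (p :* c :+ con 0ℚ :* c :+ q :* c) :* u := c :* ((p :+ q) :* u)) refl p q (c n) (1/suc n) ⟩
    c n ℚ.* ((p ℚ.+ q) ℚ.* 1/suc n)
      ≡⟨ cong (ℚ._* ((p ℚ.+ q) ℚ.* 1/suc n)) (conv-expTerm p q n) ⟩
    expTerm (p ℚ.+ q) (suc n) ∎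
  where
  open ≡-Reasoning
  c = conv (expTerm p) (expTerm q)

conv-expSum-suc : ∀ f q n → conv f (expSum q) (suc n) ≡ conv f (expSum q) n ℚ.+ conv f (expTerm q) (suc n)
conv-expSum-suc f q zero = solve 4 (λ a t b c → a :* (c :+ t) :+ b :* c := a :* c :+ (a :* t :+ b :* c)) refl
  (f 0) (expTerm q 1) (f 1) 1ℚ
conv-expSum-suc f q (suc n) = trans
  (cong (f 0 ℚ.* expSum q (2 + n) ℚ.+_) (conv-expSum-suc (λ i → f (suc i)) q n))
  (solve 5 (λ a s t c d → a :* (s :+ t) :+ (c :+ d) := (a :* s :+ c) :+ (a :* t :+ d)) refl
    (f 0) (expSum q (suc n)) (expTerm q (2 + n)) (conv (λ i → f (suc i)) (expSum q) n)
    (conv (λ i → f (suc i)) (expTerm q) (suc n)))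

-- Both sides sum pⁱ qʲ / (i! j!) over the triangle i + j ≤ n; raising n by one adds the next
-- diagonal.
conv-expSum : ∀ p q n → conv (expTerm p) (expSum q) n ≡ expSum (p ℚ.+ q) n
conv-expSum p q zero    = refl
conv-expSum p q (suc n) = trans (conv-expSum-suc (expTerm p) q n)
  (cong₂ ℚ._+_ (conv-expSum p q n) (conv-expTerm p q (suc n)))

partialSum : (ℕ → ℚ) → ℕ → ℚ
partialSum f zero    = f 0
partialSum f (suc n) = f 0 ℚ.+ partialSum (λ i → f (suc i)) n

partialSum-suc : ∀ f n → partialSum f (suc n) ≡ partialSum f n ℚ.+ f (suc n)
partialSum-suc f zero    = refl
partialSum-suc f (suc n) = trans (cong (f 0 ℚ.+_) (partialSum-suc (λ i → f (suc i)) n))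
  (sym (ℚ.+-assoc (f 0) _ _))

partialSum-expTerm : ∀ p n → partialSum (expTerm p) n ≡ expSum p n
partialSum-expTerm p zero    = refl
partialSum-expTerm p (suc n) = trans (partialSum-suc (expTerm p) n) (cong (ℚ._+ expTerm p (suc n)) (partialSum-expTerm p n))

-- The differences are ∑_{i ≤ n} f i * (∑_{n - i < j ≤ m + n} qʲ / j!), for f and for its majorant.
cauchyProduct-defect : ∀ {q B} f F → ∣ q ∣ ℚ.≤ B → (∀ i → ∣ f i ∣ ℚ.≤ F i) → ∀ m n →
  ∣ partialSum f n ℚ.* expSum q (m + n) ℚ.- conv f (expSum q) n ∣
    ℚ.≤ partialSum F n ℚ.* expSum B (m + n) ℚ.- conv F (expSum B) n
cauchyProduct-defect {q} {B} f F h H m n = go f F H m n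
  where
  open ℚ.≤-Reasoning
  term : ∀ a A → ∣ a ∣ ℚ.≤ A → ∀ m n →
    ∣ a ℚ.* (expSum q (m + n) ℚ.- expSum q n) ∣ ℚ.≤ A ℚ.* (expSum B (m + n) ℚ.- expSum B n)
  term a A a≤A m n = ℚ.≤-trans
    (ℚ.≤-reflexive (ℚ.∣p*q∣≡∣p∣*∣q∣ a (expSum q (m + n) ℚ.- expSum q n)))
    (*-mono (ℚ.0≤∣p∣ a) (ℚ.≤-trans (ℚ.0≤∣p∣ _) (expSum-tail h m n)) a≤A (expSum-tail h m n))
  go : ∀ f F → (∀ i → ∣ f i ∣ ℚ.≤ F i) → ∀ m n →
    ∣ partialSum f n ℚ.* expSum q (m + n) ℚ.- conv f (expSum q) n ∣
      ℚ.≤ partialSum F n ℚ.* expSum B (m + n) ℚ.- conv F (expSum B) n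
  go f F H m zero = subst₂ ℚ._≤_
    (cong ∣_∣ (solve 3 (λ a s t → a :* (s :- t) := a :* s :- a :* t) refl (f 0) (expSum q (m + 0)) (expSum q 0)))
    (solve 3 (λ a s t → a :* (s :- t) := a :* s :- a :* t) refl (F 0) (expSum B (m + 0)) (expSum B 0))
    (term (f 0) (F 0) (H 0) m 0)
  go f F H m (suc n) = begin
      ∣ (a ℚ.+ P) ℚ.* s ℚ.- (a ℚ.* t ℚ.+ c) ∣
        ≡⟨ cong ∣_∣ (solve 5 (λ a P s t c → (a :+ P) :* s :- (a :* t :+ c) := a :* (s :- t) :+ (P :* s :- c)) refl a P s t c) ⟩
      ∣ a ℚ.* (s ℚ.- t) ℚ.+ (P ℚ.* s ℚ.- c) ∣
        ≤⟨ ℚ.∣p+q∣≤∣p∣+∣q∣ (a ℚ.* (s ℚ.- t)) (P ℚ.* s ℚ.- c) ⟩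
      ∣ a ℚ.* (s ℚ.- t) ∣ ℚ.+ ∣ P ℚ.* s ℚ.- c ∣
        ≤⟨ ℚ.+-mono-≤ (term a A (H 0) m (suc n)) ih ⟩
      A ℚ.* (S ℚ.- T) ℚ.+ (Q ℚ.* S ℚ.- C)
        ≡⟨ solve 5 (λ a P s t c → a :* (s :- t) :+ (P :* s :- c) := (a :+ P) :* s :- (a :* t :+ c)) refl A Q S T C ⟩
      (A ℚ.+ Q) ℚ.* S ℚ.- (A ℚ.* T ℚ.+ C) ∎
    where
    f′ F′ : ℕ → ℚ
    f′ i = f (suc i)
    F′ i = F (suc i)
    a = f 0 ; A = F 0
    P = partialSum f′ n ; Q = partialSum F′ n
    s = expSum q (m + suc n) ; S = expSum B (m + suc n)
    t = expSum q (suc n) ; T = expSum B (suc n)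
    c = conv f′ (expSum q) n ; C = conv F′ (expSum B) n
    -- The range of j keeps its upper end m + n + 1 while that of i loses one index, so the
    -- induction hypothesis is used at `suc m`. For this reason m is a parameter of the lemma.
    ih : ∣ P ℚ.* s ℚ.- c ∣ ℚ.≤ Q ℚ.* S ℚ.- C
    ih = subst (λ k → ∣ P ℚ.* expSum q k ℚ.- c ∣ ℚ.≤ Q ℚ.* expSum B k ℚ.- C)
      (sym (ℕ.+-suc m n)) (go f′ F′ (λ i → H (suc i)) (suc m) n)

-- The rectangle i ≤ m, j ≤ n lies in the triangle i + j ≤ m + n, and all terms are nonnegative.
partialSum-*≤conv : ∀ {B} F → 0ℚ ℚ.≤ B → (∀ i → 0ℚ ℚ.≤ F i) → ∀ m n →
  partialSum F m ℚ.* expSum B n ℚ.≤ conv F (expSum B) (m + n)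
partialSum-*≤conv {B} F 0≤B 0≤F zero    zero    = ℚ.≤-refl
partialSum-*≤conv {B} F 0≤B 0≤F zero    (suc n) = p≤p+q (conv-nonneg _ (λ i → 0≤F (suc i)) n)
  where
  0≤S : ∀ i → 0ℚ ℚ.≤ expSum B i
  0≤S i = ℚ.≤-trans 0≤1 (expSum-mono-≤ 0≤B (ℕ.z≤n {i}))
  conv-nonneg : ∀ F → (∀ i → 0ℚ ℚ.≤ F i) → ∀ n → 0ℚ ℚ.≤ conv F (expSum B) n
  conv-nonneg F 0≤F zero    = *-nonneg (0≤F 0) (0≤S 0)
  conv-nonneg F 0≤F (suc n) = +-nonneg (*-nonneg (0≤F 0) (0≤S (suc n))) (conv-nonneg _ (λ i → 0≤F (suc i)) n)
partialSum-*≤conv {B} F 0≤B 0≤F (suc m) n = ℚ.≤-trans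
  (ℚ.≤-reflexive (ℚ.*-distribʳ-+ (expSum B n) (F 0) (partialSum (λ i → F (suc i)) m)))
  (ℚ.+-mono-≤ (*-monoˡ (0≤F 0) (expSum-mono 0≤B (suc m) n)) (partialSum-*≤conv _ 0≤B (λ i → 0≤F (suc i)) m n))

-- The product sums over a square and `expSum (p + q) n` over the triangle inside it. After passing
-- to the majorant B, the square is enclosed in the triangle of size 2n, so the defect is at most a
-- stretch of the series of exp (2B).
∣expSum-*∣≤ : ∀ {p q B} → ∣ p ∣ ℚ.≤ B → ∣ q ∣ ℚ.≤ B → ∀ n →
  ∣ expSum p n ℚ.* expSum q n ℚ.- expSum (p ℚ.+ q) n ∣ ℚ.≤ expSum (B ℚ.+ B) (n + n) ℚ.- expSum (B ℚ.+ B) n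
∣expSum-*∣≤ {p} {q} {B} hp hq n = begin
    ∣ expSum p n ℚ.* expSum q n ℚ.- expSum (p ℚ.+ q) n ∣
      ≡⟨ cong ∣_∣ (cong₂ (λ s t → s ℚ.* expSum q n ℚ.- t) (sym (partialSum-expTerm p n)) (sym (conv-expSum p q n))) ⟩
    ∣ partialSum (expTerm p) n ℚ.* expSum q n ℚ.- conv (expTerm p) (expSum q) n ∣
      ≤⟨ cauchyProduct-defect (expTerm p) (expTerm B) hq (∣expTerm∣≤ hp) 0 n ⟩
    partialSum (expTerm B) n ℚ.* expSum B n ℚ.- conv (expTerm B) (expSum B) n
      ≤⟨ ℚ.+-monoˡ-≤ _ (partialSum-*≤conv (expTerm B) 0≤B (expTerm-nonneg 0≤B) n n) ⟩
    conv (expTerm B) (expSum B) (n + n) ℚ.- conv (expTerm B) (expSum B) n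
      ≡⟨ cong₂ ℚ._-_ (conv-expSum B B (n + n)) (conv-expSum B B n) ⟩
    expSum (B ℚ.+ B) (n + n) ℚ.- expSum (B ℚ.+ B) n ∎
  where
  open ℚ.≤-Reasoning
  0≤B = ℚ.≤-trans (ℚ.0≤∣p∣ p) hp

-- The argument of the diagonal sequence moves with the index; a defect bound depending only on a
-- common bound of the arguments makes this harmless.
exp-+ : ∀ x y → exp (x +ᴿ y) ≈ exp x *ᴿ exp y
-- At the parameter `c + suc c`, `expSum-ℕ-cauchy` concerns the argument `suc c + suc c`, twice the
-- common bound `suc c`.
exp-+ x y = ≈-sym (mk≈ λ ε 0<ε → let N , H = expSum-ℕ-cauchy (c + suc c) ε 0<ε in
    (a ℕ.⊔ b) ℕ.⊔ N , λ n l →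
    let l₁ = ℕ.m⊔n≤o⇒m≤o (a ℕ.⊔ b) N l
        N≤n = ℕ.m⊔n≤o⇒n≤o (a ℕ.⊔ b) N l
    in ℚ.≤-trans
      (∣expSum-*∣≤ (ℚ.≤-trans (HA n (ℕ.m⊔n≤o⇒m≤o a b l₁)) A≤C) (ℚ.≤-trans (HB n (ℕ.m⊔n≤o⇒n≤o a b l₁)) B≤C) n)
      (ℚ.≤-trans (p≤∣p∣ _)
        (subst (λ D → ∣ expSum D (n + n) ℚ.- expSum D n ∣ ℚ.≤ ε) (ℕ→ℚ-+ (suc c) (suc c))
          (H (n + n) n (ℕ.≤-trans N≤n (ℕ.m≤m+n n n)) N≤n))))
  where
  open Bounded (bounded x) renaming (bound to A; start to a; ∣seq∣≤bound to HA)
  open Bounded (bounded y) renaming (bound to B; start to b; ∣seq∣≤bound to HB)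
  c = ceil A + ceil B
  A≤C = ℚ.≤-trans (p≤ceil A) (ℕ→ℚ-mono (ℕ.m≤n⇒m≤1+n (ℕ.m≤m+n (ceil A) (ceil B))))
  B≤C = ℚ.≤-trans (p≤ceil B) (ℕ→ℚ-mono (ℕ.m≤n⇒m≤1+n (ℕ.m≤n+m (ceil B) (ceil A))))

-- The nth partial sum has Lipschitz constant `expSum (suc c) n` on the range of the arguments, and
-- these constants are bounded by one `L` for all n.
exp-cong : ∀ {x y} → x ≈ y → exp x ≈ exp y
exp-cong {x} {y} (mk≈ h) = ≈-scaled L 0<L λ ε 0<ε → let N , H = h ε 0<ε in
    (a ℕ.⊔ b) ℕ.⊔ N , λ n l →
    let l₁ = ℕ.m⊔n≤o⇒m≤o (a ℕ.⊔ b) N l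
        N≤n = ℕ.m⊔n≤o⇒n≤o (a ℕ.⊔ b) N l
        p = seq x n ; q = seq y n
    in begin
      ∣ expSum p n ℚ.- expSum q n ∣
        ≤⟨ expSum-lipschitz (ℚ.≤-trans (HA n (ℕ.m⊔n≤o⇒m≤o a b l₁)) A≤C) (ℚ.≤-trans (HB n (ℕ.m⊔n≤o⇒n≤o a b l₁)) B≤C) n ⟩
      ∣ p ℚ.- q ∣ ℚ.* expSum (ℕ→ℚ (suc c)) n
        ≤⟨ *-mono (ℚ.0≤∣p∣ (p ℚ.- q)) (ℚ.<⇒≤ 0<L) (H n N≤n) (HL n) ⟩
      ε ℚ.* L
        ≡⟨ ℚ.*-comm ε L ⟩
      L ℚ.* ε ∎
  where
  open ℚ.≤-Reasoning
  open Bounded (bounded x) renaming (bound to A; start to a; ∣seq∣≤bound to HA)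
  open Bounded (bounded y) renaming (bound to B; start to b; ∣seq∣≤bound to HB)
  c = ceil A + ceil B
  A≤C = ℚ.≤-trans (p≤ceil A) (ℕ→ℚ-mono (ℕ.m≤n⇒m≤1+n (ℕ.m≤m+n (ceil A) (ceil B))))
  B≤C = ℚ.≤-trans (p≤ceil B) (ℕ→ℚ-mono (ℕ.m≤n⇒m≤1+n (ℕ.m≤n+m (ceil B) (ceil A))))
  L = proj₁ (expSum-ℕ-bounded c)
  0<L = proj₁ (proj₂ (expSum-ℕ-bounded c))
  HL = proj₂ (proj₂ (expSum-ℕ-bounded c))

exp-0 : exp 0ᴿ ≈ 1ᴿ
exp-0 = ≈-pointwise expSum-0
  where
  expSum-0 : ∀ n → expSum 0ℚ n ≡ 1ℚ
  expSum-0 zero    = refl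
  expSum-0 (suc n) = trans (cong₂ ℚ._+_ (expSum-0 n)
    (trans (cong (expTerm 0ℚ n ℚ.*_) (ℚ.*-zeroˡ (1/suc n))) (ℚ.*-zeroʳ (expTerm 0ℚ n)))) refl

-- Finite sums and products

^-cong : ∀ {x y} n → x ≈ y → x ^ᴿ n ≈ y ^ᴿ n
^-cong zero    x≈y = ≈-refl
^-cong (suc n) x≈y = *ᴿ-cong x≈y (^-cong n x≈y)

*ᴿ-congˡ : ∀ x {y z} → y ≈ z → x *ᴿ y ≈ x *ᴿ z
*ᴿ-congˡ x = *ᴿ-cong {x} ≈-refl

*ᴿ-congʳ : ∀ x {y z} → y ≈ z → y *ᴿ x ≈ z *ᴿ x
*ᴿ-congʳ x h = *ᴿ-cong {y = x} h ≈-refl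

*ᴿ-identityˡ : ∀ x → 1ᴿ *ᴿ x ≈ x
*ᴿ-identityˡ x = ≈-pointwise λ n → ℚ.*-identityˡ (seq x n)

+ᴿ-identityʳ : ∀ x → x +ᴿ 0ᴿ ≈ x
+ᴿ-identityʳ x = ≈-pointwise λ n → ℚ.+-identityʳ (seq x n)

*ᴿ-assoc : ∀ x y z → (x *ᴿ y) *ᴿ z ≈ x *ᴿ (y *ᴿ z)
*ᴿ-assoc x y z = ≈-pointwise λ n → ℚ.*-assoc (seq x n) (seq y n) (seq z n)

*ᴿ-comm : ∀ x y → x *ᴿ y ≈ y *ᴿ x
*ᴿ-comm x y = ≈-pointwise λ n → ℚ.*-comm (seq x n) (seq y n)

*ᴿ-interchange : ∀ a b c d → (a *ᴿ b) *ᴿ (c *ᴿ d) ≈ (a *ᴿ c) *ᴿ (b *ᴿ d)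
*ᴿ-interchange a b c d = ≈-pointwise λ n →
  solve 4 (λ a b c d → (a :* b) :* (c :* d) := (a :* c) :* (b :* d)) refl (seq a n) (seq b n) (seq c n) (seq d n)

^-+ : ∀ x m n → x ^ᴿ (m + n) ≈ x ^ᴿ m *ᴿ x ^ᴿ n
^-+ x zero    n = ≈-sym (*ᴿ-identityˡ (x ^ᴿ n))
^-+ x (suc m) n = ≈-trans (*ᴿ-congˡ x (^-+ x m n)) (≈-sym (*ᴿ-assoc x (x ^ᴿ m) (x ^ᴿ n)))

^-distrib-* : ∀ x y n → (x *ᴿ y) ^ᴿ n ≈ x ^ᴿ n *ᴿ y ^ᴿ n
^-distrib-* x y zero    = ≈-sym (*ᴿ-identityˡ 1ᴿ)
^-distrib-* x y (suc n) = ≈-trans (*ᴿ-congˡ (x *ᴿ y) (^-distrib-* x y n))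
  (*ᴿ-interchange x y (x ^ᴿ n) (y ^ᴿ n))

^-* : ∀ x m n → x ^ᴿ (m ℕ.* n) ≈ (x ^ᴿ n) ^ᴿ m
^-* x zero    n = ≈-refl
^-* x (suc m) n = ≈-trans (^-+ x n (m ℕ.* n)) (*ᴿ-congˡ (x ^ᴿ n) (^-* x m n))

1^ : ∀ n → 1ᴿ ^ᴿ n ≈ 1ᴿ
1^ zero    = ≈-refl
1^ (suc n) = ≈-trans (*ᴿ-identityˡ (1ᴿ ^ᴿ n)) (1^ n)

∏ : {A : Set} → List A → (A → ℝ) → ℝ
∏ xs f = foldr (λ a p → f a *ᴿ p) 1ᴿ xs

∑-cong : ∀ {A : Set} (xs : List A) {f g} → (∀ a → f a ≈ g a) → ∑ xs f ≈ ∑ xs g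
∑-cong []       h = ≈-refl
∑-cong (x ∷ xs) h = +ᴿ-cong (h x) (∑-cong xs h)

∏-cong : ∀ {A : Set} (xs : List A) {f g} → (∀ a → f a ≈ g a) → ∏ xs f ≈ ∏ xs g
∏-cong []       h = ≈-refl
∏-cong (x ∷ xs) h = *ᴿ-cong (h x) (∏-cong xs h)

∑-map : ∀ {A B : Set} (g : A → B) xs f → ∑ (map g xs) f ≡ ∑ xs (λ a → f (g a))
∑-map g []       f = refl
∑-map g (x ∷ xs) f = cong (f (g x) +ᴿ_) (∑-map g xs f)

∏-map : ∀ {A B : Set} (g : A → B) xs f → ∏ (map g xs) f ≡ ∏ xs (λ a → f (g a))
∏-map g []       f = refl
∏-map g (x ∷ xs) f = cong (f (g x) *ᴿ_) (∏-map g xs f)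

∑-++ : ∀ {A : Set} (xs ys : List A) f → ∑ (xs ++ ys) f ≈ ∑ xs f +ᴿ ∑ ys f
∑-++ []       ys f = ≈-pointwise λ n → sym (ℚ.+-identityˡ (seq (∑ ys f) n))
∑-++ (x ∷ xs) ys f = ≈-trans (+ᴿ-cong {f x} ≈-refl (∑-++ xs ys f))
  (≈-pointwise λ n → sym (ℚ.+-assoc (seq (f x) n) (seq (∑ xs f) n) (seq (∑ ys f) n)))

∏-++ : ∀ {A : Set} (xs ys : List A) f → ∏ (xs ++ ys) f ≈ ∏ xs f *ᴿ ∏ ys f
∏-++ []       ys f = ≈-sym (*ᴿ-identityˡ (∏ ys f))
∏-++ (x ∷ xs) ys f = ≈-trans (*ᴿ-congˡ (f x) (∏-++ xs ys f)) (≈-sym (*ᴿ-assoc (f x) (∏ xs f) (∏ ys f)))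

*-∑ : ∀ {A : Set} (xs : List A) c f → c *ᴿ ∑ xs f ≈ ∑ xs (λ a → c *ᴿ f a)
*-∑ []       c f = ≈-pointwise λ n → ℚ.*-zeroʳ (seq c n)
*-∑ (x ∷ xs) c f = ≈-trans
  (≈-pointwise λ n → ℚ.*-distribˡ-+ (seq c n) (seq (f x) n) (seq (∑ xs f) n))
  (+ᴿ-cong {c *ᴿ f x} ≈-refl (*-∑ xs c f))

∑-* : ∀ {A : Set} (xs : List A) f c → ∑ xs f *ᴿ c ≈ ∑ xs (λ a → f a *ᴿ c)
∑-* xs f c = ≈-trans (*ᴿ-comm (∑ xs f) c)
  (≈-trans (*-∑ xs c f) (∑-cong xs λ a → *ᴿ-comm c (f a)))

∑-+ : ∀ {A : Set} (xs : List A) f g → ∑ xs (λ a → f a +ᴿ g a) ≈ ∑ xs f +ᴿ ∑ xs g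
∑-+ []       f g = ≈-pointwise λ _ → refl
∑-+ (x ∷ xs) f g = ≈-trans (+ᴿ-cong {f x +ᴿ g x} ≈-refl (∑-+ xs f g))
  (≈-pointwise λ n → solve 4 (λ a b c d → (a :+ b) :+ (c :+ d) := (a :+ c) :+ (b :+ d)) refl
    (seq (f x) n) (seq (g x) n) (seq (∑ xs f) n) (seq (∑ xs g) n))

∑-swap : ∀ {A B : Set} (xs : List A) (ys : List B) (f : A → B → ℝ) →
  ∑ xs (λ a → ∑ ys (f a)) ≈ ∑ ys (λ b → ∑ xs (λ a → f a b))
∑-swap []       ys f = ∑-0 ys
  where
  ∑-0 : ∀ ys → 0ᴿ ≈ ∑ ys (λ _ → 0ᴿ)
  ∑-0 []       = ≈-refl
  ∑-0 (y ∷ ys) = ≈-trans (≈-sym (+ᴿ-identityʳ 0ᴿ)) (+ᴿ-cong {0ᴿ} ≈-refl (∑-0 ys))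
∑-swap (x ∷ xs) ys f = ≈-trans (+ᴿ-cong {∑ ys (f x)} ≈-refl (∑-swap xs ys f))
  (≈-sym (∑-+ ys (f x) (λ b → ∑ xs (λ a → f a b))))

∏-scale : ∀ {A : Set} (xs : List A) c f → ∏ xs (λ a → c *ᴿ f a) ≈ c ^ᴿ length xs *ᴿ ∏ xs f
∏-scale []       c f = ≈-sym (*ᴿ-identityˡ 1ᴿ)
∏-scale (x ∷ xs) c f = ≈-trans (*ᴿ-congˡ (c *ᴿ f x) (∏-scale xs c f))
  (*ᴿ-interchange c (f x) (c ^ᴿ length xs) (∏ xs f))

∏-1+ : ∀ {A : Set} (xs : List A) v f →
  ∏ xs (λ a → 1ᴿ +ᴿ v *ᴿ f a) ≈ ∑ (sublists xs) (λ A → v ^ᴿ length A *ᴿ ∏ A f)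
∏-1+ []       v f = ≈-pointwise λ _ → refl
∏-1+ (x ∷ xs) v f = begin
    (1ᴿ +ᴿ v *ᴿ f x) *ᴿ ∏ xs (λ a → 1ᴿ +ᴿ v *ᴿ f a)
      ≈⟨ *ᴿ-congˡ (1ᴿ +ᴿ v *ᴿ f x) (∏-1+ xs v f) ⟩
    (1ᴿ +ᴿ v *ᴿ f x) *ᴿ S
      ≈⟨ ≈-pointwise (λ n → solve 3 (λ v f s → (con 1ℚ :+ v :* f) :* s := s :+ (v :* f) :* s) refl
           (seq v n) (seq (f x) n) (seq S n)) ⟩
    S +ᴿ (v *ᴿ f x) *ᴿ S
      ≈⟨ +ᴿ-cong {S} ≈-refl (*-∑ (sublists xs) (v *ᴿ f x) g) ⟩
    S +ᴿ ∑ (sublists xs) (λ A → (v *ᴿ f x) *ᴿ g A)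
      ≈⟨ +ᴿ-cong {S} ≈-refl (∑-cong (sublists xs) λ A →
           *ᴿ-interchange v (f x) (v ^ᴿ length A) (∏ A f)) ⟩
    S +ᴿ ∑ (sublists xs) (λ A → g (x ∷ A))
      ≡⟨ cong (S +ᴿ_) (sym (∑-map (x ∷_) (sublists xs) g)) ⟩
    S +ᴿ ∑ (map (x ∷_) (sublists xs)) g
      ≈⟨ ≈-sym (∑-++ (sublists xs) (map (x ∷_) (sublists xs)) g) ⟩
    ∑ (sublists (x ∷ xs)) g ∎
  where
  open SetoidReasoning ≈-setoid
  g = λ A → v ^ᴿ length A *ᴿ ∏ A f
  S = ∑ (sublists xs) g

exp-∑ : ∀ {A : Set} (xs : List A) k f → exp (k *ᴿ ∑ xs f) ≈ ∏ xs (λ a → exp (k *ᴿ f a))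
exp-∑ []       k f = ≈-trans (exp-cong {k *ᴿ 0ᴿ} (≈-pointwise λ n → ℚ.*-zeroʳ (seq k n))) exp-0
exp-∑ (x ∷ xs) k f = ≈-trans
  (exp-cong {k *ᴿ (f x +ᴿ ∑ xs f)} {k *ᴿ f x +ᴿ k *ᴿ ∑ xs f}
    (≈-pointwise λ n → ℚ.*-distribˡ-+ (seq k n) (seq (f x) n) (seq (∑ xs f) n)))
  (≈-trans (exp-+ (k *ᴿ f x) (k *ᴿ ∑ xs f)) (*ᴿ-congˡ (exp (k *ᴿ f x)) (exp-∑ xs k f)))

exp-*-ℕ : ∀ x n → exp (x *ᴿ ℕ→ℝ n) ≈ exp x ^ᴿ n
exp-*-ℕ x zero    = ≈-trans (exp-cong {x *ᴿ 0ᴿ} (≈-pointwise λ n → ℚ.*-zeroʳ (seq x n))) exp-0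
exp-*-ℕ x (suc n) = ≈-trans
  (exp-cong {x *ᴿ ℕ→ℝ (suc n)} {x +ᴿ x *ᴿ ℕ→ℝ n} (≈-pointwise λ i → trans (cong (seq x i ℚ.*_) (ℕ→ℚ-suc n))
    (solve 2 (λ x k → x :* (con 1ℚ :+ k) := x :+ x :* k) refl (seq x i) (ℕ→ℚ n))))
  (≈-trans (exp-+ x (x *ᴿ ℕ→ℝ n)) (*ᴿ-congˡ (exp x) (exp-*-ℕ x n)))

∑-configurations-suc : ∀ n f → ∑ (configurations (suc n)) f ≈
  ∑ (configurations n) (λ σ → f (Sign.+ ∷ σ)) +ᴿ ∑ (configurations n) (λ σ → f (Sign.- ∷ σ))
∑-configurations-suc n f = ≈-trans
  (∑-++ (map (Sign.+ ∷_) (configurations n)) (map (Sign.- ∷_) (configurations n)) f)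
  (≈-reflexive (cong₂ _+ᴿ_ (∑-map (Sign.+ ∷_) (configurations n) f) (∑-map (Sign.- ∷_) (configurations n) f)))

∑-configurations-++ : ∀ m n f → ∑ (configurations (m + n)) f ≈
  ∑ (configurations m) (λ σ → ∑ (configurations n) (λ τ → f (σ ++ᵥ τ)))
∑-configurations-++ zero    n f = ≈-sym (+ᴿ-identityʳ (∑ (configurations n) f))
∑-configurations-++ (suc m) n f = ≈-trans (∑-configurations-suc (m + n) f)
  (≈-trans
    (+ᴿ-cong (∑-configurations-++ m n (λ σ → f (Sign.+ ∷ σ))) (∑-configurations-++ m n (λ σ → f (Sign.- ∷ σ))))
    (≈-sym (∑-configurations-suc m (λ σ → ∑ (configurations n) (λ τ → f (σ ++ᵥ τ))))))

-- Components and configurations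

indicator : {P : Set} → Dec P → ℝ
indicator (yes _) = 1ᴿ
indicator (no _)  = 0ᴿ

indicator-⇔ : ∀ {P Q : Set} (p? : Dec P) (q? : Dec Q) → (P → Q) → (Q → P) → indicator p? ≡ indicator q?
indicator-⇔ (yes p) (yes q) f g = refl
indicator-⇔ (yes p) (no ¬q) f g = contradiction (f p) ¬q
indicator-⇔ (no ¬p) (yes q) f g = contradiction (g q) ¬p
indicator-⇔ (no ¬p) (no ¬q) f g = refl

indicator-× : ∀ {P Q : Set} (p? : Dec P) (q? : Dec Q) → indicator (p? ×-dec q?) ≈ indicator p? *ᴿ indicator q?
indicator-× (yes p) (yes q) = ≈-pointwise λ _ → refl
indicator-× (yes p) (no ¬q) = ≈-pointwise λ _ → refl
indicator-× (no ¬p) (yes q) = ≈-pointwise λ _ → refl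
indicator-× (no ¬p) (no ¬q) = ≈-pointwise λ _ → refl

-- A list of class representatives, one for each class. Its length depends on `R` alone, so the
-- number of components can be read off from whichever list an argument produces.
record Transversal {A : Set} (R : A → A → Set) (ys : List A) : Set where
  constructor mkTransversal
  field
    independent : AllPairs (λ u v → ¬ R u v) ys
    complete    : ∀ u → Any (R u) ys

open Transversal

-- An independent list has at most one member in the class of `y`, so discarding that class costs at
-- most one element.
independent-length-filter : ∀ {A : Set} {R : A → A → Set} (eq : IsDecEquivalence R) y xs →
  AllPairs (λ u v → ¬ R u v) xs →
  length xs ℕ.≤ suc (length (filter (λ x → ¬? (IsDecEquivalence._≟_ eq y x)) xs))
independent-length-filter eq y [] [] = ℕ.z≤n
independent-length-filter {R = R} eq y (x ∷ xs) (p ∷ ps) with IsDecEquivalence._≟_ eq y x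
... | no _  = ℕ.s≤s (independent-length-filter eq y xs ps)
... | yes r = ℕ.s≤s (ℕ.≤-reflexive (cong length (sym (List.filter-all _
        (All.map (λ ¬xz yz → ¬xz (E.trans (E.sym r) yz)) p)))))
  where module E = IsDecEquivalence eq

-- Pigeonhole by induction on `ys`: dropping the class of the head `y` removes at most one element
-- of `xs`, and the remaining ones must be represented in the tail.
independent-length≤ : ∀ {A : Set} {R : A → A → Set} (eq : IsDecEquivalence R) xs ys →
  AllPairs (λ u v → ¬ R u v) xs → All (λ x → Any (R x) ys) xs → length xs ℕ.≤ length ys
independent-length≤ eq []       []       _  _        = ℕ.z≤n
independent-length≤ eq (x ∷ xs) []       _  (() ∷ _)
independent-length≤ {R = R} eq xs (y ∷ ys) ps qs = ℕ.≤-trans (independent-length-filter eq y xs ps)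
  (ℕ.s≤s (independent-length≤ eq (filter y≁? xs) ys (AllPairs.filter⁺ y≁? ps)
    (All.zipWith (λ { (y≁x , here x~y) → contradiction (E.sym x~y) y≁x ; (y≁x , there q) → q })
      (All.all-filter y≁? xs , All.filter⁺ y≁? qs))))
  where
  module E = IsDecEquivalence eq
  y≁? = λ x → ¬? (y E.≟ x)

transversal-length : ∀ {A : Set} {R : A → A → Set} (eq : IsDecEquivalence R) {xs ys} →
  Transversal R xs → Transversal R ys → length xs ≡ length ys
transversal-length eq {xs} {ys} s t = ℕ.≤-antisym
  (independent-length≤ eq xs ys (independent s) (All.tabulate λ {x} _ → complete t x))
  (independent-length≤ eq ys xs (independent t) (All.tabulate λ {y} _ → complete s y))

Constant : ∀ {n} → (Fin n → Fin n → Set) → Vec Sign n → Set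
Constant R σ = ∀ u v → R u v → lookup σ u ≡ lookup σ v

constant? : ∀ {n} {R : Fin n → Fin n → Set} → (∀ u v → Dec (R u v)) → ∀ σ → Dec (Constant R σ)
constant? R? σ = Fin.all? λ u → Fin.all? λ v → R? u v →-dec (lookup σ u Sign.≟ lookup σ v)

-- Induction on the vertices: vertex `zero` is either related to some later vertex, which forces its
-- spin, or a class of its own, which doubles the count. The relation is abstract because
-- restricting `Connected` to the later vertices need not give the connectivity of a list of edges;
-- the transversal is built along with the count.
∑-constant : ∀ {n} (R : Fin n → Fin n → Set) (eq : IsDecEquivalence R) → ∃ λ ys → Transversal R ys ×
  ∑ (configurations n) (λ σ → indicator (constant? (IsDecEquivalence._≟_ eq) σ)) ≈ ℕ→ℝ 2 ^ᴿ length ys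
∑-constant {zero} R eq = [] , mkTransversal [] (λ ()) , ≈-pointwise λ _ → refl
∑-constant {suc n} R eq
  with ∑-constant (λ u v → R (suc u) (suc v)) (On.isDecEquivalence suc eq)
     | Fin.any? (λ j → IsDecEquivalence._≟_ eq zero (suc j))
... | ys , t , h | yes (j , r) = map suc ys
  , mkTransversal (AllPairs.map⁺ (independent t))
      (λ { zero    → Any.map⁺ (Any.map (E.trans r) (complete t j))
         ; (suc u) → Any.map⁺ (complete t u) })
  , (begin
      ∑ (configurations (suc n)) c
        ≈⟨ ∑-configurations-suc n c ⟩
      ∑ (configurations n) (λ σ → c (Sign.+ ∷ σ)) +ᴿ ∑ (configurations n) (λ σ → c (Sign.- ∷ σ))
        ≈⟨ ≈-sym (∑-+ (configurations n) (λ σ → c (Sign.+ ∷ σ)) (λ σ → c (Sign.- ∷ σ))) ⟩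
      ∑ (configurations n) (λ σ → c (Sign.+ ∷ σ) +ᴿ c (Sign.- ∷ σ))
        ≈⟨ ∑-cong (configurations n) (λ σ → ≈-trans (+ᴿ-cong (factor Sign.+ σ) (factor Sign.- σ))
             (one-sign (lookup σ j) (c′ σ))) ⟩
      ∑ (configurations n) c′
        ≈⟨ h ⟩
      ℕ→ℝ 2 ^ᴿ length ys
        ≡⟨ cong (ℕ→ℝ 2 ^ᴿ_) (sym (List.length-map suc ys)) ⟩
      ℕ→ℝ 2 ^ᴿ length (map suc ys) ∎)
  where
  module E = IsDecEquivalence eq
  open SetoidReasoning ≈-setoid
  R?′ = λ u v → suc u E.≟ suc v
  c = λ σ → indicator (constant? E._≟_ σ)
  c′ = λ σ → indicator (constant? R?′ σ)
  factor : ∀ s σ → c (s ∷ σ) ≈ indicator (s Sign.≟ lookup σ j) *ᴿ c′ σ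
  factor s σ = ≈-trans
    (≈-reflexive (indicator-⇔ (constant? E._≟_ (s ∷ σ)) (s Sign.≟ lookup σ j ×-dec constant? R?′ σ)
      (λ h → h zero (suc j) r , λ u v → h (suc u) (suc v))
      (λ { (_ , _) zero    zero    _ → refl
         ; (p , h) zero    (suc v) q → trans p (h j v (E.trans (E.sym r) q))
         ; (p , h) (suc u) zero    q → trans (h u j (E.trans q r)) (sym p)
         ; (_ , h) (suc u) (suc v) q → h u v q })))
    (indicator-× (s Sign.≟ lookup σ j) (constant? R?′ σ))
  one-sign : ∀ t x → indicator (Sign.+ Sign.≟ t) *ᴿ x +ᴿ indicator (Sign.- Sign.≟ t) *ᴿ x ≈ x
  one-sign Sign.+ x = ≈-pointwise λ n → solve 1 (λ x → con 1ℚ :* x :+ con 0ℚ :* x := x) refl (seq x n)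
  one-sign Sign.- x = ≈-pointwise λ n → solve 1 (λ x → con 0ℚ :* x :+ con 1ℚ :* x := x) refl (seq x n)
... | ys , t , h | no ¬r = zero ∷ map suc ys
  , mkTransversal (All.map⁺ (All.tabulate λ {u} _ r → ¬r (u , r)) ∷ AllPairs.map⁺ (independent t))
      (λ { zero → here E.refl ; (suc u) → there (Any.map⁺ (complete t u)) })
  , (begin
      ∑ (configurations (suc n)) c
        ≈⟨ ∑-configurations-suc n c ⟩
      ∑ (configurations n) (λ σ → c (Sign.+ ∷ σ)) +ᴿ ∑ (configurations n) (λ σ → c (Sign.- ∷ σ))
        ≈⟨ +ᴿ-cong (≈-trans (free Sign.+) h) (≈-trans (free Sign.-) h) ⟩
      ℕ→ℝ 2 ^ᴿ length ys +ᴿ ℕ→ℝ 2 ^ᴿ length ys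
        ≈⟨ ≈-pointwise (λ n → solve 1 (λ x → x :+ x := con (ℕ→ℚ 2) :* x) refl (seq (ℕ→ℝ 2 ^ᴿ length ys) n)) ⟩
      ℕ→ℝ 2 ^ᴿ suc (length ys)
        ≡⟨ cong (λ k → ℕ→ℝ 2 ^ᴿ suc k) (sym (List.length-map suc ys)) ⟩
      ℕ→ℝ 2 ^ᴿ suc (length (map suc ys)) ∎)
  where
  module E = IsDecEquivalence eq
  open SetoidReasoning ≈-setoid
  c = λ σ → indicator (constant? E._≟_ σ)
  R?′ = λ u v → suc u E.≟ suc v
  free : ∀ s → ∑ (configurations n) (λ σ → c (s ∷ σ)) ≈ ∑ (configurations n) (λ σ → indicator (constant? R?′ σ))
  free s = ∑-cong (configurations n) λ σ → ≈-reflexive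
    (indicator-⇔ (constant? E._≟_ (s ∷ σ)) (constant? R?′ σ)
      (λ h u v → h (suc u) (suc v))
      (λ { h zero    zero    _ → refl
         ; h zero    (suc v) q → contradiction (v , q) ¬r
         ; h (suc u) zero    q → contradiction (u , E.sym q) ¬r
         ; h (suc u) (suc v) q → h u v q }))

connected-isDecEquivalence : ∀ {n} (A : List (Fin n × Fin n)) → IsDecEquivalence (Connected A)
connected-isDecEquivalence A = record
  { isEquivalence = EqClosure.isEquivalence (Adjacent A)
  ; _≟_ = connected? A
  }

component-transversal : ∀ {n} (A : List (Fin n × Fin n)) →
  Transversal (Connected A) (deduplicate (connected? A) (allFin n))
component-transversal {n} A = mkTransversal
  (DecSetoid.deduplicate-! (record { isDecEquivalence = connected-isDecEquivalence A }) (allFin n))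
  (λ u → Any.deduplicate⁺ (connected? A) (λ q p → E.trans p (E.sym q))
    (Any.map (λ { refl → E.refl }) (∈-allFin u)))
  where module E = IsDecEquivalence (connected-isDecEquivalence A)

transversal-components : ∀ {n} (A : List (Fin n × Fin n)) {ys} → Transversal (Connected A) ys →
  components A ≡ length ys
transversal-components A t =
  transversal-length (connected-isDecEquivalence A) (component-transversal A) t

∑-connected-constant : ∀ {n} (A : List (Fin n × Fin n)) →
  ∑ (configurations n) (λ σ → indicator (constant? (connected? A) σ)) ≈ ℕ→ℝ 2 ^ᴿ components A
∑-connected-constant A with ∑-constant (Connected A) (connected-isDecEquivalence A)
... | ys , t , h = ≈-trans h (≈-reflexive (cong (ℕ→ℝ 2 ^ᴿ_) (sym (transversal-components A t))))

δ : Sign → Sign → ℝ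
δ s t = indicator (s Sign.≟ t)

∏-δ : ∀ {n} (A : List (Fin n × Fin n)) σ →
  ∏ A (λ (u , v) → δ (lookup σ u) (lookup σ v)) ≈ indicator (constant? (connected? A) σ)
-- The empty product is read as the indicator of the true proposition `σ ≡ σ`.
∏-δ [] σ = ≈-reflexive (indicator-⇔ (yes refl) (constant? (connected? []) σ)
  (λ { refl u v p → cong (lookup σ) (connected-[] p) }) (λ _ → refl {x = σ}))
∏-δ ((a , b) ∷ A) σ = ≈-trans (*ᴿ-congˡ (δ (lookup σ a) (lookup σ b)) (∏-δ A σ))
  (≈-trans (≈-sym (indicator-× a≟b constA?))
    (≈-reflexive (indicator-⇔ (a≟b ×-dec constA?) (constant? (connected? ((a , b) ∷ A)) σ)
      (λ (p , h) u v q → via p h (split q))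
      (λ h → h a b (fwd (here refl) ◅ ε) , λ u v p → h u v (weaken p)))))
  where
  a≟b = lookup σ a Sign.≟ lookup σ b
  constA? = constant? (connected? A) σ
  via : lookup σ a ≡ lookup σ b → Constant (Connected A) σ → ∀ {u v} → Via u v → lookup σ u ≡ lookup σ v
  via p h (inj₁ q)              = h _ _ q
  via p h (inj₂ (inj₁ (q , r))) = trans (h _ _ q) (trans p (h _ _ r))
  via p h (inj₂ (inj₂ (q , r))) = trans (h _ _ q) (trans (sym p) (h _ _ r))

-- Bounds on the number of components

-- Take a transversal for `A` and discard the class of `b`. A path that uses the new edge has one
-- end in that class, so the remaining vertices stay unconnected in `(a , b) ∷ A`.
components-∷ : ∀ {n} (e : Fin n × Fin n) A → components A ℕ.≤ suc (components (e ∷ A))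
components-∷ {n} (a , b) A = ℕ.≤-trans
  (independent-length-filter eqA b ys (independent t))
  (ℕ.s≤s (independent-length≤ (connected-isDecEquivalence ((a , b) ∷ A)) (filter b≁? ys) _
    (strengthen (All.all-filter b≁? ys) (AllPairs.filter⁺ b≁? (independent t)))
    (All.tabulate λ {u} _ → complete (component-transversal ((a , b) ∷ A)) u)))
  where
  eqA = connected-isDecEquivalence A
  module E = IsDecEquivalence eqA
  t = component-transversal A
  ys = deduplicate (connected? A) (allFin n)
  b≁? = λ x → ¬? (connected? A b x)
  separate : ∀ {u v} → ¬ Connected A b u → ¬ Connected A b v → ¬ Connected A u v → ¬ Via {a = a} {b} {A} u v
  separate b≁u b≁v u≁v (inj₁ p)              = u≁v p
  separate b≁u b≁v u≁v (inj₂ (inj₁ (_ , q))) = b≁v q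
  separate b≁u b≁v u≁v (inj₂ (inj₂ (p , _))) = b≁u (E.sym p)
  strengthen : ∀ {zs} → All (λ z → ¬ Connected A b z) zs → AllPairs (λ u v → ¬ Connected A u v) zs →
    AllPairs (λ u v → ¬ Connected ((a , b) ∷ A) u v) zs
  strengthen []       []       = []
  strengthen (p ∷ ps) (q ∷ qs) =
    All.zipWith (λ (b≁v , u≁v) c → separate p b≁v u≁v (split c)) (ps , q) ∷ strengthen ps qs

-- The edgeless graph has n components and each edge lowers their number by at most one. This makes
-- the subtraction in `nullity` exact.
vertices≤edges+components : ∀ {n} (A : List (Fin n × Fin n)) → n ℕ.≤ length A + components A
vertices≤edges+components {n} [] = ℕ.≤-trans (ℕ.≤-reflexive (sym (List.length-tabulate {n = n} (λ i → i))))
  (independent-length≤ (connected-isDecEquivalence []) (allFin n) _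
    (AllPairs.map (λ u≢v p → u≢v (connected-[] p)) (Unique.allFin⁺ n))
    (All.tabulate λ {u} _ → complete (component-transversal []) u))
vertices≤edges+components (e ∷ A) = ℕ.≤-trans (vertices≤edges+components A)
  (ℕ.≤-trans (ℕ.+-monoʳ-≤ (length A) (components-∷ e A)) (ℕ.≤-reflexive (ℕ.+-suc (length A) (components (e ∷ A)))))

components≤vertices : ∀ {n} (A : List (Fin n × Fin n)) → components A ℕ.≤ n
components≤vertices {n} A = subst (components A ℕ.≤_) (List.length-tabulate {n = n} (λ i → i))
  (List.length-deduplicate (connected? A) (allFin n))

-- The Ising model and its expansions

edgeWeight : ℝ → Sign → Sign → ℝ
edgeWeight k s t = exp (k *ᴿ (spin s *ᴿ spin t))

weight : ∀ {n} → ℝ → List (Fin n × Fin n) → Vec Sign n → ℝ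
weight k es σ = ∏ es λ (u , v) → edgeWeight k (lookup σ u) (lookup σ v)

isingZ≈∑weight : ∀ G β J → isingZ G β J ≈ ∑ (configurations (∣V∣ G)) (weight (β *ᴿ J) (edges G))
isingZ≈∑weight G β J = ∑-cong (configurations (∣V∣ G)) λ σ → exp-∑ (edges G) (β *ᴿ J) _

edgeWeight-equal : ∀ k s → edgeWeight k s s ≈ exp k
edgeWeight-equal k Sign.+ = exp-cong (≈-pointwise λ n →
  solve 1 (λ k → k :* (con 1ℚ :* con 1ℚ) := k) refl (seq k n))
edgeWeight-equal k Sign.- = exp-cong (≈-pointwise λ n →
  solve 1 (λ k → k :* ((:- con 1ℚ) :* (:- con 1ℚ)) := k) refl (seq k n))

edgeWeight+- : ∀ k → edgeWeight k Sign.+ Sign.- ≈ exp (-ᴿ k)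
edgeWeight+- k = exp-cong (≈-pointwise λ n →
  solve 1 (λ k → k :* (con 1ℚ :* (:- con 1ℚ)) := :- k) refl (seq k n))

edgeWeight-+ : ∀ k → edgeWeight k Sign.- Sign.+ ≈ exp (-ᴿ k)
edgeWeight-+ k = exp-cong (≈-pointwise λ n →
  solve 1 (λ k → k :* ((:- con 1ℚ) :* con 1ℚ) := :- k) refl (seq k n))

exp[-k]*exp[2k] : ∀ k → exp (-ᴿ k) *ᴿ exp (ℕ→ℝ 2 *ᴿ k) ≈ exp k
exp[-k]*exp[2k] k = ≈-trans (≈-sym (exp-+ (-ᴿ k) (ℕ→ℝ 2 *ᴿ k)))
  (exp-cong (≈-pointwise λ n → solve 1 (λ k → (:- k) :+ con (ℕ→ℚ 2) :* k := k) refl (seq k n)))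

edgeWeight-δ : ∀ k s t →
  edgeWeight k s t ≈ exp (-ᴿ k) *ᴿ (1ᴿ +ᴿ (exp (ℕ→ℝ 2 *ᴿ k) -ᴿ 1ᴿ) *ᴿ δ s t)
edgeWeight-δ k s t = helper s t
  where
  c = exp (-ᴿ k)
  e² = exp (ℕ→ℝ 2 *ᴿ k)
  equal : ∀ s → edgeWeight k s s ≈ c *ᴿ (1ᴿ +ᴿ (e² -ᴿ 1ᴿ) *ᴿ 1ᴿ)
  equal s = ≈-trans (edgeWeight-equal k s) (≈-trans (≈-sym (exp[-k]*exp[2k] k))
    (≈-pointwise λ n → solve 2 (λ c e → c :* e := c :* (con 1ℚ :+ (e :- con 1ℚ) :* con 1ℚ)) refl (seq c n) (seq e² n)))
  unequal : c ≈ c *ᴿ (1ᴿ +ᴿ (e² -ᴿ 1ᴿ) *ᴿ 0ᴿ)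
  unequal = ≈-pointwise λ n →
    solve 2 (λ c e → c := c :* (con 1ℚ :+ (e :- con 1ℚ) :* con 0ℚ)) refl (seq c n) (seq e² n)
  helper : ∀ s t → edgeWeight k s t ≈ c *ᴿ (1ᴿ +ᴿ (e² -ᴿ 1ᴿ) *ᴿ δ s t)
  helper Sign.+ Sign.+ = equal Sign.+
  helper Sign.- Sign.- = equal Sign.-
  helper Sign.+ Sign.- = ≈-trans (edgeWeight+- k) unequal
  helper Sign.- Sign.+ = ≈-trans (edgeWeight-+ k) unequal

edgeWeight-tanh : ∀ k s t → edgeWeight k s t ≈ cosh k *ᴿ (1ᴿ +ᴿ tanh k *ᴿ (spin s *ᴿ spin t))
edgeWeight-tanh k s t = ≈-trans (helper s t) (≈-trans (+ᴿ-cong {cosh k} ≈-refl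
    (*ᴿ-congʳ (spin s *ᴿ spin t) (≈-sym (÷-*-cancel (sinh k) (cosh k) (cosh-pos k)))))
    (≈-pointwise λ n → solve 3 (λ c z s → c :+ (c :* z) :* s := c :* (con 1ℚ :+ z :* s)) refl
      (seq (cosh k) n) (seq (tanh k) n) (seq (spin s *ᴿ spin t) n)))
  where
  e = exp k
  e⁻ = exp (-ᴿ k)
  helper : ∀ s t → edgeWeight k s t ≈ cosh k +ᴿ sinh k *ᴿ (spin s *ᴿ spin t)
  helper Sign.+ Sign.+ = ≈-trans (edgeWeight-equal k Sign.+) (≈-pointwise λ n →
    solve 2 (λ e f → e := con ½ :* (e :+ f) :+ (con ½ :* (e :- f)) :* (con 1ℚ :* con 1ℚ)) refl (seq e n) (seq e⁻ n))
  helper Sign.- Sign.- = ≈-trans (edgeWeight-equal k Sign.-) (≈-pointwise λ n →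
    solve 2 (λ e f → e := con ½ :* (e :+ f) :+ (con ½ :* (e :- f)) :* ((:- con 1ℚ) :* (:- con 1ℚ))) refl (seq e n) (seq e⁻ n))
  helper Sign.+ Sign.- = ≈-trans (edgeWeight+- k) (≈-pointwise λ n →
    solve 2 (λ e f → f := con ½ :* (e :+ f) :+ (con ½ :* (e :- f)) :* (con 1ℚ :* (:- con 1ℚ))) refl (seq e n) (seq e⁻ n))
  helper Sign.- Sign.+ = ≈-trans (edgeWeight-+ k) (≈-pointwise λ n →
    solve 2 (λ e f → f := con ½ :* (e :+ f) :+ (con ½ :* (e :- f)) :* ((:- con 1ℚ) :* con 1ℚ)) refl (seq e n) (seq e⁻ n))

∑weight-clusters : ∀ {n} k (es : List (Fin n × Fin n)) →
  ∑ (configurations n) (weight k es) ≈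
  exp (-ᴿ k) ^ᴿ length es *ᴿ
    ∑ (sublists es) λ A → (exp (ℕ→ℝ 2 *ᴿ k) -ᴿ 1ᴿ) ^ᴿ length A *ᴿ ℕ→ℝ 2 ^ᴿ components A
∑weight-clusters {n} k es = begin
    ∑ (configurations n) (weight k es)
      ≈⟨ ∑-cong (configurations n) (λ σ → ≈-trans
           (∏-cong es λ (a , b) → edgeWeight-δ k (lookup σ a) (lookup σ b))
           (≈-trans (∏-scale es c _) (*ᴿ-congˡ (c ^ᴿ length es) (∏-1+ es v _)))) ⟩
    ∑ (configurations n) (λ σ → c ^ᴿ length es *ᴿ ∑ (sublists es) (λ A → v ^ᴿ length A *ᴿ Π A σ))
      ≈⟨ ≈-sym (*-∑ (configurations n) (c ^ᴿ length es) _) ⟩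
    c ^ᴿ length es *ᴿ ∑ (configurations n) (λ σ → ∑ (sublists es) (λ A → v ^ᴿ length A *ᴿ Π A σ))
      ≈⟨ *ᴿ-congˡ (c ^ᴿ length es) (≈-trans
           (∑-swap (configurations n) (sublists es) (λ σ A → v ^ᴿ length A *ᴿ Π A σ))
           (∑-cong (sublists es) λ A → ≈-trans
             (≈-sym (*-∑ (configurations n) (v ^ᴿ length A) (Π A)))
             (*ᴿ-congˡ (v ^ᴿ length A) (≈-trans
               (∑-cong (configurations n) (∏-δ A)) (∑-connected-constant A))))) ⟩
    c ^ᴿ length es *ᴿ ∑ (sublists es) (λ A → v ^ᴿ length A *ᴿ ℕ→ℝ 2 ^ᴿ components A) ∎
  where
  open SetoidReasoning ≈-setoid
  c = exp (-ᴿ k)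
  v = exp (ℕ→ℝ 2 *ᴿ k) -ᴿ 1ᴿ
  Π = λ A σ → ∏ A λ (a , b) → δ (lookup σ a) (lookup σ b)

-- The two truncated subtractions in the exponents are evaluated with ∣V∣ - 1 = n and components A = suc j.
cluster-term : ∀ {n} (es A : List (Fin (suc n) × Fin (suc n))) → components es ≡ 1 →
  ∀ x v → v *ᴿ (x -ᴿ 1ᴿ) ≈ ℕ→ℝ 2 →
  (ℕ→ℝ 2 *ᴿ v ^ᴿ n) *ᴿ ((x -ᴿ 1ᴿ) ^ᴿ (rank es ∸ rank A) *ᴿ v ^ᴿ nullity A)
    ≈ v ^ᴿ length A *ᴿ ℕ→ℝ 2 ^ᴿ components A
cluster-term {n} es A k[es]≡1 x v h = begin
    (ℕ→ℝ 2 *ᴿ v ^ᴿ n) *ᴿ (w ^ᴿ (rank es ∸ rank A) *ᴿ v ^ᴿ q)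
      ≡⟨ cong₂ (λ a b → (ℕ→ℝ 2 *ᴿ v ^ᴿ a) *ᴿ (w ^ᴿ b *ᴿ v ^ᴿ q)) (sym (ℕ.m∸n+n≡m j≤n))
           (trans (cong (λ k → (suc n ∸ k) ∸ r) k[es]≡1) (ℕ.m∸[m∸n]≡n j≤n)) ⟩
    (ℕ→ℝ 2 *ᴿ v ^ᴿ (r + j)) *ᴿ (w ^ᴿ j *ᴿ v ^ᴿ q)
      ≈⟨ *ᴿ-congʳ (w ^ᴿ j *ᴿ v ^ᴿ q) (*ᴿ-congˡ (ℕ→ℝ 2) (^-+ v r j)) ⟩
    (ℕ→ℝ 2 *ᴿ (v ^ᴿ r *ᴿ v ^ᴿ j)) *ᴿ (w ^ᴿ j *ᴿ v ^ᴿ q)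
      ≈⟨ ≈-pointwise (λ i → solve 5 (λ two a b c d → (two :* (a :* b)) :* (c :* d) := (a :* d) :* (two :* (b :* c))) refl
           (ℕ→ℚ 2) (seq (v ^ᴿ r) i) (seq (v ^ᴿ j) i) (seq (w ^ᴿ j) i) (seq (v ^ᴿ q) i)) ⟩
    -- Of the n = r + j factors v, j pair with the factors w to give 2ʲ, which the leading 2
    -- completes to 2ʲ⁺¹; the other r raise the nullity exponent to the number of edges.
    (v ^ᴿ r *ᴿ v ^ᴿ q) *ᴿ (ℕ→ℝ 2 *ᴿ (v ^ᴿ j *ᴿ w ^ᴿ j))
      ≈⟨ *ᴿ-cong (≈-sym (^-+ v r q))
           (*ᴿ-congˡ (ℕ→ℝ 2) (≈-trans (≈-sym (^-distrib-* v w j)) (^-cong j h))) ⟩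
    v ^ᴿ (r + q) *ᴿ (ℕ→ℝ 2 *ᴿ ℕ→ℝ 2 ^ᴿ j)
      ≡⟨ cong (λ a → v ^ᴿ a *ᴿ ℕ→ℝ 2 ^ᴿ suc j) (ℕ.m+[n∸m]≡n r≤∣A∣) ⟩
    v ^ᴿ length A *ᴿ ℕ→ℝ 2 ^ᴿ components A ∎
  where
  open SetoidReasoning ≈-setoid
  w = x -ᴿ 1ᴿ
  r = rank A
  q = nullity A
  -- `deduplicate` always keeps the first vertex, so `components A` is `suc j` by computation.
  j = ℕ.pred (components A)
  j≤n : j ℕ.≤ n
  j≤n = ℕ.≤-pred (components≤vertices A)
  r≤∣A∣ : r ℕ.≤ length A
  r≤∣A∣ = ℕ.m≤n+o⇒m∸n≤o _ (components A) (subst (suc n ℕ.≤_) (ℕ.+-comm (length A) (components A)) (vertices≤edges+components A))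

-- The point of evaluation lies on the hyperbola (x - 1)(y - 1) = 2 that belongs to two spin states:
-- y - 1 is v, and x - 1 = 2 / v.
fortuinKasteleyn : ∀ {n} (es : List (Fin (suc n) × Fin (suc n))) → components es ≡ 1 →
  ∀ β J (0<v : Positive (exp (ℕ→ℝ 2 *ᴿ (β *ᴿ J)) -ᴿ 1ᴿ)) →
  let k = β *ᴿ J
      e² = exp (ℕ→ℝ 2 *ᴿ k)
  in ℕ→ℝ 2 *ᴿ (e² -ᴿ 1ᴿ) ^ᴿ n *ᴿ exp (-ᴿ (k *ᴿ ℕ→ℝ (length es)))
       *ᴿ tutte (mkGraph (suc n) es) ((e² +ᴿ 1ᴿ) ÷ (e² -ᴿ 1ᴿ) by 0<v) e²
     ≈ isingZ (mkGraph (suc n) es) β J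
fortuinKasteleyn {n} es k[es]≡1 β J 0<v = begin
    ℕ→ℝ 2 *ᴿ v ^ᴿ n *ᴿ exp (-ᴿ (k *ᴿ ℕ→ℝ (length es))) *ᴿ T
      ≈⟨ ≈-pointwise (λ i → solve 3 (λ a c t → (a :* c) :* t := c :* (a :* t)) refl (seq (ℕ→ℝ 2 *ᴿ v ^ᴿ n) i) (seq (exp (-ᴿ (k *ᴿ ℕ→ℝ (length es)))) i) (seq T i)) ⟩
    exp (-ᴿ (k *ᴿ ℕ→ℝ (length es))) *ᴿ ((ℕ→ℝ 2 *ᴿ v ^ᴿ n) *ᴿ T)
      ≈⟨ *ᴿ-cong
           (≈-trans (exp-cong {y = (-ᴿ k) *ᴿ ℕ→ℝ (length es)}
               (≈-pointwise λ i → solve 2 (λ k m → :- (k :* m) := (:- k) :* m) refl (seq k i) (ℕ→ℚ (length es))))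
             (exp-*-ℕ (-ᴿ k) (length es)))
           (≈-trans (*-∑ (sublists es) (ℕ→ℝ 2 *ᴿ v ^ᴿ n) _)
             (∑-cong (sublists es) λ A → cluster-term es A k[es]≡1 x v v[x-1]≈2)) ⟩
    exp (-ᴿ k) ^ᴿ length es *ᴿ ∑ (sublists es) (λ A → v ^ᴿ length A *ᴿ ℕ→ℝ 2 ^ᴿ components A)
      ≈⟨ ≈-sym (∑weight-clusters k es) ⟩
    ∑ (configurations (suc n)) (weight k es)
      ≈⟨ ≈-sym (isingZ≈∑weight (mkGraph (suc n) es) β J) ⟩
    isingZ (mkGraph (suc n) es) β J ∎
  where
  open SetoidReasoning ≈-setoid
  k = β *ᴿ J
  e² = exp (ℕ→ℝ 2 *ᴿ k)
  v = e² -ᴿ 1ᴿ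
  x = (e² +ᴿ 1ᴿ) ÷ v by 0<v
  T = tutte (mkGraph (suc n) es) x e²
  v[x-1]≈2 : v *ᴿ (x -ᴿ 1ᴿ) ≈ ℕ→ℝ 2
  v[x-1]≈2 = ≈-trans
    (≈-pointwise λ i → solve 2 (λ v x → v :* (x :- con 1ℚ) := v :* x :- v) refl (seq v i) (seq x i))
    (≈-trans (+ᴿ-cong (÷-*-cancel (e² +ᴿ 1ᴿ) v 0<v) (≈-refl { -ᴿ v }))
      (≈-pointwise λ i → solve 1 (λ e → (e :+ con 1ℚ) :- (e :- con 1ℚ) := con (ℕ→ℚ 2)) refl (seq e² i)))

-- The Sierpiński graphs

embed-edge : ∀ {i} → Fin 3 → Fin (3 + i) × Fin (3 + i) → Fin (6 + 3 ℕ.* i) × Fin (6 + 3 ℕ.* i)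
embed-edge c (u , v) = embed c u , embed c v

embed-connected : ∀ G c {u v} → Connected (cornerEdges G) u v →
  Connected (cornerEdges (amalgam G)) (embed {i G} c u) (embed c v)
embed-connected G c = EqClosure.gmap (embed {i G} c) λ e →
  ∈-concat⁺′ (∈-map⁺ (embed-edge {i G} c) e) (∈-map⁺ (λ c → map (embed-edge {i G} c) (cornerEdges G)) (∈-allFin c))

amalgam-connected : ∀ G → (∀ v → Connected (cornerEdges G) 0F v) →
  ∀ v → Connected (cornerEdges (amalgam G)) 0F v
amalgam-connected G h = reach
  where
  top : ∀ c → Connected (cornerEdges (amalgam G)) 0F (embed {i G} c 0F)
  top 0F = ε
  -- The top of copy 1 is the left corner of copy 0, and below, the top of copy 2 is its right
  -- corner; both are reached inside copy 0.
  top 1F = embed-connected G 0F (h 1F)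
  top 2F = embed-connected G 0F (h 2F)
  copy : ∀ c w → Connected (cornerEdges (amalgam G)) 0F (embed {i G} c w)
  copy c w = top c ◅◅ embed-connected G c (h w)
  reach : ∀ v → Connected (cornerEdges (amalgam G)) 0F v
  reach 0F = copy 0F 0F
  reach 1F = copy 1F 1F
  reach 2F = copy 2F 2F
  reach 3F = copy 0F 1F
  reach 4F = copy 0F 2F
  reach 5F = copy 1F 2F
  reach (suc (suc (suc (suc (suc (suc x)))))) with Fin.combine-surjective {3} {i G} x
  ... | c , w , refl = copy c (suc (suc (suc w)))

Γ-connected : ∀ n .{{_ : NonZero n}} v → Connected (edges (Γ n)) 0F v
Γ-connected 1 0F = ε
Γ-connected 1 1F = EqClosure.return (here refl)
Γ-connected 1 2F = EqClosure.return (there (here refl))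
Γ-connected (suc (suc n)) = amalgam-connected (Γ′ (suc n)) (Γ-connected (suc n))

components-Γ : ∀ n .{{_ : NonZero n}} → components (edges (Γ n)) ≡ 1
components-Γ n = transversal-components (edges (Γ n)) {0F ∷ []}
  (mkTransversal ([] ∷ []) λ u → here (EqClosure.symmetric _ (Γ-connected n u)))

-- Partition functions with prescribed corner spins

cornerZ : ℝ → CornerGraph → Sign → Sign → Sign → ℝ
cornerZ k G a b c = ∑ (configurations (i G)) λ τ → weight k (cornerEdges G) (a ∷ b ∷ c ∷ τ)

weight-map : ∀ {m n} k (f : Fin m → Fin n) es σ τ → (∀ v → lookup τ (f v) ≡ lookup σ v) →
  weight k (map (λ (u , v) → f u , f v) es) τ ≈ weight k es σ
weight-map k f es σ τ h = ≈-trans (≈-reflexive (∏-map (λ (u , v) → f u , f v) es _))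
  (∏-cong es λ (u , v) → ≈-reflexive (cong₂ (edgeWeight k) (h u) (h v)))

-- `p`, `q`, `r` are the spins of the glued vertices 3, 4, 5, shared by the copies 0 and 1, 0 and 2,
-- 1 and 2. The edge list is the concatenation of those of the copies, so the weight factorises.
weight-amalgam : ∀ k G a b c p q r τ₁ τ₂ τ₃ →
  let w = weight k (cornerEdges G) in
  weight k (cornerEdges (amalgam G)) (a ∷ b ∷ c ∷ p ∷ q ∷ r ∷ concat (τ₁ ∷ τ₂ ∷ τ₃ ∷ []))
    ≈ w (a ∷ p ∷ q ∷ τ₁) *ᴿ (w (p ∷ b ∷ r ∷ τ₂) *ᴿ w (q ∷ r ∷ c ∷ τ₃))
weight-amalgam k G a b c p q r τ₁ τ₂ τ₃ = ≈-trans (∏-++ (es 0F) (es 1F ++ (es 2F ++ [])) _)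
  (*ᴿ-cong (weight-map k (embed 0F) (cornerEdges G) (a ∷ p ∷ q ∷ τ₁) σ copy₁)
    (≈-trans (∏-++ (es 1F) (es 2F ++ []) _)
      (*ᴿ-cong (weight-map k (embed 1F) (cornerEdges G) (p ∷ b ∷ r ∷ τ₂) σ copy₂)
        (≈-trans (≈-reflexive (cong (λ es → weight k es σ) (List.++-identityʳ (es 2F))))
          (weight-map k (embed 2F) (cornerEdges G) (q ∷ r ∷ c ∷ τ₃) σ copy₃)))))
  where
  es = λ c → map (embed-edge {i G} c) (cornerEdges G)
  σ = a ∷ b ∷ c ∷ p ∷ q ∷ r ∷ concat (τ₁ ∷ τ₂ ∷ τ₃ ∷ [])
  inner = Vec.lookup-concat (τ₁ ∷ τ₂ ∷ τ₃ ∷ [])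
  copy₁ : ∀ v → lookup σ (embed 0F v) ≡ lookup (a ∷ p ∷ q ∷ τ₁) v
  copy₁ 0F = refl
  copy₁ 1F = refl
  copy₁ 2F = refl
  copy₁ (suc (suc (suc w))) = inner 0F w
  copy₂ : ∀ v → lookup σ (embed 1F v) ≡ lookup (p ∷ b ∷ r ∷ τ₂) v
  copy₂ 0F = refl
  copy₂ 1F = refl
  copy₂ 2F = refl
  copy₂ (suc (suc (suc w))) = inner 1F w
  copy₃ : ∀ v → lookup σ (embed 2F v) ≡ lookup (q ∷ r ∷ c ∷ τ₃) v
  copy₃ 0F = refl
  copy₃ 1F = refl
  copy₃ 2F = refl
  copy₃ (suc (suc (suc w))) = inner 2F w

∑-configurations-concat : ∀ n f (g₁ g₂ g₃ : Vec Sign n → ℝ) →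
  (∀ τ₁ τ₂ τ₃ → f (concat (τ₁ ∷ τ₂ ∷ τ₃ ∷ [])) ≈ g₁ τ₁ *ᴿ (g₂ τ₂ *ᴿ g₃ τ₃)) →
  ∑ (configurations (3 ℕ.* n)) f
    ≈ ∑ (configurations n) g₁ *ᴿ (∑ (configurations n) g₂ *ᴿ ∑ (configurations n) g₃)
∑-configurations-concat n f g₁ g₂ g₃ h = begin
    ∑ (configurations (3 ℕ.* n)) f
      ≈⟨ ∑-configurations-++ n (2 ℕ.* n) f ⟩
    ∑ C (λ τ₁ → ∑ (configurations (2 ℕ.* n)) (λ ρ → f (τ₁ ++ᵥ ρ)))
      ≈⟨ ∑-cong C (λ τ₁ → ≈-trans (∑-configurations-++ n (1 ℕ.* n) _) (∑-cong C λ τ₂ →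
           -- `3 * n` unfolds to n + (n + (n + 0)); the trailing block has a single, empty
           -- configuration.
           ≈-trans (∑-configurations-++ n 0 _) (∑-cong C λ τ₃ →
             ≈-trans (+ᴿ-identityʳ (f (concat (τ₁ ∷ τ₂ ∷ τ₃ ∷ [])))) (h τ₁ τ₂ τ₃)))) ⟩
    ∑ C (λ τ₁ → ∑ C (λ τ₂ → ∑ C (λ τ₃ → g₁ τ₁ *ᴿ (g₂ τ₂ *ᴿ g₃ τ₃))))
      ≈⟨ ∑-cong C (λ τ₁ → ≈-trans
           (∑-cong C λ τ₂ → ≈-trans (≈-sym (*-∑ C (g₁ τ₁) _)) (*ᴿ-congˡ (g₁ τ₁) (≈-sym (*-∑ C (g₂ τ₂) g₃))))
           (≈-trans (≈-sym (*-∑ C (g₁ τ₁) _)) (*ᴿ-congˡ (g₁ τ₁) (≈-sym (∑-* C g₂ (∑ C g₃)))))) ⟩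
    ∑ C (λ τ₁ → g₁ τ₁ *ᴿ (∑ C g₂ *ᴿ ∑ C g₃))
      ≈⟨ ≈-sym (∑-* C g₁ (∑ C g₂ *ᴿ ∑ C g₃)) ⟩
    ∑ C g₁ *ᴿ (∑ C g₂ *ᴿ ∑ C g₃) ∎
  where
  open SetoidReasoning ≈-setoid
  C = configurations n

∑₃ : (Sign → Sign → Sign → ℝ) → ℝ
∑₃ f = ∑ (configurations 3) λ σ → f (lookup σ 0F) (lookup σ 1F) (lookup σ 2F)

∑₃-cong : ∀ f g → (∀ p q r → f p q r ≈ g p q r) → ∑₃ f ≈ ∑₃ g
∑₃-cong f g h = ∑-cong (configurations 3)
  {λ σ → f (lookup σ 0F) (lookup σ 1F) (lookup σ 2F)} {λ σ → g (lookup σ 0F) (lookup σ 1F) (lookup σ 2F)}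
  λ σ → h (lookup σ 0F) (lookup σ 1F) (lookup σ 2F)

∑-configurations-3+ : ∀ n f → ∑ (configurations (3 + n)) f
  ≈ ∑₃ λ p q r → ∑ (configurations n) (λ τ → f (p ∷ q ∷ r ∷ τ))
∑-configurations-3+ = ∑-configurations-++ 3

cornerZ-amalgam : ∀ k G a b c → cornerZ k (amalgam G) a b c ≈
  ∑₃ λ p q r → cornerZ k G a p q *ᴿ (cornerZ k G p b r *ᴿ cornerZ k G q r c)
cornerZ-amalgam k G a b c = ≈-trans (∑-configurations-3+ (3 ℕ.* i G) f)
  (∑₃-cong (λ p q r → ∑ (configurations (3 ℕ.* i G)) (λ τ → f (p ∷ q ∷ r ∷ τ))) _ λ p q r →
    ∑-configurations-concat (i G) (λ τ → f (p ∷ q ∷ r ∷ τ)) _ _ _ (weight-amalgam k G a b c p q r))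
  where f = λ σ → weight k (cornerEdges (amalgam G)) (a ∷ b ∷ c ∷ σ)

pairSum : Sign → Sign → Sign → ℝ
pairSum a b c = spin a *ᴿ spin b +ᴿ spin a *ᴿ spin c +ᴿ spin b *ᴿ spin c

-- Spin reversal of p, q, r cancels the terms of odd degree; the others give D ↦ 8 D³ (t + 1), t ↦ t² - t + 1.
∑₃-pairSum : ∀ D t a b c →
  let M = λ a b c → D *ᴿ (t +ᴿ pairSum a b c) in
  ∑₃ (λ p q r → M a p q *ᴿ (M p b r *ᴿ M q r c))
    ≈ (ℕ→ℝ 8 *ᴿ D ^ᴿ 3 *ᴿ (t +ᴿ 1ᴿ)) *ᴿ ((t *ᴿ t -ᴿ t +ᴿ 1ᴿ) +ᴿ pairSum a b c)
∑₃-pairSum D t a b c = ≈-pointwise λ n → solve 5 (λ D t a b c →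
    let ↑ = con 1ℚ
        ↓ = :- con 1ℚ
        M = λ a b c → D :* (t :+ (a :* b :+ a :* c :+ b :* c))
        N = λ p q r → M a p q :* (M p b r :* M q r c)
    in N ↑ ↑ ↑ :+ (N ↑ ↑ ↓ :+ (N ↑ ↓ ↑ :+ (N ↑ ↓ ↓ :+ (N ↓ ↑ ↑ :+ (N ↓ ↑ ↓ :+ (N ↓ ↓ ↑ :+ (N ↓ ↓ ↓ :+ con 0ℚ)))))))
       := (con (ℕ→ℚ 8) :* (D :* (D :* (D :* con 1ℚ))) :* (t :+ con 1ℚ)) :* ((t :* t :- t :+ con 1ℚ) :+ (a :* b :+ a :* c :+ b :* c)))
  refl (seq D n) (seq t n) (seq (spin a) n) (seq (spin b) n) (seq (spin c) n)

-- The product Φ and the recursion over the gluing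

-- The bound `k ≤ n` is passed on because the exponents satisfy suc n ∸ k = suc (n ∸ k) only in that
-- range.
∏₁-cong : ∀ n {f g : (k : ℕ) → .{{NonZero k}} → ℝ} → (∀ k .{{_ : NonZero k}} → k ℕ.≤ n → f k ≈ g k) →
  ∏₁ n f ≈ ∏₁ n g
∏₁-cong zero    h = ≈-refl
∏₁-cong (suc n) h = *ᴿ-cong (∏₁-cong n λ k k≤n → h k (ℕ.m≤n⇒m≤1+n k≤n)) (h (suc n) ℕ.≤-refl)

∏₁-^ : ∀ n (f : (k : ℕ) → .{{NonZero k}} → ℝ) m → ∏₁ n (λ k → f k ^ᴿ m) ≈ ∏₁ n f ^ᴿ m
∏₁-^ zero    f m = ≈-sym (1^ m)
∏₁-^ (suc n) f m = ≈-trans (*ᴿ-congʳ (f (suc n) ^ᴿ m) (∏₁-^ n f m))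
  (≈-sym (^-distrib-* (∏₁ n f) (f (suc n)) m))

-- Φ n z = Φ-factor n z * (φ (n + 1) z - 1)
Φ-factor : ℕ → (z : ℝ) → Positive z → ℝ
Φ-factor n z 0<z = sqrt z 0<z ^ᴿ (3 ^ n) *ᴿ ∏₁ n (λ k → φ k z 0<z ^ᴿ (3 ^ (n ∸ k)))

-- All old exponents triple, and the new factor k = n + 1 enters with exponent 3⁰. This matches D ↦
-- 8 D³ (t + 1), with t + 1 = φ_{n+1}.
Φ-factor-suc : ∀ n z 0<z → Φ-factor (suc n) z 0<z ≈ Φ-factor n z 0<z ^ᴿ 3 *ᴿ φ (suc n) z 0<z
Φ-factor-suc n z 0<z = begin
    s ^ᴿ (3 ^ suc n) *ᴿ (∏₁ n (λ k → φ k z 0<z ^ᴿ (3 ^ (suc n ∸ k))) *ᴿ φ (suc n) z 0<z ^ᴿ (3 ^ (n ∸ n)))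
      ≈⟨ *ᴿ-cong (^-* s 3 (3 ^ n)) (*ᴿ-cong
           (≈-trans (∏₁-cong n λ k k≤n → ≈-trans
               (≈-reflexive (cong (λ m → φ k z 0<z ^ᴿ (3 ^ m)) (ℕ.+-∸-assoc 1 k≤n)))
               (^-* (φ k z 0<z) 3 (3 ^ (n ∸ k))))
             (∏₁-^ n (λ k → φ k z 0<z ^ᴿ (3 ^ (n ∸ k))) 3))
           (≈-trans (≈-reflexive (cong (λ m → φ (suc n) z 0<z ^ᴿ (3 ^ m)) (ℕ.n∸n≡0 n)))
             (≈-pointwise λ i → ℚ.*-identityʳ (seq (φ (suc n) z 0<z) i)))) ⟩
    S ^ᴿ 3 *ᴿ (P ^ᴿ 3 *ᴿ φ (suc n) z 0<z)
      ≈⟨ ≈-sym (*ᴿ-assoc (S ^ᴿ 3) (P ^ᴿ 3) (φ (suc n) z 0<z)) ⟩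
    S ^ᴿ 3 *ᴿ P ^ᴿ 3 *ᴿ φ (suc n) z 0<z
      ≈⟨ *ᴿ-congʳ (φ (suc n) z 0<z) (≈-sym (^-distrib-* S P 3)) ⟩
    Φ-factor n z 0<z ^ᴿ 3 *ᴿ φ (suc n) z 0<z ∎
  where
  open SetoidReasoning ≈-setoid
  s = sqrt z 0<z
  S = s ^ᴿ (3 ^ n)
  P = ∏₁ n (λ k → φ k z 0<z ^ᴿ (3 ^ (n ∸ k)))

-- One √z cancels the denominator of φ_1 and the other two multiply to z; here the half powers
-- disappear.
Φ-factor-1 : ∀ z 0<z → Φ-factor 1 z 0<z ≈ z *ᴿ (z +ᴿ 1ᴿ)
Φ-factor-1 z 0<z = ≈-trans
  (≈-pointwise λ n → solve 2 (λ s f → (s :* (s :* (s :* con 1ℚ))) :* (con 1ℚ :* (f :* con 1ℚ)) := (s :* s) :* (s :* f))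
    refl (seq s n) (seq (φ 1 z 0<z) n))
  (*ᴿ-cong (sqrt-square z 0<z) (÷-*-cancel (z +ᴿ 1ᴿ) s (sqrt-pos 0<z)))
  where s = sqrt z 0<z


spin² : ∀ a → spin a *ᴿ spin a ≈ 1ᴿ
spin² Sign.+ = ≈-pointwise λ _ → refl
spin² Sign.- = ≈-pointwise λ _ → refl

-- With S = ab + ac + bc and squares of spins equal to 1, (1 + z ab)(1 + z ac)(1 + z bc) = 1 + z³ +
-- (z + z²) S = (z + 1)((z² + 1) + z (S - 1)), and z² + 1 = z φ_2.
cornerZ-triangle : ∀ k (0<z : Positive (tanh k)) a b c → let z = tanh k in
  cornerZ k triangle a b c ≈ cosh k ^ᴿ 3 *ᴿ (z *ᴿ (z +ᴿ 1ᴿ)) *ᴿ ((φ 2 z 0<z -ᴿ 1ᴿ) +ᴿ pairSum a b c)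
cornerZ-triangle k 0<z a b c = begin
    edgeWeight k a b *ᴿ (edgeWeight k a c *ᴿ (edgeWeight k b c *ᴿ 1ᴿ)) +ᴿ 0ᴿ
      ≈⟨ +ᴿ-cong (*ᴿ-cong (edgeWeight-tanh k a b) (*ᴿ-cong (edgeWeight-tanh k a c)
           (*ᴿ-congʳ 1ᴿ (edgeWeight-tanh k b c)))) (≈-refl {0ᴿ}) ⟩
    (C *ᴿ (1ᴿ +ᴿ z *ᴿ (A *ᴿ B))) *ᴿ ((C *ᴿ (1ᴿ +ᴿ z *ᴿ (A *ᴿ D))) *ᴿ ((C *ᴿ (1ᴿ +ᴿ z *ᴿ (B *ᴿ D))) *ᴿ 1ᴿ)) +ᴿ 0ᴿ
      -- To the solver the spins are free variables, so their squares are first collected into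
      -- separate factors that `spin²` can replace.
      ≈⟨ ≈-pointwise (λ n → solve 5 (λ C z A B D →
           (C :* (con 1ℚ :+ z :* (A :* B))) :* ((C :* (con 1ℚ :+ z :* (A :* D))) :* ((C :* (con 1ℚ :+ z :* (B :* D))) :* con 1ℚ)) :+ con 0ℚ
           := (C :* (C :* (C :* con 1ℚ))) :* ((con 1ℚ :+ z :* z :* z :* ((A :* A) :* ((B :* B) :* (D :* D)))) :+ z :* (A :* B :+ A :* D :+ B :* D)
             :+ z :* z :* ((D :* D) :* (A :* B) :+ (B :* B) :* (A :* D) :+ (A :* A) :* (B :* D))))
           refl (seq C n) (seq z n) (seq A n) (seq B n) (seq D n)) ⟩
    C ^ᴿ 3 *ᴿ ((1ᴿ +ᴿ z *ᴿ z *ᴿ z *ᴿ ((A *ᴿ A) *ᴿ ((B *ᴿ B) *ᴿ (D *ᴿ D)))) +ᴿ z *ᴿ (A *ᴿ B +ᴿ A *ᴿ D +ᴿ B *ᴿ D)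
      +ᴿ z *ᴿ z *ᴿ ((D *ᴿ D) *ᴿ (A *ᴿ B) +ᴿ (B *ᴿ B) *ᴿ (A *ᴿ D) +ᴿ (A *ᴿ A) *ᴿ (B *ᴿ D)))
      ≈⟨ *ᴿ-congˡ (C ^ᴿ 3) (+ᴿ-cong
           (+ᴿ-cong (+ᴿ-cong {1ᴿ} ≈-refl (*ᴿ-congˡ (z *ᴿ z *ᴿ z) (*ᴿ-cong (spin² a) (*ᴿ-cong (spin² b) (spin² c)))))
             (≈-refl {z *ᴿ pairSum a b c}))
           (*ᴿ-congˡ (z *ᴿ z) (+ᴿ-cong (+ᴿ-cong (*ᴿ-congʳ (A *ᴿ B) (spin² c)) (*ᴿ-congʳ (A *ᴿ D) (spin² b)))
             (*ᴿ-congʳ (B *ᴿ D) (spin² a))))) ⟩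
    C ^ᴿ 3 *ᴿ ((1ᴿ +ᴿ z *ᴿ z *ᴿ z *ᴿ (1ᴿ *ᴿ (1ᴿ *ᴿ 1ᴿ))) +ᴿ z *ᴿ (A *ᴿ B +ᴿ A *ᴿ D +ᴿ B *ᴿ D)
      +ᴿ z *ᴿ z *ᴿ (1ᴿ *ᴿ (A *ᴿ B) +ᴿ 1ᴿ *ᴿ (A *ᴿ D) +ᴿ 1ᴿ *ᴿ (B *ᴿ D)))
      ≈⟨ ≈-pointwise (λ n → solve 5 (λ K z A B D →
           K :* ((con 1ℚ :+ z :* z :* z :* (con 1ℚ :* (con 1ℚ :* con 1ℚ))) :+ z :* (A :* B :+ A :* D :+ B :* D)
             :+ z :* z :* (con 1ℚ :* (A :* B) :+ con 1ℚ :* (A :* D) :+ con 1ℚ :* (B :* D)))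
           := K :* ((z :+ con 1ℚ) :* ((z :* (z :* con 1ℚ) :+ con 1ℚ) :+ z :* (A :* B :+ A :* D :+ B :* D :- con 1ℚ))))
           refl (seq (C ^ᴿ 3) n) (seq z n) (seq A n) (seq B n) (seq D n)) ⟩
    C ^ᴿ 3 *ᴿ ((z +ᴿ 1ᴿ) *ᴿ ((z ^ᴿ 2 +ᴿ 1ᴿ) +ᴿ z *ᴿ (pairSum a b c -ᴿ 1ᴿ)))
      ≈⟨ *ᴿ-congˡ (C ^ᴿ 3) (*ᴿ-congˡ (z +ᴿ 1ᴿ)
           (+ᴿ-cong (≈-sym (÷-*-cancel (z ^ᴿ 2 +ᴿ 1ᴿ) z 0<z)) (≈-refl {z *ᴿ (pairSum a b c -ᴿ 1ᴿ)}))) ⟩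
    C ^ᴿ 3 *ᴿ ((z +ᴿ 1ᴿ) *ᴿ (z *ᴿ φ 2 z 0<z +ᴿ z *ᴿ (pairSum a b c -ᴿ 1ᴿ)))
      ≈⟨ ≈-pointwise (λ n → solve 4 (λ K z f s →
           K :* ((z :+ con 1ℚ) :* (z :* f :+ z :* (s :- con 1ℚ))) := K :* (z :* (z :+ con 1ℚ)) :* ((f :- con 1ℚ) :+ s))
           refl (seq (C ^ᴿ 3) n) (seq z n) (seq (φ 2 z 0<z) n) (seq (pairSum a b c) n)) ⟩
    C ^ᴿ 3 *ᴿ (z *ᴿ (z +ᴿ 1ᴿ)) *ᴿ ((φ 2 z 0<z -ᴿ 1ᴿ) +ᴿ pairSum a b c) ∎
  where
  open SetoidReasoning ≈-setoid
  C = cosh k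
  z = tanh k
  A = spin a
  B = spin b
  D = spin c

-- The induction runs on the doubled count 3 + 2i = 3ⁿ, which the step i ↦ 3 + 3i multiplies by 3;
-- the division comes only at the end.
∣V∣-Γ : ∀ n .{{_ : NonZero n}} → ∣V∣ (Γ n) ≡ (3 ^ n + 3) / 2
∣V∣-Γ n = trans (sym (ℕ.m*n/n≡m (3 + i (Γ′ n)) 2))
  (cong (_/ 2) (trans (ℕ.*-distribʳ-+ 2 3 (i (Γ′ n))) (trans (cong (3 +_) (inner n)) (ℕ.+-comm 3 (3 ^ n)))))
  where
  inner : ∀ n .{{_ : NonZero n}} → 3 + i (Γ′ n) ℕ.* 2 ≡ 3 ^ n
  inner 1 = refl
  inner (suc n@(suc _)) = trans
    (ℕS.solve 1 (λ i → ℕS.con 3 ℕS.:+ (ℕS.con 3 ℕS.:+ ℕS.con 3 ℕS.:* i) ℕS.:* ℕS.con 2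
       ℕS.:= ℕS.con 3 ℕS.:* (ℕS.con 3 ℕS.:+ i ℕS.:* ℕS.con 2)) refl (i (Γ′ n)))
    (cong (3 ℕ.*_) (inner n))
    where module ℕS = ℕ.+-*-Solver

cornerZ-Γ : ∀ n .{{_ : NonZero n}} k (0<z : Positive (tanh k)) a b c →
  cornerZ k (Γ′ n) a b c ≈
    ℕ→ℝ 2 ^ᴿ i (Γ′ n) *ᴿ cosh k ^ᴿ (3 ^ n) *ᴿ Φ-factor n (tanh k) 0<z
      *ᴿ ((φ (suc n) (tanh k) 0<z -ᴿ 1ᴿ) +ᴿ pairSum a b c)
cornerZ-Γ 1 k 0<z a b c = ≈-trans (cornerZ-triangle k 0<z a b c)
  (*ᴿ-congʳ ((φ 2 (tanh k) 0<z -ᴿ 1ᴿ) +ᴿ pairSum a b c) (*ᴿ-cong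
    (≈-sym (*ᴿ-identityˡ (cosh k ^ᴿ 3))) (≈-sym (Φ-factor-1 (tanh k) 0<z))))
cornerZ-Γ (suc n@(suc _)) k 0<z a b c = begin
    cornerZ k (amalgam (Γ′ n)) a b c
      ≈⟨ cornerZ-amalgam k (Γ′ n) a b c ⟩
    ∑₃ (λ p q r → Z a p q *ᴿ (Z p b r *ᴿ Z q r c))
      ≈⟨ ∑₃-cong _ (λ p q r → M a p q *ᴿ (M p b r *ᴿ M q r c)) (λ p q r →
           *ᴿ-cong (cornerZ-Γ n k 0<z a p q)
             (*ᴿ-cong (cornerZ-Γ n k 0<z p b r) (cornerZ-Γ n k 0<z q r c))) ⟩
    ∑₃ (λ p q r → M a p q *ᴿ (M p b r *ᴿ M q r c))
      ≈⟨ ∑₃-pairSum D t a b c ⟩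
    (ℕ→ℝ 8 *ᴿ D ^ᴿ 3 *ᴿ (t +ᴿ 1ᴿ)) *ᴿ ((t *ᴿ t -ᴿ t +ᴿ 1ᴿ) +ᴿ s)
      ≈⟨ *ᴿ-cong
           (*ᴿ-cong {ℕ→ℝ 8 *ᴿ D ^ᴿ 3} {ℕ→ℝ 8 *ᴿ (W ^ᴿ 3 *ᴿ Bₙ ^ᴿ 3)}
             (*ᴿ-congˡ (ℕ→ℝ 8) (^-distrib-* W Bₙ 3))
             (≈-pointwise {y = f} λ n → solve 1 (λ f → (f :- con 1ℚ) :+ con 1ℚ := f) refl (seq f n)))
           (+ᴿ-cong {y = s}
             -- As n ≥ 1, the index n + 2 is at least 3 and φ unfolds by its recursion: for t = f -
             -- 1, t² - t + 1 = (f² - 3f + 4) - 1.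
             (≈-pointwise {y = φ (suc (suc n)) z 0<z -ᴿ 1ᴿ} λ n → solve 1 (λ f →
               let t = f :- con 1ℚ in
               t :* t :- t :+ con 1ℚ
                 := ((f :* (f :* con 1ℚ) :- con (ℕ→ℚ 3) :* f) :+ con (ℕ→ℚ 4)) :- con 1ℚ) refl (seq f n))
             ≈-refl) ⟩
    (ℕ→ℝ 8 *ᴿ (W ^ᴿ 3 *ᴿ Bₙ ^ᴿ 3) *ᴿ f) *ᴿ ((φ (suc (suc n)) z 0<z -ᴿ 1ᴿ) +ᴿ s)
      ≈⟨ *ᴿ-congʳ ((φ (suc (suc n)) z 0<z -ᴿ 1ᴿ) +ᴿ s) (begin
           ℕ→ℝ 8 *ᴿ (W ^ᴿ 3 *ᴿ Bₙ ^ᴿ 3) *ᴿ f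
             ≈⟨ ≈-pointwise (λ n → solve 4 (λ e w b f → e :* (w :* b) :* f := (e :* w) :* (b :* f)) refl
                  (ℕ→ℚ 8) (seq (W ^ᴿ 3) n) (seq (Bₙ ^ᴿ 3) n) (seq f n)) ⟩
           (ℕ→ℝ 8 *ᴿ W ^ᴿ 3) *ᴿ (Bₙ ^ᴿ 3 *ᴿ f)
             ≈⟨ *ᴿ-cong scale (≈-sym (Φ-factor-suc n z 0<z)) ⟩
           ℕ→ℝ 2 ^ᴿ (3 + 3 ℕ.* m) *ᴿ cosh k ^ᴿ (3 ^ suc n) *ᴿ Φ-factor (suc n) z 0<z ∎) ⟩
    ℕ→ℝ 2 ^ᴿ (3 + 3 ℕ.* m) *ᴿ cosh k ^ᴿ (3 ^ suc n) *ᴿ Φ-factor (suc n) z 0<z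
      *ᴿ ((φ (suc (suc n)) z 0<z -ᴿ 1ᴿ) +ᴿ s) ∎
  where
  open SetoidReasoning ≈-setoid
  z = tanh k
  m = i (Γ′ n)
  f = φ (suc n) z 0<z
  t = f -ᴿ 1ᴿ
  s = pairSum a b c
  Z = cornerZ k (Γ′ n)
  W = ℕ→ℝ 2 ^ᴿ m *ᴿ cosh k ^ᴿ (3 ^ n)
  Bₙ = Φ-factor n z 0<z
  D = W *ᴿ Bₙ
  M = λ a b c → D *ᴿ (t +ᴿ pairSum a b c)
  -- The factor 8 = 2³ stands for the three glued vertices, which become inner ones: m grows to 3 +
  -- 3m.
  scale : ℕ→ℝ 8 *ᴿ W ^ᴿ 3 ≈ ℕ→ℝ 2 ^ᴿ (3 + 3 ℕ.* m) *ᴿ cosh k ^ᴿ (3 ^ suc n)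
  scale = ≈-trans (*ᴿ-congˡ (ℕ→ℝ 8) (^-distrib-* (ℕ→ℝ 2 ^ᴿ m) (cosh k ^ᴿ (3 ^ n)) 3))
    (≈-trans (≈-sym (*ᴿ-assoc (ℕ→ℝ 8) ((ℕ→ℝ 2 ^ᴿ m) ^ᴿ 3) ((cosh k ^ᴿ (3 ^ n)) ^ᴿ 3)))
      (*ᴿ-cong
        (≈-sym (≈-trans (^-+ (ℕ→ℝ 2) 3 (3 ℕ.* m))
          (*ᴿ-cong {ℕ→ℝ 2 ^ᴿ 3} {ℕ→ℝ 8} (≈-pointwise λ _ → refl) (^-* (ℕ→ℝ 2) 3 m))))
        (≈-sym (^-* (cosh k) 3 (3 ^ n)))))

-- A product of two distinct spins averages to zero. The 8 contributes the three outmost vertices to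
-- the power of 2.
∑₃-pairSum-cancel : ∀ D t → ∑₃ (λ p q r → D *ᴿ (t +ᴿ pairSum p q r)) ≈ ℕ→ℝ 8 *ᴿ (D *ᴿ t)
∑₃-pairSum-cancel D t = ≈-pointwise λ n → solve 2 (λ D t →
    let ↑ = con 1ℚ
        ↓ = :- con 1ℚ
        N = λ p q r → D :* (t :+ (p :* q :+ p :* r :+ q :* r))
    in N ↑ ↑ ↑ :+ (N ↑ ↑ ↓ :+ (N ↑ ↓ ↑ :+ (N ↑ ↓ ↓ :+ (N ↓ ↑ ↑ :+ (N ↓ ↑ ↓ :+ (N ↓ ↓ ↑ :+ (N ↓ ↓ ↓ :+ con 0ℚ)))))))
       := con (ℕ→ℚ 8) :* (D :* t))
  refl (seq D n) (seq t n)

∑weight-Γ : ∀ n .{{_ : NonZero n}} k (0<z : Positive (tanh k)) →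
  ∑ (configurations (∣V∣ (Γ n))) (weight k (edges (Γ n)))
    ≈ ℕ→ℝ 2 ^ᴿ ((3 ^ n + 3) / 2) *ᴿ cosh k ^ᴿ (3 ^ n) *ᴿ Φ n (tanh k) 0<z
∑weight-Γ n k 0<z = begin
    ∑ (configurations (3 + m)) (weight k (edges (Γ n)))
      ≈⟨ ∑-configurations-3+ m (weight k (edges (Γ n))) ⟩
    ∑₃ (cornerZ k (Γ′ n))
      ≈⟨ ∑₃-cong (cornerZ k (Γ′ n)) (λ p q r → D *ᴿ (t +ᴿ pairSum p q r)) (cornerZ-Γ n k 0<z) ⟩
    ∑₃ (λ p q r → D *ᴿ (t +ᴿ pairSum p q r))
      ≈⟨ ∑₃-pairSum-cancel D t ⟩
    ℕ→ℝ 8 *ᴿ (D *ᴿ t)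
      ≈⟨ ≈-pointwise (λ j → solve 4 (λ p c b t → con (ℕ→ℚ 8) :* (((p :* c) :* b) :* t)
           := ((con (ℕ→ℚ 2) :* (con (ℕ→ℚ 2) :* (con (ℕ→ℚ 2) :* p))) :* c) :* (b :* t)) refl
           (seq (ℕ→ℝ 2 ^ᴿ m) j) (seq (cosh k ^ᴿ (3 ^ n)) j) (seq (Φ-factor n z 0<z) j) (seq t j)) ⟩
    ℕ→ℝ 2 ^ᴿ (3 + m) *ᴿ cosh k ^ᴿ (3 ^ n) *ᴿ Φ n z 0<z
      ≡⟨ cong (λ v → ℕ→ℝ 2 ^ᴿ v *ᴿ cosh k ^ᴿ (3 ^ n) *ᴿ Φ n z 0<z) (∣V∣-Γ n) ⟩
    ℕ→ℝ 2 ^ᴿ ((3 ^ n + 3) / 2) *ᴿ cosh k ^ᴿ (3 ^ n) *ᴿ Φ n z 0<z ∎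
  where
  open SetoidReasoning ≈-setoid
  z = tanh k
  m = i (Γ′ n)
  t = φ (suc n) z 0<z -ᴿ 1ᴿ
  D = ℕ→ℝ 2 ^ᴿ m *ᴿ cosh k ^ᴿ (3 ^ n) *ᴿ Φ-factor n z 0<z

tutte-Γ : ∀ n .{{_ : NonZero n}} β J (0<v : Positive (exp (ℕ→ℝ 2 *ᴿ (β *ᴿ J)) -ᴿ 1ᴿ)) →
  let k = β *ᴿ J
      e² = exp (ℕ→ℝ 2 *ᴿ k)
  in ℕ→ℝ 2 *ᴿ (e² -ᴿ 1ᴿ) ^ᴿ (∣V∣ (Γ n) ∸ 1) *ᴿ exp (-ᴿ (k *ᴿ ℕ→ℝ (∣E∣ (Γ n))))
       *ᴿ tutte (Γ n) ((e² +ᴿ 1ᴿ) ÷ (e² -ᴿ 1ᴿ) by 0<v) e²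
     ≈ isingZ (Γ n) β J
tutte-Γ n β J 0<v = fortuinKasteleyn (edges (Γ n)) (components-Γ n) β J 0<v
ising-Γ : ∀ n .{{_ : NonZero n}} β J (0<z : Positive (tanh (β *ᴿ J))) →
   isingZ (Γ n) β J ≈ ℕ→ℝ 2 ^ᴿ ((3 ^ n + 3) / 2) *ᴿ cosh (β *ᴿ J) ^ᴿ (3 ^ n) *ᴿ Φ n (tanh (β *ᴿ J)) 0<z
ising-Γ n β J 0<z = ≈-trans (isingZ≈∑weight (Γ n) β J) (∑weight-Γ n (β *ᴿ J) 0<z)

theorem3p12 : (n : ℕ) → .{{_ : NonZero n}} → (β J : ℝ) → (0<β : Positive β) → (0<J : Positive J) →
  let βJ    = β *ᴿ J
      0<βJ  = *ᴿ-pos 0<β 0<J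
      0<2βJ = *ᴿ-pos (ℕ→ℝ-pos 2) 0<βJ
      e²    = exp (ℕ→ℝ 2 *ᴿ βJ)
      rhs   = ℕ→ℝ 2 ^ᴿ ((3 ^ n + 3) / 2) *ᴿ cosh βJ ^ᴿ (3 ^ n) *ᴿ Φ n (tanh βJ) (tanh-pos 0<βJ)
  in
    (ℕ→ℝ 2 *ᴿ (e² -ᴿ 1ᴿ) ^ᴿ (∣V∣ (Γ n) ∸ 1) *ᴿ exp (-ᴿ (βJ *ᴿ ℕ→ℝ (∣E∣ (Γ n))))
      *ᴿ tutte (Γ n) ((e² +ᴿ 1ᴿ) ÷ (e² -ᴿ 1ᴿ) by exp-1-pos 0<2βJ) e²
      ≈ rhs)
    × (rhs ≈ isingZ (Γ n) β J)
theorem3p12 n β J 0<β 0<J =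
    ≈-trans (tutte-Γ n β J (exp-1-pos (*ᴿ-pos (ℕ→ℝ-pos 2) (*ᴿ-pos 0<β 0<J)))) (ising-Γ n β J (tanh-pos (*ᴿ-pos 0<β 0<J)))
  , ≈-sym (ising-Γ n β J (tanh-pos (*ᴿ-pos 0<β 0<J)))
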